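{- Let $G$ be a locally finite graph with countably many ends, and let $k$ be a positive integer. Then $G$ is $2k$-edge-connected if and only if $G$ has a $k$-arc-connected orientation.
   Context: An end of $G$ is an equivalence class of rays (one-way infinite paths), two rays being equivalent if there are infinitely many pairwise vertex-disjoint paths between them in $G$. A directed multigraph is $k$-arc-connected if for any two distinct vertices $v,w$ there are $k$ pairwise arc-disjoint directed paths from $v$ to $w$. -}

module Defs where

open import Data.Fin using (Fin)
open import Data.List using (List; []; _∷_; length)
open import Data.List.Membership.Propositional using (_∈_; _∉_)
open import Data.List.Relation.Binary.Disjoint.Propositional using (Disjoint)
open import Data.List.Relation.Unary.Unique.Propositional using (Unique)
open import Data.Nat using (ℕ; suc; _<_)
open import Data.Product using (Σ; ∃; _×_; _,_; proj₁)
open import Data.Sum using (_⊎_)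
open import Function.Definitions using (Congruent; Injective)
open import Level using (Level; _⊔_) renaming (suc to lsuc)
open import Relation.Binary.Core using (Rel)
open import Relation.Binary.PropositionalEquality using (_≡_; _≢_)

private
  variable
    a b : Level

-- Parallel edges and loops are allowed.  The two ends of an edge are listed
-- in an arbitrary order, which `Joins` below forgets.
record Graph (a b : Level) : Set (lsuc (a ⊔ b)) where
  field
    Vertex : Set a
    Edge   : Set b
    end₁   : Edge → Vertex
    end₂   : Edge → Vertex

  Joins : Edge → Vertex → Vertex → Set a
  Joins e u v = (end₁ e ≡ u × end₂ e ≡ v) ⊎ (end₁ e ≡ v × end₂ e ≡ u)

  Incident : Edge → Vertex → Set a
  Incident e v = end₁ e ≡ v ⊎ end₂ e ≡ v

record Digraph (a b : Level) : Set (lsuc (a ⊔ b)) where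
  field
    Vertex : Set a
    Arc    : Set b
    tail   : Arc → Vertex
    head   : Arc → Vertex

  Leads : Arc → Vertex → Vertex → Set a
  Leads e u v = tail e ≡ u × head e ≡ v

-- `Step u e v` says that e can be traversed from u to v; it is instantiated
-- with `Joins` for undirected and with `Leads` for directed paths.
module Paths {V : Set a} {E : Set b} (Step : E → V → V → Set a) where

  data Walk : V → V → Set (a ⊔ b) where
    nil  : ∀ {v} → Walk v v
    cons : ∀ {u v w} (e : E) → Step e u v → Walk v w → Walk u w

  walkVertices : ∀ {u v} → Walk u v → List V
  walkVertices {u} nil          = u ∷ []
  walkVertices {u} (cons _ _ p) = u ∷ walkVertices p

  walkEdges : ∀ {u v} → Walk u v → List E
  walkEdges nil          = []
  walkEdges (cons e _ p) = e ∷ walkEdges p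

  record Path (u v : V) : Set (a ⊔ b) where
    field
      walk     : Walk u v
      distinct : Unique (walkVertices walk)

    vertices : List V
    vertices = walkVertices walk

    edges : List E
    edges = walkEdges walk

module _ (G : Graph a b) where
  open Graph G
  open Paths Joins

  LocallyFinite : Set (a ⊔ b)
  LocallyFinite = ∀ v → ∃ λ (es : List Edge) → ∀ e → Incident e v → e ∈ es

  -- The empty graph and one-vertex graphs count as connected.
  Connected : Set (a ⊔ b)
  Connected = ∀ u v → Path u v

  deleteEdges : List Edge → Graph a b
  deleteEdges F = record
    { Vertex = Vertex
    ; Edge   = Σ Edge (_∉ F)
    ; end₁   = λ e → end₁ (proj₁ e)
    ; end₂   = λ e → end₂ (proj₁ e)
    }

  record Ray : Set (a ⊔ b) where
    field
      vertex   : ℕ → Vertex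
      edge     : ℕ → Edge
      joins    : ∀ n → Joins (edge n) (vertex n) (vertex (suc n))
      distinct : Injective _≡_ _≡_ vertex

  record PathBetween (R S : Ray) : Set (a ⊔ b) where
    field
      start finish : ℕ
      path         : Path (Ray.vertex R start) (Ray.vertex S finish)

    open Path path public using (vertices)

  -- Paths of length 0 at common vertices of the two rays are included.
  _∼_ : Rel Ray (a ⊔ b)
  R ∼ S = ∃ λ (P : ℕ → PathBetween R S) → ∀ i j → i ≢ j →
    Disjoint (PathBetween.vertices (P i)) (PathBetween.vertices (P j))

  -- An end is a class of rays under _∼_.  A map on rays satisfying both
  -- conditions is precisely an injection of the set of ends into ℕ, so
  -- "countably many" includes finitely many, and none.
  CountablyManyEnds : Set (a ⊔ b)
  CountablyManyEnds =
    ∃ λ (index : Ray → ℕ) → Congruent _∼_ _≡_ index × Injective _∼_ _≡_ index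

  record Orientation : Set (a ⊔ b) where
    field
      tail     : Edge → Vertex
      head     : Edge → Vertex
      oriented : ∀ e → Joins e (tail e) (head e)

    digraph : Digraph a b
    digraph = record { Vertex = Vertex ; Arc = Edge ; tail = tail ; head = head }

-- A list of length less than k represents a set of fewer than k edges.
EdgeConnected : ℕ → Graph a b → Set (a ⊔ b)
EdgeConnected k G =
  ∀ (F : List (Graph.Edge G)) → length F < k → Connected (deleteEdges G F)

ArcConnected : ℕ → Digraph a b → Set (a ⊔ b)
ArcConnected k D = ∀ v w → v ≢ w →
  ∃ λ (P : Fin k → Path v w) → ∀ i j → i ≢ j →
    Disjoint (Path.edges (P i)) (Path.edges (P j))
  where
  open Digraph D
  open Paths Leads

{-# OPTIONS --safe #-}
module Submission where

-- A pairing of a finite graph E with terminals A is a graph M of the same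
-- degree parities with d_M(X) + K ≤ d_E(X) for all X separating terminals; in
-- every Eulerian orientation of E + M such an X has at least K/2 leaving edges
-- of E.  If d_E(X) ≥ K for all these X and K is even, a pairing exists
-- (Nash-Williams): delete edges as long as d_E ≥ K persists, cut E along tight
-- sets, and finally drop terminals of degree K.
--
-- Applied to finite quotients of G with K = 2k, and combined with compactness,
-- this makes all finite cuts good.  Infinite cuts are controlled by rings:
-- pairwise edge-disjoint finite subgraphs, each 2-edge-connecting the boundary
-- of a neighbourhood of an end.  As there are only countably many ends,
-- infinitely many rings can be reserved for each of them, one after the other.
-- Every ring F has a pairing M with K = 2 as well.  In a finite quotient, an
-- Eulerian orientation of what remains of G outside the rings, together with
-- all the pairings, orients each M; then F is oriented with the net flow of M,
-- and every set splitting the boundary of the neighbourhood gets a leaving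
-- edge in F.  Hence a set X with fewer than k leaving edges splits finitely
-- many rings only, and can be made constant on neighbourhoods of all ends
-- without new leaving edges, which reduces it to a finite cut.

open import Defs
open import Axiom.ExcludedMiddle using (ExcludedMiddle)
import Algebra.Properties.CommutativeSemigroup as CommutativeSemigroup
open import Data.Bool using (Bool; true; false; not; _∧_; _∨_; _xor_; if_then_else_)
import Data.Bool.Properties as Bool
open import Data.Empty using (⊥; ⊥-elim)
open import Data.Fin using (Fin; zero; suc)
import Data.Fin.Properties as Fin
open import Data.Integer as ℤ using (ℤ; +_)
import Data.Integer.Properties as ℤ
open import Data.Integer.Tactic.RingSolver using (solve-∀)
open import Data.List using (List; []; _∷_; _++_; map; length; filter; concatMap; deduplicate; upTo; allFin)
import Data.List.Properties as List
open import Data.List.Membership.Propositional using (_∈_; _∉_; lose; find)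
open import Data.List.Membership.Propositional.Properties
  using (∈-∃++; ∈-++⁺ˡ; ∈-++⁺ʳ; ∈-++⁻; ∈-map⁺; ∈-map⁻; ∈-filter⁺; ∈-filter⁻; ∈-concatMap⁺; ∈-concatMap⁻;
         ∈-deduplicate⁺; ∈-deduplicate⁻; ∈-upTo⁺)
open import Data.List.Relation.Binary.Disjoint.Propositional using (Disjoint)
open import Data.List.Relation.Binary.Permutation.Propositional as Perm using (_↭_; ↭⇒↭ₛ)
open import Data.List.Relation.Binary.Permutation.Propositional.Properties using (shift; ↭-length; ∈-resp-↭)
import Data.List.Relation.Binary.Permutation.Propositional.Properties as Permutation
import Data.List.Relation.Binary.Permutation.Setoid.Properties as PermutationSetoid
open import Data.List.Relation.Binary.Pointwise using (Pointwise; []; _∷_)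
open import Data.List.Relation.Unary.All as All using (All; []; _∷_)
import Data.List.Relation.Unary.All.Properties as All
open import Data.List.Relation.Unary.AllPairs using ([]; _∷_)
open import Data.List.Relation.Unary.Any as Any using (Any; here; there)
open import Data.List.Relation.Unary.Unique.Propositional using (Unique)
import Data.List.Relation.Unary.Unique.DecPropositional.Properties as UniqueDec
import Data.List.Relation.Unary.Unique.Propositional.Properties as Unique
open import Data.Nat using (ℕ; zero; suc; _+_; _*_; _∸_; _≤_; _<_; z≤n; s≤s; _≤?_; _≤′_; ≤′-refl; ≤′-step; NonZero; >-nonZero⁻¹)
import Data.Nat as ℕ using (_⊔_)
open import Data.Nat.Induction using (<-wellFounded)
import Data.Nat.Properties as ℕ
open import Data.Product using (Σ; ∃; _×_; _,_; proj₁; proj₂; swap)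
import Data.Product as Product
open import Data.Sum as Sum using (_⊎_; inj₁; inj₂; [_,_]′)
open import Function using (_∘_; id; case_of_; mk⇔)
open import Function.Bundles using (_⇔_)
open import Function.Definitions using (Injective)
open import Induction.WellFounded using (Acc; acc)
open import Level using (Level; _⊔_; Lift; lift; lower)
import Level
open import Relation.Binary.Definitions using (tri<; tri≈; tri>)
open import Relation.Binary.PropositionalEquality
  using (_≡_; _≢_; refl; sym; trans; cong; cong₂; subst; setoid; module ≡-Reasoning)
open import Relation.Nullary using (Dec; yes; no; ¬_; contradiction; does; ¬?)
open import Relation.Nullary.Decidable using (from-yes; dec-true; dec-false; map′; _×-dec_; decidable-stable)

-- Compactness keeps only conditions on finitely many edges. A lower bound for the leaving edges of
-- an infinite cut is not of this kind: the leaving edges may escape to an end in the limit. That a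
-- ring has a leaving edge across every split of its boundary is of this kind, and it suffices,
-- since a set splitting infinitely many disjoint rings has infinitely many leaving edges. One edge
-- per ring means K = 2, and the 2-edge-connection asked for comes from `G` having no bridge. A ring
-- cannot be oriented in advance: its imbalances would have to be absorbed by the finite cuts
-- through it. Hence its pairing stands in for it in the Eulerian graph, and its own orientation,
-- chosen last, adapts to whatever flow the pairing gets. Other vertices of a ring than those of the
-- boundary may have small degree in it, which is why pairings refer to terminals. Countability
-- enters through the order of choice: every ring has to avoid all earlier ones, so a single
-- sequence must visit each end infinitely often.

private
  variable
    a b ℓ ℓ′ : Level
    A U V : Set ℓ

open CommutativeSemigroup ℕ.+-commutativeSemigroup using () renaming (interchange to +-interchange)

-- Inequalities between cuts reduce to the memberships of the two ends of one pair; nested uses of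
-- `bool?` check these by evaluation.
bool? : {P : Bool → Set} → (∀ x → Dec (P x)) → Dec (∀ x → P x)
bool? P? with P? true | P? false
... | yes t | yes f = yes λ { true → t ; false → f }
... | no ¬t | _     = no λ all → ¬t (all true)
... | _     | no ¬f = no λ all → ¬f (all false)

-- Parity and arithmetic

odd : ℕ → Bool
odd zero    = false
odd (suc n) = not (odd n)

odd-+ : ∀ m n → odd (m + n) ≡ odd m xor odd n
odd-+ zero    n = refl
odd-+ (suc m) n = trans (cong not (odd-+ m n)) (not-xor (odd m) (odd n))
  where
  not-xor : ∀ x y → not (x xor y) ≡ not x xor y
  not-xor true  y = Bool.not-involutive y
  not-xor false y = refl

odd-double : ∀ c → odd (c + c) ≡ false
odd-double c = trans (odd-+ c c) (Bool.xor-same (odd c))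

even-gap : ∀ {m n} → m ≤ n → odd m ≡ odd n → ∃ λ c → n ≡ m + (c + c)
even-gap {n = n} z≤n p = half n (sym p)
  where
  half : ∀ n → odd n ≡ false → ∃ λ c → n ≡ c + c
  half zero          _  = 0 , refl
  half (suc (suc n)) ev with half n (trans (sym (Bool.not-involutive (odd n))) ev)
  ... | c , refl = suc c , cong suc (sym (ℕ.+-suc c c))
even-gap (s≤s m≤n) p with even-gap m≤n (Bool.not-injective p)
... | c , refl = c , refl

+-mono₂ : ∀ {a b c d a′ b′ c′ d′} → a + b ≤ c + d → a′ + b′ ≤ c′ + d′ →
  (a + a′) + (b + b′) ≤ (c + c′) + (d + d′)
+-mono₂ {a} {b} {c} {d} {a′} {b′} {c′} {d′} p q = begin
  (a + a′) + (b + b′) ≡⟨ +-interchange a a′ b b′ ⟩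
  (a + b) + (a′ + b′) ≤⟨ ℕ.+-mono-≤ p q ⟩
  (c + d) + (c′ + d′) ≡⟨ +-interchange c d c′ d′ ⟩
  (c + c′) + (d + d′) ∎
  where open ℕ.≤-Reasoning

extract : {A : Set ℓ} {x : A} {xs : List A} → x ∈ xs → ∃ λ ys → xs ↭ x ∷ ys
extract {x = x} x∈xs with ys , zs , refl ← ∈-∃++ x∈xs = ys ++ zs , shift x ys zs

-- Cuts of finite multigraphs, given as lists of pairs

Cut : Set ℓ → Set ℓ
Cut V = V → Bool

Pairs : Set ℓ → Set ℓ
Pairs V = List (V × V)

infixr 7 _∩_
infixr 6 _∪_

_∩_ _∪_ : Cut V → Cut V → Cut V
(X ∩ Y) v = X v ∧ Y v
(X ∪ Y) v = X v ∨ Y v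

∁ : Cut V → Cut V
∁ X v = not (X v)

crossing : Bool → Bool → ℕ
crossing x y = if x xor y then 1 else 0

crossing-comm : ∀ x y → crossing x y ≡ crossing y x
crossing-comm x y = cong (if_then 1 else 0) (Bool.xor-comm x y)

crossing-≢ : ∀ {x y} → x ≢ y → crossing x y ≡ 1
crossing-≢ {true}  {true}  x≢y = contradiction refl x≢y
crossing-≢ {true}  {false} x≢y = refl
crossing-≢ {false} {true}  x≢y = refl
crossing-≢ {false} {false} x≢y = contradiction refl x≢y

crossing-refl : ∀ x → crossing x x ≡ 0
crossing-refl true  = refl
crossing-refl false = refl

crossing≤1 : ∀ x y → crossing x y ≤ 1
crossing≤1 = from-yes (bool? λ x → bool? λ y → crossing x y ≤? 1)

crossing>0 : ∀ x y → 1 ≤ crossing x y → x ≢ y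
crossing>0 x .x 1≤0 refl rewrite crossing-refl x with () ← 1≤0

crossing-triangle : ∀ x y z → crossing x z ≤ crossing y x + crossing y z
crossing-triangle = from-yes (bool? λ x → bool? λ y → bool? λ z →
  crossing x z ≤? (crossing y x + crossing y z))

cut : Pairs V → Cut V → ℕ
cut []            X = 0
cut ((p , q) ∷ E) X = crossing (X p) (X q) + cut E X

cut-cong-on : (E : Pairs V) {X Y : Cut V} → (∀ {p q} → (p , q) ∈ E → X p ≡ Y p × X q ≡ Y q) →
  cut E X ≡ cut E Y
cut-cong-on []            X≡Y = refl
cut-cong-on ((p , q) ∷ E) X≡Y =
  cong₂ _+_ (cong₂ crossing (proj₁ (X≡Y (here refl))) (proj₂ (X≡Y (here refl))))
            (cut-cong-on E (X≡Y ∘ there))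

cut-cong : (E : Pairs V) {X Y : Cut V} → (∀ v → X v ≡ Y v) → cut E X ≡ cut E Y
cut-cong E X≡Y = cut-cong-on E λ _ → X≡Y _ , X≡Y _

cut-++ : (E F : Pairs V) (X : Cut V) → cut (E ++ F) X ≡ cut E X + cut F X
cut-++ []            F X = refl
cut-++ ((p , q) ∷ E) F X = trans (cong (_+_ (crossing (X p) (X q))) (cut-++ E F X))
  (sym (ℕ.+-assoc (crossing (X p) (X q)) _ _))

cut-map : (f : U → V) (E : Pairs U) (X : Cut V) → cut (map (Product.map f f) E) X ≡ cut E (X ∘ f)
cut-map f []      X = refl
cut-map f (e ∷ E) X = cong (_+_ _) (cut-map f E X)

cut-↭ : {E F : Pairs V} → E ↭ F → ∀ X → cut E X ≡ cut F X
cut-↭ Perm.refl                 X = refl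
cut-↭ (Perm.prep (p , q) E↭F)   X = cong (_+_ (crossing (X p) (X q))) (cut-↭ E↭F X)
cut-↭ (Perm.swap {ys = F} (p , q) (r , s) E↭F) X = begin
  c + (d + _)       ≡⟨ cong (λ t → c + (d + t)) (cut-↭ E↭F X) ⟩
  c + (d + cut F X) ≡⟨ ℕ.+-assoc c d _ ⟨
  c + d + cut F X   ≡⟨ cong (_+ cut F X) (ℕ.+-comm c d) ⟩
  d + c + cut F X   ≡⟨ ℕ.+-assoc d c _ ⟩
  d + (c + cut F X) ∎
  where
  open ≡-Reasoning
  c = crossing (X p) (X q)
  d = crossing (X r) (X s)
cut-↭ (Perm.trans E↭F F↭G)      X = trans (cut-↭ E↭F X) (cut-↭ F↭G X)

cut-∁ : (E : Pairs V) (X : Cut V) → cut E (∁ X) ≡ cut E X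
cut-∁ []            X = refl
cut-∁ ((p , q) ∷ E) X = cong₂ _+_ (crossing-not (X p) (X q)) (cut-∁ E X)
  where
  crossing-not : ∀ x y → crossing (not x) (not y) ≡ crossing x y
  crossing-not = from-yes (bool? λ x → bool? λ y → crossing (not x) (not y) ℕ.≟ crossing x y)

cut-submodular : (E : Pairs V) (X Y : Cut V) → cut E (X ∩ Y) + cut E (X ∪ Y) ≤ cut E X + cut E Y
cut-submodular []            X Y = z≤n
cut-submodular ((p , q) ∷ E) X Y =
  +-mono₂ {a = crossing (X p ∧ Y p) (X q ∧ Y q)} {c = crossing (X p) (X q)}
    (pointwise (X p) (X q) (Y p) (Y q)) (cut-submodular E X Y)
  where
  pointwise : ∀ x x′ y y′ →
    crossing (x ∧ y) (x′ ∧ y′) + crossing (x ∨ y) (x′ ∨ y′) ≤ crossing x x′ + crossing y y′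
  pointwise = from-yes (bool? λ x → bool? λ x′ → bool? λ y → bool? λ y′ →
    (crossing (x ∧ y) (x′ ∧ y′) + crossing (x ∨ y) (x′ ∨ y′)) ≤? (crossing x x′ + crossing y y′))

cut-∪ : (E : Pairs V) (X Y : Cut V) → cut E (X ∪ Y) ≤ cut E X + cut E Y
cut-∪ E X Y = ℕ.≤-trans (ℕ.m≤n+m _ _) (cut-submodular E X Y)

-- Modulo 2, cuts are linear under symmetric difference. `Z` is kept separate because both disjoint
-- unions and partitions of a set occur below.
cut-xor : (E : Pairs V) {X Y Z : Cut V} → (∀ v → Z v ≡ X v xor Y v) →
  odd (cut E Z) ≡ odd (cut E X) xor odd (cut E Y)
cut-xor []            Z≡ = refl
cut-xor ((p , q) ∷ E) {X} {Y} {Z} Z≡ rewrite Z≡ p | Z≡ q = begin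
  odd (crossing (X p xor Y p) (X q xor Y q) + cut E Z)
    ≡⟨ odd-+ (crossing (X p xor Y p) (X q xor Y q)) _ ⟩
  odd (crossing (X p xor Y p) (X q xor Y q)) xor odd (cut E Z)
    ≡⟨ cong₂ _xor_ (pointwise (X p) (X q) (Y p) (Y q)) (cut-xor E Z≡) ⟩
  (odd (crossing (X p) (X q)) xor odd (crossing (Y p) (Y q))) xor (odd (cut E X) xor odd (cut E Y))
    ≡⟨ xor-interchange (odd (crossing (X p) (X q))) (odd (crossing (Y p) (Y q))) (odd (cut E X)) _ ⟩
  (odd (crossing (X p) (X q)) xor odd (cut E X)) xor (odd (crossing (Y p) (Y q)) xor odd (cut E Y))
    ≡⟨ cong₂ _xor_ (odd-+ (crossing (X p) (X q)) _) (odd-+ (crossing (Y p) (Y q)) _) ⟨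
  odd (crossing (X p) (X q) + cut E X) xor odd (crossing (Y p) (Y q) + cut E Y) ∎
  where
  open ≡-Reasoning
  pointwise : ∀ x x′ y y′ →
    odd (crossing (x xor y) (x′ xor y′)) ≡ odd (crossing x x′) xor odd (crossing y y′)
  pointwise = from-yes (bool? λ x → bool? λ x′ → bool? λ y → bool? λ y′ →
    odd (crossing (x xor y) (x′ xor y′)) Bool.≟ (odd (crossing x x′) xor odd (crossing y y′)))
  xor-interchange : ∀ a b c d → (a xor b) xor (c xor d) ≡ (a xor c) xor (b xor d)
  xor-interchange = from-yes (bool? λ a → bool? λ b → bool? λ c → bool? λ d →
    ((a xor b) xor (c xor d)) Bool.≟ ((a xor c) xor (b xor d)))

cut-∈ : {E : Pairs V} {p q : V} {X : Cut V} → (p , q) ∈ E → X p ≢ X q → 1 ≤ cut E X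
cut-∈ {X = X} (here refl)  Xp≢Xq = ℕ.≤-trans (ℕ.≤-reflexive (sym (crossing-≢ Xp≢Xq))) (ℕ.m≤m+n _ _)
cut-∈         (there pq∈E) Xp≢Xq = ℕ.≤-trans (cut-∈ pq∈E Xp≢Xq) (ℕ.m≤n+m _ _)

cut>0 : (E : Pairs V) (X : Cut V) → 1 ≤ cut E X → ∃ λ p → ∃ λ q → (p , q) ∈ E × X p ≢ X q
cut>0 ((p , q) ∷ E) X 1≤cut with X p Bool.≟ X q
... | no  Xp≢Xq = p , q , here refl , Xp≢Xq
... | yes Xp≡Xq rewrite Xp≡Xq | crossing-refl (X q) with r , s , rs∈E , ≢ ← cut>0 E X 1≤cut =
  r , s , there rs∈E , ≢

-- Odd-vertex pairings

cut-balance-on : (E : Pairs V) {X Y Z W : Cut V} →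
  (∀ {p q} → (p , q) ∈ E →
    crossing (X p) (X q) + crossing (Y p) (Y q) ≡ crossing (Z p) (Z q) + crossing (W p) (W q)) →
  cut E X + cut E Y ≡ cut E Z + cut E W
cut-balance-on []            _  = refl
cut-balance-on ((p , q) ∷ E) {X} {Y} {Z} {W} eq = begin
  (crossing (X p) (X q) + cut E X) + (crossing (Y p) (Y q) + cut E Y)
    ≡⟨ +-interchange (crossing (X p) (X q)) _ _ _ ⟩
  (crossing (X p) (X q) + crossing (Y p) (Y q)) + (cut E X + cut E Y)
    ≡⟨ cong₂ _+_ (eq (here refl)) (cut-balance-on E (eq ∘ there)) ⟩
  (crossing (Z p) (Z q) + crossing (W p) (W q)) + (cut E Z + cut E W)
    ≡⟨ +-interchange (crossing (Z p) (Z q)) _ _ _ ⟩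
  (crossing (Z p) (Z q) + cut E Z) + (crossing (W p) (W q) + cut E W) ∎
  where
  open ≡-Reasoning

cut-∩ : (E : Pairs V) (X Y : Cut V) → cut E (X ∩ Y) ≤ cut E X + cut E Y
cut-∩ E X Y = ℕ.≤-trans (ℕ.m≤m+n _ _) (cut-submodular E X Y)

false≢true : false ≢ true
false≢true ()

does-true : {P : Set ℓ} (P? : Dec P) → does P? ≡ true → P
does-true (yes p) _ = p

module Pairings (em : ExcludedMiddle ℓ) {V : Set ℓ} where

  infix 4 _≟_
  _≟_ : (x y : V) → Dec (x ≡ y)
  x ≟ y = em

  ｛_｝ : V → Cut V
  ｛ v ｝ w = does (w ≟ v)

  ｛｝-∈ : ∀ v → ｛ v ｝ v ≡ true
  ｛｝-∈ v = dec-true (v ≟ v) refl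

  ｛｝-∉ : ∀ {v w} → w ≢ v → ｛ v ｝ w ≡ false
  ｛｝-∉ {v} {w} w≢v = dec-false (w ≟ v) w≢v

  ｛｝-true : ∀ {v w} → ｛ v ｝ w ≡ true → w ≡ v
  ｛｝-true {v} {w} = does-true (w ≟ v)

  Splits : List V → Cut V → Set ℓ
  Splits A X = (∃ λ a → a ∈ A × X a ≡ true) × (∃ λ a → a ∈ A × X a ≡ false)

  Connects : ℕ → List V → Pairs V → Set ℓ
  Connects K A E = ∀ X → Splits A X → K ≤ cut E X

  -- `below` covers the sets that split no terminals; the slack needed to orient a ring ranges over
  -- all sets. With `simple`, the parity of the degree in `E` determines the degree in `pairs`.
  record Pairing (K : ℕ) (A : List V) (E : Pairs V) : Set ℓ where
    field
      pairs  : Pairs V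
      split  : ∀ X → Splits A X → cut pairs X + K ≤ cut E X
      below  : ∀ X → cut pairs X ≤ cut E X
      parity : ∀ X → odd (cut pairs X) ≡ odd (cut E X)
      simple : ∀ v → cut pairs ｛ v ｝ ≤ 1

  otherEnd : ∀ v {p q} → ｛ v ｝ p ≢ ｛ v ｝ q →
    ∃ λ x → ∀ (X : Cut V) → crossing (X p) (X q) ≡ crossing (X v) (X x)
  otherEnd v {p} {q} ≢ with p ≟ v | q ≟ v
  ... | yes refl | _        = q , λ X → refl
  ... | no _     | yes refl = p , λ X → crossing-comm (X p) (X q)
  ... | no _     | no _     = contradiction refl ≢

  -- Two pairs at v, with other ends x and y, are replaced by the pair xy.
  shortcut : ∀ v M → 2 ≤ cut M ｛ v ｝ → ∃ λ M′ → length M′ < length M ×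
    (∀ X → cut M′ X ≤ cut M X) × (∀ X → odd (cut M′ X) ≡ odd (cut M X))
  shortcut v M 2≤
    with p , q , pq∈M , ≢₁ ← cut>0 M ｛ v ｝ (ℕ.≤-trans (s≤s z≤n) 2≤)
    with M₁ , M↭ ← extract pq∈M
    with r , s , rs∈M₁ , ≢₂ ← cut>0 M₁ ｛ v ｝ (ℕ.+-cancelˡ-≤ 1 _ _
           (ℕ.≤-trans 2≤ (ℕ.≤-trans (ℕ.≤-reflexive (cut-↭ M↭ ｛ v ｝)) (ℕ.+-monoˡ-≤ _ (crossing≤1 (｛ v ｝ p) (｛ v ｝ q))))))
    with M₂ , M₁↭ ← extract rs∈M₁
    with x , x≡ ← otherEnd v ≢₁
    with y , y≡ ← otherEnd v ≢₂ = (x , y) ∷ M₂ ,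
      ℕ.≤-reflexive (sym (trans (↭-length M↭) (cong suc (↭-length M₁↭)))) ,
      (λ X → ℕ.≤-trans (ℕ.+-monoˡ-≤ (cut M₂ X) (crossing-triangle (X x) (X v) (X y)))
               (ℕ.≤-reflexive (sym (expand X)))) ,
      (λ X → sym (trans (cong odd (expand X)) (trans (odd-+ (crossing (X v) (X x) + crossing (X v) (X y)) _)
               (trans (cong (_xor odd (cut M₂ X)) (pointwise (X v) (X x) (X y)))
                 (sym (odd-+ (crossing (X x) (X y)) _))))))
    where
    pointwise : ∀ v x y → odd (crossing v x + crossing v y) ≡ odd (crossing x y)
    pointwise = from-yes (bool? λ v → bool? λ x → bool? λ y →
      odd (crossing v x + crossing v y) Bool.≟ odd (crossing x y))
    expand : ∀ X → cut M X ≡ crossing (X v) (X x) + crossing (X v) (X y) + cut M₂ X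
    expand X = begin
      cut M X                                                        ≡⟨ cut-↭ M↭ X ⟩
      crossing (X p) (X q) + cut M₁ X                                ≡⟨ cong₂ _+_ (x≡ X) (cut-↭ M₁↭ X) ⟩
      crossing (X v) (X x) + (crossing (X r) (X s) + cut M₂ X)       ≡⟨ cong (λ t → crossing (X v) (X x) + (t + cut M₂ X)) (y≡ X) ⟩
      crossing (X v) (X x) + (crossing (X v) (X y) + cut M₂ X)       ≡⟨ ℕ.+-assoc (crossing (X v) (X x)) _ _ ⟨
      crossing (X v) (X x) + crossing (X v) (X y) + cut M₂ X         ∎
      where open ≡-Reasoning

  Simplification : Pairs V → Set ℓ
  Simplification M = ∃ λ M′ → (∀ X → cut M′ X ≤ cut M X) ×
    (∀ X → odd (cut M′ X) ≡ odd (cut M X)) × (∀ v → cut M′ ｛ v ｝ ≤ 1)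

  normalise : ∀ M → Acc _<_ (length M) → Simplification M
  normalise M (acc rec) with em {∃ λ v → 2 ≤ cut M ｛ v ｝}
  ... | no  none      = M , (λ X → ℕ.≤-refl) , (λ X → refl) , λ v → ℕ.≮⇒≥ λ 2≤ → none (v , 2≤)
  ... | yes (v , 2≤) = via (shortcut v M 2≤)
    where
    via : (∃ λ M₁ → length M₁ < length M × (∀ X → cut M₁ X ≤ cut M X) ×
            (∀ X → odd (cut M₁ X) ≡ odd (cut M X))) → Simplification M
    via (M₁ , shorter , ≤₁ , odd₁) with M₂ , ≤₂ , odd₂ , simple ← normalise M₁ (rec shorter) =
      M₂ , (λ X → ℕ.≤-trans (≤₂ X) (≤₁ X)) , (λ X → trans (odd₂ X) (odd₁ X)) , simple

  normalised : ∀ {K A E} M → (∀ X → Splits A X → cut M X + K ≤ cut E X) →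
    (∀ X → cut M X ≤ cut E X) → (∀ X → odd (cut M X) ≡ odd (cut E X)) → Pairing K A E
  normalised M split below parity
    with M′ , ≤M , odd≡ , simple ← normalise M (<-wellFounded _) = record
    { pairs  = M′
    ; split  = λ X s → ℕ.≤-trans (ℕ.+-monoˡ-≤ _ (≤M X)) (split X s)
    ; below  = λ X → ℕ.≤-trans (≤M X) (below X)
    ; parity = λ X → trans (odd≡ X) (parity X)
    ; simple = simple
    }

  Splits-∁ : ∀ {A X} → Splits A X → Splits A (∁ X)
  Splits-∁ ((a , a∈A , Xa) , (b , b∈A , Xb)) = (b , b∈A , cong not Xb) , (a , a∈A , cong not Xa)

  Adjacent : Pairs V → V → V → Set ℓ
  Adjacent E p q = (p , q) ∈ E ⊎ (q , p) ∈ E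

  cut-adjacent : ∀ {E p q} {X : Cut V} → Adjacent E p q → X p ≢ X q → 1 ≤ cut E X
  cut-adjacent (inj₁ pq∈E) ≢ = cut-∈ pq∈E ≢
  cut-adjacent (inj₂ qp∈E) ≢ = cut-∈ qp∈E (≢ ∘ sym)

  module _ (K : ℕ) (K>0 : 1 ≤ K) (K-even : odd K ≡ false) where

    Saturated : List V → Pairs V → V → Set ℓ
    Saturated A E t = t ∈ A × cut E ｛ t ｝ ≡ K

    -- Contracting one side of a tight cut

    module Contraction {A E} (X : Cut V) {a a′} (a∈A : a ∈ A) (a∉X : X a ≡ false)
                       (a′∈A : a′ ∈ A) (a′∈X : X a′ ≡ true) (tight : cut E X ≡ K) where

      f : V → V
      f v = if X v then v else a

      f-∈ : ∀ {v} → X v ≡ true → f v ≡ v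
      f-∈ Xv rewrite Xv = refl

      f-∉ : ∀ {v} → X v ≡ false → f v ≡ a
      f-∉ Xv rewrite Xv = refl

      touches? : (e : V × V) → Dec (X (proj₁ e) ∨ X (proj₂ e) ≡ true)
      touches? (p , q) = (X p ∨ X q) Bool.≟ true

      A₁ : List V
      A₁ = a ∷ filter (λ v → X v Bool.≟ true) A

      -- Edges that miss `X` would become loops at `a`. Dropping them changes no cut and makes the
      -- recursion descend.
      E₁ : Pairs V
      E₁ = map (Product.map f f) (filter touches? E)

      -- The filter discards `a`, which lies outside `X`; this makes room for the new head.
      A₁≤A : length A₁ ≤ length A
      A₁≤A = List.filter-notAll (λ v → X v Bool.≟ true) A
        (Any.map (λ { refl Xa → false≢true (trans (sym a∉X) Xa) }) a∈A)

      E₁<E : Any (λ e → X (proj₁ e) ≡ false × X (proj₂ e) ≡ false) E → length E₁ < length E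
      E₁<E outside = ℕ.≤-trans (s≤s (ℕ.≤-reflexive (List.length-map _ (filter touches? E))))
        (List.filter-notAll touches? E (Any.map (λ { (Xp , Xq) t → false≢true (trans (sym (cong₂ _∨_ Xp Xq)) t) }) outside))

      cut-E₁ : ∀ Z → cut E₁ Z ≡ cut E (Z ∘ f)
      cut-E₁ Z = trans (cut-map f (filter touches? E) Z) (go E)
        where
        go : ∀ E → cut (filter touches? E) (Z ∘ f) ≡ cut E (Z ∘ f)
        go [] = refl
        go ((p , q) ∷ E) with touches? (p , q)
        ... | yes _ = cong (_+_ (crossing (Z (f p)) (Z (f q)))) (go E)
        ... | no ¬t = trans (go E) (cong (_+ cut E (Z ∘ f)) (sym (trans
                (cong₂ (λ t u → crossing (Z t) (Z u)) (f-∉ Xp) (f-∉ Xq)) (crossing-refl (Z a)))))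
          where
          Xp : X p ≡ false
          Xp = Bool.¬-not λ Xp → ¬t (cong (_∨ X q) Xp)
          Xq : X q ≡ false
          Xq = Bool.¬-not λ Xq → ¬t (trans (cong (X p ∨_) Xq) (Bool.∨-zeroʳ (X p)))

      A₁⁻ : ∀ {b} → b ∈ A₁ → b ∈ A × f b ≡ b
      A₁⁻ (here refl) = a∈A , f-∉ a∉X
      A₁⁻ (there b∈) with b∈A , Xb ← ∈-filter⁻ (λ v → X v Bool.≟ true) {xs = A} b∈ = b∈A , f-∈ Xb

      connects : Connects K A E → Connects K A₁ E₁
      connects con Z ((b , b∈ , Zb) , (c , c∈ , Zc)) = ℕ.≤-trans
        (con (Z ∘ f) ((b , proj₁ (A₁⁻ b∈) , trans (cong Z (proj₂ (A₁⁻ b∈))) Zb) ,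
                      (c , proj₁ (A₁⁻ c∈) , trans (cong Z (proj₂ (A₁⁻ c∈))) Zc)))
        (ℕ.≤-reflexive (sym (cut-E₁ Z)))

      module Lifted (P : Pairing K A₁ E₁) where
        open Pairing P using (split; below; parity) renaming (pairs to M)

        -- `M` may contain vertices outside `X` other than `a`; a second application of `f` moves
        -- these to `a`.
        N : Pairs V
        N = map (Product.map f f) M

        a′∈A₁ : a′ ∈ A₁
        a′∈A₁ = there (∈-filter⁺ (λ v → X v Bool.≟ true) a′∈A a′∈X)

        -- Tightness leaves no room: `split` fits `cut M (∁ X) + K` into a cut of size `K`. So no
        -- pair of `M` crosses `X`.
        cut-∁X : cut M (∁ X) ≡ 0
        cut-∁X = ℕ.n≤0⇒n≡0 (ℕ.+-cancelʳ-≤ K _ 0 (begin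
          cut M (∁ X) + K ≤⟨ split (∁ X) ((a , here refl , cong not a∉X) , (a′ , a′∈A₁ , cong not a′∈X)) ⟩
          cut E₁ (∁ X)    ≡⟨ cut-E₁ (∁ X) ⟩
          cut E (∁ X ∘ f) ≡⟨ cut-cong E ∁X∘f ⟩
          cut E (∁ X)     ≡⟨ cut-∁ E X ⟩
          cut E X         ≡⟨ tight ⟩
          K               ∎))
          where
          open ℕ.≤-Reasoning
          ∁X∘f : ∀ v → ∁ X (f v) ≡ ∁ X v
          ∁X∘f v with X v in Xv
          ... | true  = cong not Xv
          ... | false = cong not a∉X

        inner outer : Cut V → Cut V
        inner Z = Z ∩ X
        outer Z = Z ∪ ∁ X

        -- No pair of `M` crosses `X`, so it makes no difference whether the complement of `X` is
        -- left out of a set or added to it. This gives two bounds for `N`, and `glue` picks the one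
        -- that suits `Z`.
        inner≡outer : ∀ Z → cut M (inner Z) ≡ cut M (outer Z)
        inner≡outer Z = ℕ.≤-antisym
          (begin
            cut M (inner Z)           ≡⟨ cut-cong M (λ v → absorb₁ (Z v) (X v)) ⟩
            cut M (outer Z ∩ X)       ≤⟨ cut-∩ M (outer Z) X ⟩
            cut M (outer Z) + cut M X ≡⟨ cong (_+_ (cut M (outer Z))) (trans (sym (cut-∁ M X)) cut-∁X) ⟩
            cut M (outer Z) + 0       ≡⟨ ℕ.+-identityʳ _ ⟩
            cut M (outer Z)           ∎)
          (begin
            cut M (outer Z)               ≡⟨ cut-cong M (λ v → absorb₂ (Z v) (X v)) ⟩
            cut M (inner Z ∪ ∁ X)         ≤⟨ cut-∪ M (inner Z) (∁ X) ⟩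
            cut M (inner Z) + cut M (∁ X) ≡⟨ cong (_+_ (cut M (inner Z))) cut-∁X ⟩
            cut M (inner Z) + 0           ≡⟨ ℕ.+-identityʳ _ ⟩
            cut M (inner Z)               ∎)
          where
          open ℕ.≤-Reasoning
          absorb₁ : ∀ z x → z ∧ x ≡ (z ∨ not x) ∧ x
          absorb₁ = from-yes (bool? λ z → bool? λ x → (z ∧ x) Bool.≟ ((z ∨ not x) ∧ x))
          absorb₂ : ∀ z x → z ∨ not x ≡ (z ∧ x) ∨ not x
          absorb₂ = from-yes (bool? λ z → bool? λ x → (z ∨ not x) Bool.≟ ((z ∧ x) ∨ not x))

        cut-inner : ∀ Z → cut N Z ≡ cut M (inner Z)
        cut-inner Z with Z a in Za
        ... | false = trans (cut-map f M Z) (cut-cong M pointwise)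
          where
          pointwise : ∀ v → Z (f v) ≡ inner Z v
          pointwise v with X v
          ... | true  = sym (Bool.∧-identityʳ (Z v))
          ... | false = trans Za (sym (Bool.∧-zeroʳ (Z v)))
        ... | true  = trans (cut-map f M Z) (trans (cut-cong M pointwise) (sym (inner≡outer Z)))
          where
          pointwise : ∀ v → Z (f v) ≡ outer Z v
          pointwise v with X v
          ... | true  = sym (Bool.∨-identityʳ (Z v))
          ... | false = trans Za (sym (Bool.∨-zeroʳ (Z v)))

        cut-outer : ∀ Z → cut N Z ≡ cut M (outer Z)
        cut-outer Z = trans (cut-inner Z) (inner≡outer Z)

        E₁-inner : ∀ Z → cut E₁ (inner Z) ≡ cut E (inner Z)
        E₁-inner Z = trans (cut-E₁ (inner Z)) (cut-cong E pointwise)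
          where
          pointwise : ∀ v → inner Z (f v) ≡ inner Z v
          pointwise v with X v in Xv
          ... | true  = cong (Z v ∧_) Xv
          ... | false = trans (cong (Z a ∧_) a∉X) (trans (Bool.∧-zeroʳ (Z a)) (sym (Bool.∧-zeroʳ (Z v))))

        E₁-outer : ∀ Z → cut E₁ (outer Z) ≡ cut E (outer Z)
        E₁-outer Z = trans (cut-E₁ (outer Z)) (cut-cong E pointwise)
          where
          pointwise : ∀ v → outer Z (f v) ≡ outer Z v
          pointwise v with X v in Xv
          ... | true  = cong (λ x → Z v ∨ not x) Xv
          ... | false = trans (cong (λ x → Z a ∨ not x) a∉X) (trans (Bool.∨-zeroʳ (Z a)) (sym (Bool.∨-zeroʳ (Z v))))

        below-inner : ∀ Z → cut N Z ≤ cut E (Z ∩ X)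
        below-inner Z = ℕ.≤-trans (ℕ.≤-reflexive (cut-inner Z))
          (ℕ.≤-trans (below (inner Z)) (ℕ.≤-reflexive (E₁-inner Z)))

        below-outer : ∀ Z → cut N Z ≤ cut E (Z ∪ ∁ X)
        below-outer Z = ℕ.≤-trans (ℕ.≤-reflexive (cut-outer Z))
          (ℕ.≤-trans (below (outer Z)) (ℕ.≤-reflexive (E₁-outer Z)))

        split-inner : ∀ Z {b} → b ∈ A → Z b ≡ true → X b ≡ true → cut N Z + K ≤ cut E (Z ∩ X)
        split-inner Z {b} b∈A Zb Xb = ℕ.≤-trans (ℕ.≤-reflexive (cong (_+ K) (cut-inner Z)))
          (ℕ.≤-trans (split (inner Z)
              ((b , there (∈-filter⁺ (λ v → X v Bool.≟ true) b∈A Xb) , cong₂ _∧_ Zb Xb) ,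
               (a , here refl , trans (cong (Z a ∧_) a∉X) (Bool.∧-zeroʳ (Z a)))))
            (ℕ.≤-reflexive (E₁-inner Z)))

        split-outer : ∀ Z {b} → b ∈ A → Z b ≡ false → X b ≡ true → cut N Z + K ≤ cut E (Z ∪ ∁ X)
        split-outer Z {b} b∈A Zb Xb = ℕ.≤-trans (ℕ.≤-reflexive (cong (_+ K) (cut-outer Z)))
          (ℕ.≤-trans (split (outer Z)
              ((a , here refl , trans (cong (λ x → Z a ∨ not x) a∉X) (Bool.∨-zeroʳ (Z a))) ,
               (b , there (∈-filter⁺ (λ v → X v Bool.≟ true) b∈A Xb) , cong₂ (λ z x → z ∨ not x) Zb Xb)))
            (ℕ.≤-reflexive (E₁-outer Z)))

        parity-inner : ∀ Z → odd (cut N Z) ≡ odd (cut E (Z ∩ X))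
        parity-inner Z = trans (cong odd (cut-inner Z)) (trans (parity (inner Z)) (cong odd (E₁-inner Z)))

    -- Without an edge outside X, K = d(X) = d(a) + d(rest) for a terminal a
    -- outside X.  As d(a) ≥ K, the edge pq ends in a, which is then saturated.
    edge-outside : ∀ {A E X p q} → Connects K A E → Splits A X → cut E X ≡ K → Adjacent E p q →
      X p ≡ true → X q ≡ false → ¬ Saturated A E q →
      Any (λ e → X (proj₁ e) ≡ false × X (proj₂ e) ≡ false) E
    edge-outside {A} {E} {X} {p} {q} con s@((b , b∈A , Xb) , (a , a∈A , Xa)) tight pq Xp Xq unsat
      with em {Any (λ e → X (proj₁ e) ≡ false × X (proj₂ e) ≡ false) E}
    ... | yes outside = outside
    ... | no  none    = ⊥-elim impossible
      where
      pointwise : ∀ x x′ s s′ → ¬ (x ≡ false × x′ ≡ false) → (s ≡ true → x ≡ false) → (s′ ≡ true → x′ ≡ false) →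
        crossing x x′ + crossing false false ≡ crossing s s′ + crossing (not x ∧ not s) (not x′ ∧ not s′)
      pointwise false false _ _ ¬ff _ _ = contradiction (refl , refl) ¬ff
      pointwise true  x′ true  s′ _ sx _ with () ← sx refl
      pointwise x  true  s true  _ _ sx with () ← sx refl
      pointwise true  true  false false _ _ _ = refl
      pointwise true  false false true  _ _ _ = refl
      pointwise true  false false false _ _ _ = refl
      pointwise false true  true  false _ _ _ = refl
      pointwise false true  false false _ _ _ = refl
      rest : Cut V
      rest v = not (X v) ∧ not (｛ a ｝ v)
      a-outside : ∀ {v} → ｛ a ｝ v ≡ true → X v ≡ false
      a-outside av rewrite ｛｝-true av = Xa
      total : cut E X ≡ cut E ｛ a ｝ + cut E rest
      total = trans (sym (ℕ.+-identityʳ _)) (trans (cong (_+_ (cut E X)) (sym (cut-const E)))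
        (cut-balance-on E λ {r} {s} rs∈E → pointwise (X r) (X s) (｛ a ｝ r) (｛ a ｝ s)
          (λ ff → none (Any.map (λ { refl → ff }) rs∈E)) a-outside a-outside))
        where
        cut-const : ∀ E → cut E (λ _ → false) ≡ 0
        cut-const []      = refl
        cut-const (_ ∷ E) = cut-const E
      K≤a : K ≤ cut E ｛ a ｝
      K≤a = con ｛ a ｝ ((a , a∈A , ｛｝-∈ a) ,
        (b , b∈A , ｛｝-∉ λ { refl → false≢true (trans (sym Xa) Xb) }))
      impossible : ⊥
      impossible with q ≟ a
      ... | yes refl = unsat (a∈A , ℕ.≤-antisym
              (ℕ.≤-trans (ℕ.m≤m+n _ _) (ℕ.≤-reflexive (trans (sym total) tight))) K≤a)
      ... | no  q≢a  = ℕ.<-irrefl refl (begin-strict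
              K                         <⟨ ℕ.≤-reflexive (ℕ.+-comm 1 K) ⟩
              K + 1                     ≤⟨ ℕ.+-mono-≤ K≤a (cut-adjacent {X = rest} pq p≢q) ⟩
              cut E ｛ a ｝ + cut E rest ≡⟨ total ⟨
              cut E X                   ≡⟨ tight ⟩
              K                         ∎)
        where
        open ℕ.≤-Reasoning
        p≢q : rest p ≢ rest q
        p≢q eq = false≢true (trans (sym (cong (λ x → not x ∧ not (｛ a ｝ p)) Xp))
          (trans eq (cong₂ (λ x s → not x ∧ not s) Xq (｛｝-∉ q≢a))))

    -- `K₁` and `K₂` are the gains on the two sides of the tight cut, which itself costs `K`.
    uncross : ∀ m n K₁ K₂ {z x i u} → m + K₁ ≤ i → n + K₂ ≤ u → i + u ≤ z + x → x ≡ K →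
      (m + n) + (K₁ + K₂) ≤ z + K
    uncross m n K₁ K₂ p q r refl = ℕ.≤-trans (ℕ.≤-reflexive (+-interchange m n K₁ K₂))
      (ℕ.≤-trans (ℕ.+-mono-≤ p q) r)

    module Decomposition {A E X} (con : Connects K A E) (s : Splits A X) (tight : cut E X ≡ K) where
      private
        b₁ = proj₁ (proj₁ s)
        b₁∈A = proj₁ (proj₂ (proj₁ s))
        Xb₁ = proj₂ (proj₂ (proj₁ s))
        b₀ = proj₁ (proj₂ s)
        b₀∈A = proj₁ (proj₂ (proj₂ s))
        Xb₀ = proj₂ (proj₂ (proj₂ s))

      module C₁ = Contraction {A} {E} X b₀∈A Xb₀ b₁∈A Xb₁ tight
      module C₂ = Contraction {A} {E} (∁ X) b₁∈A (cong not Xb₁) b₀∈A (cong not Xb₀) (trans (cut-∁ E X) tight)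

      -- One lifted pairing is bounded by a cut of `E` at an intersection with `X` or `∁ X`, the
      -- other by one at the corresponding union, and submodularity leads back to `Z`.
      glue : Pairing K C₁.A₁ C₁.E₁ → Pairing K C₂.A₁ C₂.E₁ → Pairing K A E
      glue P₁ P₂ = normalised (L₁.N ++ L₂.N) split below parity
        where
        open ℕ.≤-Reasoning
        module L₁ = C₁.Lifted P₁
        module L₂ = C₂.Lifted P₂
        below₂ : ∀ Z → cut L₂.N Z ≤ cut E (Z ∪ X)
        below₂ Z = ℕ.≤-trans (L₂.below-outer Z)
          (ℕ.≤-reflexive (cut-cong E λ v → cong (Z v ∨_) (Bool.not-involutive (X v))))
        split₂ : ∀ Z {b} → b ∈ A → Z b ≡ false → X b ≡ false → cut L₂.N Z + K ≤ cut E (Z ∪ X)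
        split₂ Z b∈A Zb Xb = ℕ.≤-trans (L₂.split-outer Z b∈A Zb (cong not Xb))
          (ℕ.≤-reflexive (cut-cong E λ v → cong (Z v ∨_) (Bool.not-involutive (X v))))
        submodular∁ : ∀ Z → cut E (Z ∪ ∁ X) + cut E (Z ∩ ∁ X) ≤ cut E Z + cut E X
        submodular∁ Z = begin
          cut E (Z ∪ ∁ X) + cut E (Z ∩ ∁ X) ≡⟨ ℕ.+-comm (cut E (Z ∪ ∁ X)) _ ⟩
          cut E (Z ∩ ∁ X) + cut E (Z ∪ ∁ X) ≤⟨ cut-submodular E Z (∁ X) ⟩
          cut E Z + cut E (∁ X)             ≡⟨ cong (_+_ (cut E Z)) (cut-∁ E X) ⟩
          cut E Z + cut E X                 ∎
        drop : ∀ {m z} → m + K ≤ z + K → m ≤ z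
        drop {m} {z} = ℕ.+-cancelʳ-≤ K m z
        pad : ∀ {m z} → m ≤ z → m + 0 ≤ z
        pad {m} = ℕ.≤-trans (ℕ.≤-reflexive (ℕ.+-identityʳ m))
        two : ∀ Z → cut L₁.N Z + cut L₂.N Z + (K + K) ≤ cut E Z + K → cut (L₁.N ++ L₂.N) Z + K ≤ cut E Z
        two Z le = drop (begin
          cut (L₁.N ++ L₂.N) Z + K + K        ≡⟨ cong (λ t → t + K + K) (cut-++ L₁.N L₂.N Z) ⟩
          cut L₁.N Z + cut L₂.N Z + K + K     ≡⟨ ℕ.+-assoc (cut L₁.N Z + cut L₂.N Z) K K ⟩
          cut L₁.N Z + cut L₂.N Z + (K + K)   ≤⟨ le ⟩
          cut E Z + K                         ∎)
        one : ∀ Z → cut L₁.N Z + cut L₂.N Z + (K + 0) ≤ cut E Z + K → cut (L₁.N ++ L₂.N) Z ≤ cut E Z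
        one Z le = drop (begin
          cut (L₁.N ++ L₂.N) Z + K            ≡⟨ cong₂ _+_ (cut-++ L₁.N L₂.N Z) (sym (ℕ.+-identityʳ K)) ⟩
          cut L₁.N Z + cut L₂.N Z + (K + 0)   ≤⟨ le ⟩
          cut E Z + K                         ∎)
        parallel : ∀ Z {b c} → b ∈ A → Z b ≡ true → X b ≡ true → c ∈ A → Z c ≡ false → X c ≡ false →
          cut (L₁.N ++ L₂.N) Z + K ≤ cut E Z
        parallel Z b∈A Zb Xb c∈A Zc Xc =
          two Z (uncross (cut L₁.N Z) (cut L₂.N Z) K K (L₁.split-inner Z b∈A Zb Xb) (split₂ Z c∈A Zc Xc) (cut-submodular E Z X) tight)
        crossed : ∀ Z {b c} → b ∈ A → Z b ≡ false → X b ≡ true → c ∈ A → Z c ≡ true → X c ≡ false →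
          cut (L₁.N ++ L₂.N) Z + K ≤ cut E Z
        crossed Z b∈A Zb Xb c∈A Zc Xc =
          two Z (uncross (cut L₁.N Z) (cut L₂.N Z) K K (L₁.split-outer Z b∈A Zb Xb) (L₂.split-inner Z c∈A Zc (cong not Xc)) (submodular∁ Z) tight)
        split : ∀ Z → Splits A Z → cut (L₁.N ++ L₂.N) Z + K ≤ cut E Z
        split Z ((z₁ , z₁∈A , Zz₁) , (z₀ , z₀∈A , Zz₀)) with X z₁ in Xz₁ | X z₀ in Xz₀
        ... | true  | false = parallel Z z₁∈A Zz₁ Xz₁ z₀∈A Zz₀ Xz₀
        ... | false | true  = crossed Z z₀∈A Zz₀ Xz₀ z₁∈A Zz₁ Xz₁
        -- With both witnesses on one side of `X`, a terminal from the other side replaces one of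
        -- them; its membership in `Z` decides which.
        ... | true  | true with Z b₀ in Zb₀
        ...   | true  = crossed Z z₀∈A Zz₀ Xz₀ b₀∈A Zb₀ Xb₀
        ...   | false = parallel Z z₁∈A Zz₁ Xz₁ b₀∈A Zb₀ Xb₀
        split Z ((z₁ , z₁∈A , Zz₁) , (z₀ , z₀∈A , Zz₀)) | false | false with Z b₁ in Zb₁
        ...   | true  = parallel Z b₁∈A Zb₁ Xb₁ z₀∈A Zz₀ Xz₀
        ...   | false = crossed Z b₁∈A Zb₁ Xb₁ z₁∈A Zz₁ Xz₁
        below : ∀ Z → cut (L₁.N ++ L₂.N) Z ≤ cut E Z
        -- The terminal `b₁` gives the first side a gain of `K`, which just pays for the tight cut.
        below Z with Z b₁ in Zb₁
        ... | true  = one Z (uncross (cut L₁.N Z) (cut L₂.N Z) K 0 (L₁.split-inner Z b₁∈A Zb₁ Xb₁) (pad (below₂ Z)) (cut-submodular E Z X) tight)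
        ... | false = one Z (uncross (cut L₁.N Z) (cut L₂.N Z) K 0 (L₁.split-outer Z b₁∈A Zb₁ Xb₁) (pad (L₂.below-inner Z)) (submodular∁ Z) tight)
        parity : ∀ Z → odd (cut (L₁.N ++ L₂.N) Z) ≡ odd (cut E Z)
        parity Z = trans (trans (cong odd (cut-++ L₁.N L₂.N Z)) (odd-+ (cut L₁.N Z) _))
          (trans (cong₂ _xor_ (L₁.parity-inner Z) (L₂.parity-inner Z)) (sym (cut-xor E λ v → halves (Z v) (X v))))
          where
          halves : ∀ z x → z ≡ (z ∧ x) xor (z ∧ not x)
          halves = from-yes (bool? λ z → bool? λ x → z Bool.≟ ((z ∧ x) xor (z ∧ not x)))

    -- When every edge has a saturated end, a saturated terminal t can be
    -- dropped: the non-terminals are pairwise non-adjacent, so a cut X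
    -- containing t as its only terminal can be built up from t vertex by vertex.
    module Removal {A E t} (con : Connects K A E) (sat : Saturated A E t)
                   (covered : ∀ {p q} → (p , q) ∈ E → p ∈ A ⊎ q ∈ A) where

      A₁ : List V
      A₁ = filter (λ v → ¬? (v ≟ t)) A

      A₁<A : length A₁ < length A
      A₁<A = List.filter-notAll (λ v → ¬? (v ≟ t)) A (Any.map (λ { refl ¬refl → ¬refl refl }) (proj₁ sat))

      A₁⊆A : ∀ {v} → v ∈ A₁ → v ∈ A
      A₁⊆A v∈ = proj₁ (∈-filter⁻ (λ v → ¬? (v ≟ t)) {xs = A} v∈)

      ∈-A₁ : ∀ {v} → v ∈ A → v ≢ t → v ∈ A₁
      ∈-A₁ = ∈-filter⁺ (λ v → ¬? (v ≟ t))

      connects : Connects K A₁ E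
      connects X ((b , b∈ , Xb) , (c , c∈ , Xc)) = con X ((b , A₁⊆A b∈ , Xb) , (c , A₁⊆A c∈ , Xc))

      module _ (P : Pairing K A₁ E) where
        open Pairing P renaming (pairs to M; split to split₁)

        t-parity : odd (cut M ｛ t ｝) ≡ false
        t-parity = trans (parity ｛ t ｝) (trans (cong odd (proj₂ sat)) K-even)

        -- The degree `K` of `t` is even, so parity excludes the single pair that `simple` would
        -- allow.
        t-free : cut M ｛ t ｝ ≡ 0
        t-free with cut M ｛ t ｝ | simple t | t-parity
        ... | zero | _ | _ = refl
        ... | suc zero | _ | ()
        ... | suc (suc _) | s≤s () | _

        module Grow (X : Cut V) (t∈X : X t ≡ true) (only-t : ∀ {a} → a ∈ A → X a ≡ true → a ≡ t)
                    {z} (z∈A : z ∈ A) (z∉X : X z ≡ false) where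
          open ℕ.≤-Reasoning

          record Stage (L : List V) : Set ℓ where
            field
              Y      : Cut V
              Y⊆X    : ∀ {v} → Y v ≡ true → X v ≡ true
              t∈Y    : Y t ≡ true
              covers : ∀ {v} → v ∈ L → X v ≡ true → Y v ≡ true
              bound  : cut M Y + K ≤ cut E Y

          z≢t : z ≢ t
          z≢t refl = false≢true (trans (sym z∉X) t∈X)

          -- `t` and `n` together are separated from the terminal `z`, so their cut is at least `K`.
          -- If `n` is paired, this cut is odd while `K` is even, so it is at least `K + 1`.
          star : ∀ {n} → n ≢ t → n ∉ A → K + cut M ｛ n ｝ ≤ cut E (｛ t ｝ ∪ ｛ n ｝)
          star {n} n≢t n∉A with cut M ｛ n ｝ | simple n | cut-E-parity
            where
            disjoint : ∀ v → (｛ t ｝ ∪ ｛ n ｝) v ≡ ｛ t ｝ v xor ｛ n ｝ v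
            disjoint v with v ≟ t | v ≟ n
            ... | yes refl | yes refl = contradiction refl n≢t
            ... | yes _    | no _     = refl
            ... | no _     | yes _    = refl
            ... | no _     | no _     = refl
            cut-E-parity : odd (cut E (｛ t ｝ ∪ ｛ n ｝)) ≡ odd (cut M ｛ n ｝)
            cut-E-parity = trans (sym (parity _)) (trans (cut-xor M disjoint) (cong (_xor odd (cut M ｛ n ｝)) t-parity))
          ... | zero  | _ | _ = ℕ.≤-trans (ℕ.≤-reflexive (ℕ.+-identityʳ K)) K≤star
            where
            K≤star = con (｛ t ｝ ∪ ｛ n ｝) ((t , proj₁ sat , cong (_∨ ｛ n ｝ t) (｛｝-∈ t)) ,
              (z , z∈A , cong₂ _∨_ (｛｝-∉ z≢t) (｛｝-∉ λ { refl → n∉A z∈A })))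
          ... | suc zero | _ | odd-star = ℕ.≤-trans (ℕ.≤-reflexive (ℕ.+-comm K 1)) (ℕ.≤∧≢⇒< K≤star
                  λ K≡ → false≢true (trans (sym K-even) (trans (cong odd K≡) odd-star)))
            where
            K≤star = con (｛ t ｝ ∪ ｛ n ｝) ((t , proj₁ sat , cong (_∨ ｛ n ｝ t) (｛｝-∈ t)) ,
              (z , z∈A , cong₂ _∨_ (｛｝-∉ z≢t) (｛｝-∉ λ { refl → n∉A z∈A })))
          ... | suc (suc _) | s≤s () | _

          -- One end of the edge is a terminal, with the same membership `s` in `Y` and in the
          -- singleton of `t`. The other end has memberships `y`, `τ`, `ν` in `Y` and in the
          -- singletons of `t` and `n`.
          pointwise : ∀ s y τ ν → (ν ≡ true → y ≡ false × τ ≡ false) →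
            crossing (s ∨ false) (y ∨ ν) + crossing s τ ≡ crossing s y + crossing (s ∨ false) (τ ∨ ν)
          pointwise s y τ false _
            rewrite Bool.∨-identityʳ s | Bool.∨-identityʳ y | Bool.∨-identityʳ τ = refl
          pointwise s y τ true νy with refl , refl ← νy refl rewrite Bool.∨-identityʳ s =
            ℕ.+-comm (crossing s true) (crossing s false)

          add : ∀ {L n} (S : Stage L) → X n ≡ true → Stage.Y S n ≡ false → Stage (n ∷ L)
          add {L} {n} S Xn Yn = record
            { Y      = Y ∪ ｛ n ｝
            ; Y⊆X    = λ {v} → ⊆X v
            ; t∈Y    = cong (_∨ ｛ n ｝ t) t∈Y
            ; covers = λ { (here refl) _  → trans (cong (Y n ∨_) (｛｝-∈ n)) (Bool.∨-zeroʳ (Y n))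
                         ; (there v∈L) Xv → cong (_∨ _) (covers v∈L Xv) }
            ; bound  = bound′
            }
            where
            open Stage S
            n≢t : n ≢ t
            n≢t refl = false≢true (trans (sym Yn) t∈Y)
            n∉A : n ∉ A
            n∉A n∈A = n≢t (only-t n∈A Xn)
            ⊆X : ∀ v → (Y ∪ ｛ n ｝) v ≡ true → X v ≡ true
            ⊆X v eq with Y v in Yv | v ≟ n
            ... | true  | _        = Y⊆X Yv
            ... | false | yes refl = Xn
            Y-terminal : ∀ {p} → p ∈ A → Y p ≡ ｛ t ｝ p
            Y-terminal {p} p∈A with p ≟ t
            ... | yes refl = t∈Y
            ... | no  p≢t  = Bool.¬-not λ Yp → p≢t (only-t p∈A (Y⊆X Yp))
            n-free : ∀ {v} → ｛ n ｝ v ≡ true → Y v ≡ false × ｛ t ｝ v ≡ false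
            n-free nv rewrite ｛｝-true nv = Yn , ｛｝-∉ n≢t
            half-edge : ∀ {p q} → p ∈ A →
              crossing ((Y ∪ ｛ n ｝) p) ((Y ∪ ｛ n ｝) q) + crossing (｛ t ｝ p) (｛ t ｝ q) ≡
              crossing (Y p) (Y q) + crossing ((｛ t ｝ ∪ ｛ n ｝) p) ((｛ t ｝ ∪ ｛ n ｝) q)
            half-edge {p} {q} p∈A
              rewrite Y-terminal p∈A | ｛｝-∉ {n} {p} (λ { refl → n∉A p∈A }) =
                pointwise (｛ t ｝ p) (Y q) (｛ t ｝ q) (｛ n ｝ q) n-free
            edge : ∀ {p q} → (p , q) ∈ E →
              crossing ((Y ∪ ｛ n ｝) p) ((Y ∪ ｛ n ｝) q) + crossing (｛ t ｝ p) (｛ t ｝ q) ≡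
              crossing (Y p) (Y q) + crossing ((｛ t ｝ ∪ ｛ n ｝) p) ((｛ t ｝ ∪ ｛ n ｝) q)
            edge {p} {q} pq∈E with covered pq∈E
            ... | inj₁ p∈A = half-edge p∈A
            ... | inj₂ q∈A = trans (cong₂ _+_ (crossing-comm ((Y ∪ ｛ n ｝) p) ((Y ∪ ｛ n ｝) q)) (crossing-comm (｛ t ｝ p) (｛ t ｝ q)))
                  (trans (half-edge q∈A) (cong₂ _+_ (crossing-comm (Y q) (Y p)) (crossing-comm ((｛ t ｝ ∪ ｛ n ｝) q) ((｛ t ｝ ∪ ｛ n ｝) p))))
            -- All edges between `n` and `Y` end in `t`, so `n` changes the cut of `Y` by as much as
            -- it changes that of `t` alone; there `star` provides what a pair at `n` costs.
            bound′ : cut M (Y ∪ ｛ n ｝) + K ≤ cut E (Y ∪ ｛ n ｝)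
            bound′ = ℕ.+-cancelʳ-≤ K _ _ (begin
              cut M (Y ∪ ｛ n ｝) + K + K              ≤⟨ ℕ.+-monoˡ-≤ K (ℕ.+-monoˡ-≤ K (cut-∪ M Y ｛ n ｝)) ⟩
              cut M Y + cut M ｛ n ｝ + K + K          ≡⟨ cong (_+ K) (trans (ℕ.+-assoc (cut M Y) _ K) (trans (cong (_+_ (cut M Y)) (ℕ.+-comm _ K)) (sym (ℕ.+-assoc (cut M Y) K _)))) ⟩
              cut M Y + K + cut M ｛ n ｝ + K          ≤⟨ ℕ.+-monoˡ-≤ K (ℕ.+-monoˡ-≤ _ bound) ⟩
              cut E Y + cut M ｛ n ｝ + K              ≡⟨ trans (ℕ.+-assoc (cut E Y) _ K) (cong (_+_ (cut E Y)) (ℕ.+-comm _ K)) ⟩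
              cut E Y + (K + cut M ｛ n ｝)            ≤⟨ ℕ.+-monoʳ-≤ (cut E Y) (star n≢t n∉A) ⟩
              cut E Y + cut E (｛ t ｝ ∪ ｛ n ｝)      ≡⟨ cut-balance-on E edge ⟨
              cut E (Y ∪ ｛ n ｝) + cut E ｛ t ｝      ≡⟨ cong (_+_ (cut E (Y ∪ ｛ n ｝))) (proj₂ sat) ⟩
              cut E (Y ∪ ｛ n ｝) + K                  ∎)

          stage : ∀ L → Stage L
          stage [] = record
            { Y      = ｛ t ｝
            ; Y⊆X    = λ tv → subst (λ v → X v ≡ true) (sym (｛｝-true tv)) t∈X
            ; t∈Y    = ｛｝-∈ t
            ; covers = λ ()
            ; bound  = ℕ.≤-reflexive (trans (cong (_+ K) t-free) (sym (proj₂ sat)))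
            }
          stage (n ∷ L) with S ← stage L with Stage.Y S n in Yn | X n in Xn
          ... | false | true  = add S Xn Yn
          ... | true  | _     = record { Stage S ; covers = λ { (here refl) _ → Yn ; (there v∈L) → Stage.covers S v∈L } }
          ... | false | false = record { Stage S ; covers = λ { (here refl) Xv → contradiction (trans (sym Xn) Xv) false≢true
                                                              ; (there v∈L) → Stage.covers S v∈L } }

          -- `X` may be infinite, but `E` and `M` see only finitely many vertices of it.
          ends : List V
          ends = map proj₁ (E ++ M) ++ map proj₂ (E ++ M)

          open Stage (stage ends)

          Y≡X : ∀ {v} → v ∈ ends → Y v ≡ X v
          Y≡X {v} v∈ with X v in Xv
          ... | true  = covers v∈ Xv
          ... | false = Bool.¬-not λ Yv → false≢true (trans (sym Xv) (Y⊆X Yv))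

          agree : ∀ {p q} → (p , q) ∈ E ++ M → Y p ≡ X p × Y q ≡ X q
          agree pq∈ = Y≡X (∈-++⁺ˡ (∈-map⁺ proj₁ pq∈)) , Y≡X (∈-++⁺ʳ (map proj₁ (E ++ M)) (∈-map⁺ proj₂ pq∈))

          result : cut M X + K ≤ cut E X
          result = begin
            cut M X + K ≡⟨ cong (_+ K) (cut-cong-on M (agree ∘ ∈-++⁺ʳ E)) ⟨
            cut M Y + K ≤⟨ bound ⟩
            cut E Y     ≡⟨ cut-cong-on E (agree ∘ ∈-++⁺ˡ) ⟩
            cut E X     ∎

        only : ∀ {X z} → ¬ Splits A₁ X → X t ≡ true → z ∈ A → X z ≡ false → ∀ {a} → a ∈ A → X a ≡ true → a ≡ t
        only {X} {z} ¬s Xt z∈A Xz {a} a∈A Xa with a ≟ t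
        ... | yes a≡t = a≡t
        ... | no  a≢t = ⊥-elim (¬s ((a , ∈-A₁ a∈A a≢t , Xa) ,
                (z , ∈-A₁ z∈A (λ { refl → false≢true (trans (sym Xz) Xt) }) , Xz)))

        split : ∀ X → Splits A X → cut M X + K ≤ cut E X
        split X s with em {Splits A₁ X}
        ... | yes s₁ = split₁ X s₁
        ... | no ¬s₁ with X t in Xt | s
        ...   | true  | _ , (z , z∈A , Xz) = Grow.result X Xt (only ¬s₁ Xt z∈A Xz) z∈A Xz
        ...   | false | (z , z∈A , Xz) , _ = begin
                cut M X + K     ≡⟨ cong (_+ K) (cut-∁ M X) ⟨
                cut M (∁ X) + K ≤⟨ Grow.result (∁ X) (cong not Xt) (only ¬s∁ (cong not Xt) z∈A (cong not Xz)) z∈A (cong not Xz) ⟩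
                cut E (∁ X)     ≡⟨ cut-∁ E X ⟩
                cut E X         ∎
          where
          open ℕ.≤-Reasoning
          ¬s∁ : ¬ Splits A₁ (∁ X)
          ¬s∁ ((b , b∈ , Xb) , (c , c∈ , Xc)) =
            ¬s₁ ((c , c∈ , Bool.not-injective Xc) , (b , b∈ , Bool.not-injective Xb))

        pairing′ : Pairing K A E
        pairing′ = record { pairs = M ; split = split ; below = below ; parity = parity ; simple = simple }

    -- A cut that forbids the deletion of `pq` falls below `K` without it; so it contains `pq` and
    -- has exactly `K` edges.
    tight-cut : ∀ {A E p q} → Connects K A E →
      ¬ (∃ λ e → ∃ λ E′ → E ↭ e ∷ E′ × Connects K A E′) →
      (p , q) ∈ E → ∃ λ X → Splits A X × cut E X ≡ K × X p ≢ X q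
    tight-cut {A} {E} {p} {q} con minimal pq∈E with E′ , E↭ ← extract pq∈E
      with em {∃ λ X → Splits A X × cut E′ X < K}
    ... | no none = ⊥-elim (minimal (_ , E′ , E↭ , λ X s → ℕ.≮⇒≥ λ lt → none (X , s , lt)))
    ... | yes (X , s , lt) = X , s , ℕ.≤-antisym E≤K (con X s) , crossing>0 (X p) (X q)
            (ℕ.+-cancelʳ-≤ (cut E′ X) 1 _ (ℕ.≤-trans lt (ℕ.≤-trans (con X s) (ℕ.≤-reflexive (cut-↭ E↭ X)))))
      where
      E≤K : cut E X ≤ K
      E≤K = ℕ.≤-trans (ℕ.≤-reflexive (cut-↭ E↭ X)) (ℕ.≤-trans (ℕ.+-monoˡ-≤ (cut E′ X) (crossing≤1 (X p) (X q))) lt)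

    decompose : ∀ {A E p q X} → Connects K A E → Adjacent E p q → ¬ Saturated A E p → ¬ Saturated A E q →
      Splits A X → cut E X ≡ K → X p ≡ true → X q ≡ false →
      (∀ {A′ E′} → length A′ ≤ length A → length E′ < length E → Connects K A′ E′ → Pairing K A′ E′) →
      Pairing K A E
    decompose {A} {E} {p} {q} {X} con pq ¬p ¬q s tight Xp Xq rec = D.glue
      (rec D.C₁.A₁≤A (D.C₁.E₁<E (edge-outside con s tight pq Xp Xq ¬q)) (D.C₁.connects con))
      (rec D.C₂.A₁≤A (D.C₂.E₁<E (edge-outside con (Splits-∁ s) (trans (cut-∁ E X) tight)
             (Sum.swap pq) (cong not Xq) (cong not Xp) ¬p)) (D.C₂.connects con))
      where
      module D = Decomposition {A} {E} {X} con s tight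

    -- Deleting an edge and contracting a side both shorten the list of edges without lengthening
    -- `A`; dropping a terminal shortens `A`.
    pairing-acc : ∀ A E → Acc _<_ (length A + length E) → Connects K A E → Pairing K A E
    pairing-acc A E (acc rec) con with em {∃ λ X → Splits A X}
    ... | no none = normalised E (λ X s → ⊥-elim (none (X , s))) (λ X → ℕ.≤-refl) (λ X → refl)
    ... | yes (X₀ , s₀) with em {∃ λ e → ∃ λ E′ → E ↭ e ∷ E′ × Connects K A E′}
    -- The deleted edge becomes a pair, so both sides of each condition change by the same amount.
    ...   | yes ((p , q) , E′ , E↭ , con′)
      with record { pairs = M ; split = split ; below = below ; parity = parity } ← pairing-acc A E′
             (rec (ℕ.+-monoʳ-< (length A) (ℕ.≤-reflexive (sym (↭-length E↭))))) con′ = normalised ((p , q) ∷ M)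
        (λ X s → ℕ.≤-trans (ℕ.≤-reflexive (ℕ.+-assoc (crossing (X p) (X q)) _ K))
          (ℕ.≤-trans (ℕ.+-monoʳ-≤ (crossing (X p) (X q)) (split X s)) (ℕ.≤-reflexive (sym (cut-↭ E↭ X)))))
        (λ X → ℕ.≤-trans (ℕ.+-monoʳ-≤ (crossing (X p) (X q)) (below X)) (ℕ.≤-reflexive (sym (cut-↭ E↭ X))))
        (λ X → trans (odd-+ (crossing (X p) (X q)) _) (trans (cong (odd (crossing (X p) (X q)) xor_) (parity X))
          (trans (sym (odd-+ (crossing (X p) (X q)) _)) (cong odd (sym (cut-↭ E↭ X))))))
    ...   | no minimal with em {∃ λ p → ∃ λ q → (p , q) ∈ E × ¬ Saturated A E p × ¬ Saturated A E q}
    ...     | yes (p , q , pq∈E , ¬p , ¬q) = case tight-cut con minimal pq∈E of λ where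
                (X , s , tight , Xp≢Xq) → helper X s tight Xp≢Xq
      where
      smaller : ∀ {A′ E′} → length A′ ≤ length A → length E′ < length E → Connects K A′ E′ → Pairing K A′ E′
      smaller A′≤A E′<E = pairing-acc _ _ (rec (ℕ.+-mono-≤-< A′≤A E′<E))
      helper : ∀ X → Splits A X → cut E X ≡ K → X p ≢ X q → Pairing K A E
      helper X s tight Xp≢Xq with X p in Xp | X q in Xq
      ... | true  | true  = contradiction refl Xp≢Xq
      ... | false | false = contradiction refl Xp≢Xq
      ... | true  | false = decompose con (inj₁ pq∈E) ¬p ¬q s tight Xp Xq smaller
      ... | false | true  = decompose con (inj₂ pq∈E) ¬q ¬p s tight Xq Xp smaller
    pairing-acc A E (acc rec) con | yes (X₀ , s₀) | no minimal | no none
      -- As `K` is positive, some edge crosses `X₀`, and one of its ends is a saturated terminal.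
      with p , q , pq∈E , _ ← cut>0 E X₀ (ℕ.≤-trans K>0 (con X₀ s₀)) = [ drop , drop ]′ (saturated pq∈E)
      where
      saturated : ∀ {p q} → (p , q) ∈ E → Saturated A E p ⊎ Saturated A E q
      saturated {p} {q} pq∈E with em {Saturated A E p} | em {Saturated A E q}
      ... | yes p-sat | _         = inj₁ p-sat
      ... | no _      | yes q-sat = inj₂ q-sat
      ... | no ¬p     | no ¬q     = ⊥-elim (none (p , q , pq∈E , ¬p , ¬q))
      drop : ∀ {t} → Saturated A E t → Pairing K A E
      drop sat = R.pairing′ (pairing-acc R.A₁ E (rec (ℕ.+-monoˡ-< (length E) R.A₁<A)) R.connects)
        where
        module R = Removal con sat (λ pq∈E → Sum.map proj₁ proj₁ (saturated pq∈E))
  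
    pairing : ∀ A E → Connects K A E → Pairing K A E
    pairing A E = pairing-acc A E (<-wellFounded _)

-- Orientations with prescribed net flow

indicator : Bool → ℤ
indicator true  = + 1
indicator false = + 0

-- With pairs read as arcs, this is the flow out of `X`: leaving minus entering arcs.
net : Pairs V → Cut V → ℤ
net []            X = + 0
net ((p , q) ∷ Q) X = (indicator (X p) ℤ.- indicator (X q)) ℤ.+ net Q X

net-++ : (P Q : Pairs V) (X : Cut V) → net (P ++ Q) X ≡ net P X ℤ.+ net Q X
net-++ []            Q X = sym (ℤ.+-identityˡ _)
net-++ ((p , q) ∷ P) Q X = trans (cong (ℤ._+_ (indicator (X p) ℤ.- indicator (X q))) (net-++ P Q X))
  (sym (ℤ.+-assoc (indicator (X p) ℤ.- indicator (X q)) _ _))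

net-map : (f : U → V) (Q : Pairs U) (X : Cut V) → net (map (Product.map f f) Q) X ≡ net Q (X ∘ f)
net-map f []      X = refl
net-map f ((p , q) ∷ Q) X = cong (ℤ._+_ (indicator (X (f p)) ℤ.- indicator (X (f q)))) (net-map f Q X)

net-cong : (Q : Pairs V) {X Y : Cut V} → (∀ v → X v ≡ Y v) → net Q X ≡ net Q Y
net-cong []            X≡Y = refl
net-cong ((p , q) ∷ Q) X≡Y = cong₂ ℤ._+_ (cong₂ (λ x y → indicator x ℤ.- indicator y) (X≡Y p) (X≡Y q)) (net-cong Q X≡Y)

net-∁ : (Q : Pairs V) (X : Cut V) → net Q (∁ X) ≡ ℤ.- net Q X
net-∁ []            X = refl
net-∁ ((p , q) ∷ Q) X = trans (cong₂ ℤ._+_ (pointwise (X p) (X q)) (net-∁ Q X))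
  (sym (ℤ.neg-distrib-+ (indicator (X p) ℤ.- indicator (X q)) _))
  where
  pointwise : ∀ x y → indicator (not x) ℤ.- indicator (not y) ≡ ℤ.- (indicator x ℤ.- indicator y)
  pointwise = from-yes (bool? λ x → bool? λ y →
    (indicator (not x) ℤ.- indicator (not y)) ℤ.≟ (ℤ.- (indicator x ℤ.- indicator y)))

net-modular : (Q : Pairs V) (X Y : Cut V) → net Q (X ∩ Y) ℤ.+ net Q (X ∪ Y) ≡ net Q X ℤ.+ net Q Y
net-modular []            X Y = refl
net-modular ((p , q) ∷ Q) X Y = trans (shuffle (w (X p ∧ Y p) (X q ∧ Y q)) (net Q (X ∩ Y)) (w (X p ∨ Y p) (X q ∨ Y q)) (net Q (X ∪ Y)))
  (trans (cong₂ ℤ._+_ (pointwise (X p) (X q) (Y p) (Y q)) (net-modular Q X Y))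
    (sym (shuffle (w (X p) (X q)) (net Q X) (w (Y p) (Y q)) (net Q Y))))
  where
  w : Bool → Bool → ℤ
  w x y = indicator x ℤ.- indicator y
  shuffle : ∀ a b c d → (a ℤ.+ b) ℤ.+ (c ℤ.+ d) ≡ (a ℤ.+ c) ℤ.+ (b ℤ.+ d)
  shuffle = solve-∀
  pointwise : ∀ x x′ y y′ → w (x ∧ y) (x′ ∧ y′) ℤ.+ w (x ∨ y) (x′ ∨ y′) ≡ w x x′ ℤ.+ w y y′
  pointwise = from-yes (bool? λ x → bool? λ x′ → bool? λ y → bool? λ y′ →
    (w (x ∧ y) (x′ ∧ y′) ℤ.+ w (x ∨ y) (x′ ∨ y′)) ℤ.≟ (w x x′ ℤ.+ w y y′))

leaving : Pairs V → Cut V → ℕ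
leaving []            X = 0
leaving ((p , q) ∷ Q) X = (if X p ∧ not (X q) then 1 else 0) + leaving Q X

cut≡net+entering : (Q : Pairs V) (X : Cut V) →
  + cut Q X ≡ net Q X ℤ.+ + (leaving Q (∁ X) + leaving Q (∁ X))
cut≡net+entering []            X = refl
cut≡net+entering ((p , q) ∷ Q) X = trans (cong (ℤ._+_ (+ crossing (X p) (X q))) (cut≡net+entering Q X))
  (pointwise (X p) (X q))
  where
  w : Bool → Bool → ℤ
  w x y = indicator x ℤ.- indicator y
  L = leaving Q (∁ X)
  n = net Q X
  up : ∀ n l → + 1 ℤ.+ (n ℤ.+ (l ℤ.+ l)) ≡ (ℤ.- + 1 ℤ.+ n) ℤ.+ ((+ 1 ℤ.+ l) ℤ.+ (+ 1 ℤ.+ l))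
  up = solve-∀
  pointwise : ∀ x y → + crossing x y ℤ.+ (n ℤ.+ + (L + L)) ≡ (w x y ℤ.+ n) ℤ.+
    + (((if not x ∧ not (not y) then 1 else 0) + L) + ((if not x ∧ not (not y) then 1 else 0) + L))
  pointwise true  true  = trans (ℤ.+-identityˡ _) (cong (ℤ._+ + (L + L)) (sym (ℤ.+-identityˡ n)))
  pointwise true  false = sym (ℤ.+-assoc (+ 1) n (+ (L + L)))
  pointwise false true  = up n (+ L)
  pointwise false false = trans (ℤ.+-identityˡ _) (cong (ℤ._+ + (L + L)) (sym (ℤ.+-identityˡ n)))

leaving-∁∁ : (Q : Pairs V) (X : Cut V) → leaving Q (∁ (∁ X)) ≡ leaving Q X
leaving-∁∁ []            X = refl
leaving-∁∁ ((p , q) ∷ Q) X rewrite Bool.not-involutive (X p) | Bool.not-involutive (X q) =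
  cong (_+_ _) (leaving-∁∁ Q X)

cut+net≡leaving : (Q : Pairs V) (X : Cut V) → + cut Q X ℤ.+ net Q X ≡ + (leaving Q X + leaving Q X)
cut+net≡leaving Q X = begin
  + cut Q X ℤ.+ net Q X                                         ≡⟨ cong (λ c → + c ℤ.+ net Q X) (cut-∁ Q X) ⟨
  + cut Q (∁ X) ℤ.+ net Q X                                     ≡⟨ cong (ℤ._+ net Q X) (cut≡net+entering Q (∁ X)) ⟩
  (net Q (∁ X) ℤ.+ + _) ℤ.+ net Q X                             ≡⟨ cong (λ t → (t ℤ.+ + (l + l)) ℤ.+ net Q X) (net-∁ Q X) ⟩
  (ℤ.- net Q X ℤ.+ + (l + l)) ℤ.+ net Q X                       ≡⟨ cancel (net Q X) (+ (l + l)) ⟩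
  + (l + l)                                                     ≡⟨ cong (λ t → + (t + t)) (leaving-∁∁ Q X) ⟩
  + (leaving Q X + leaving Q X)                                 ∎
  where
  open ≡-Reasoning
  l = leaving Q (∁ (∁ X))
  cancel : ∀ n l → (ℤ.- n ℤ.+ l) ℤ.+ n ≡ l
  cancel = solve-∀

SameEnds : V × V → V × V → Set _
SameEnds e a = a ≡ e ⊎ a ≡ swap e

Orients : Pairs V → Pairs V → Set _
Orients = Pointwise SameEnds

-- c is the number of edges of F that enter X when F is oriented with the net
-- flow of Q; it encodes both net Q X ≤ cut F X and the equality of parities.
Slack : Pairs V → Pairs V → Set _
Slack F Q = ∀ X → ∃ λ c → + cut F X ≡ net Q X ℤ.+ + (c + c)

-- Once the edge is directed from `p` to `q`, the flow of `Q` minus this arc remains to be realised;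
-- adding the reversed pair to `Q` expresses that. Only sets containing `q` but not `p` lose slack,
-- namely one entering edge.
orient-edge : ∀ {p q : V} {F Q} (slack : Slack ((p , q) ∷ F) Q) →
  (∀ X → X p ≡ false → X q ≡ true → proj₁ (slack X) ≢ 0) → Slack F ((q , p) ∷ Q)
orient-edge {p = p} {q} {F} {Q} slack room X
  with X p | X q | slack X | room X
... | true  | true  | c , eq | _ = c , trans eq (cong (ℤ._+ + (c + c)) (sym (ℤ.+-identityˡ (net Q X))))
... | false | false | c , eq | _ = c , trans eq (cong (ℤ._+ + (c + c)) (sym (ℤ.+-identityˡ (net Q X))))
... | true  | false | c , eq | _ = c , trans (down (+ cut F X)) (trans (cong (ℤ._+_ (ℤ.- + 1)) eq)
      (sym (ℤ.+-assoc (ℤ.- + 1) (net Q X) (+ (c + c)))))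
  where
  down : ∀ n → n ≡ ℤ.- + 1 ℤ.+ (+ 1 ℤ.+ n)
  down = solve-∀
... | false | true  | zero  , eq | r = contradiction refl (r refl refl)
... | false | true  | suc c , eq | _ = c , trans (down (+ cut F X)) (trans (cong (ℤ._+_ (ℤ.- + 1)) eq)
      (shift-one (net Q X) (+ c)))
  where
  down : ∀ n → n ≡ ℤ.- + 1 ℤ.+ (+ 1 ℤ.+ n)
  down = solve-∀
  shift-one : ∀ n c → ℤ.- + 1 ℤ.+ (n ℤ.+ ((+ 1 ℤ.+ c) ℤ.+ (+ 1 ℤ.+ c))) ≡ (+ 1 ℤ.+ n) ℤ.+ (c ℤ.+ c)
  shift-one = solve-∀

-- If neither orientation of pq left room, then X and Y would be tight with
-- p ∈ Y ∖ X and q ∈ X ∖ Y, contradicting the strict submodularity at pq.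
conflict : ∀ {p q : V} {F Q} (slack : Slack ((p , q) ∷ F) Q) X Y →
  X p ≡ false → X q ≡ true → proj₁ (slack X) ≡ 0 →
  Y p ≡ true → Y q ≡ false → proj₁ (slack Y) ≡ 0 → ⊥
conflict {p = p} {q} {F} {Q} slack X Y Xp Xq cX Yp Yq cY = ℕ.<-irrefl refl (begin-strict
  cut F X + cut F Y                         <⟨ s≤s (ℕ.≤-trans (ℕ.n≤1+n _) (ℕ.m≤m+n _ _)) ⟩
  suc (suc (cut F X + cut F Y)) + (i + u)   ≡⟨ cong (_+ (i + u)) (cong suc (sym (ℕ.+-suc (cut F X) (cut F Y)))) ⟩
  (suc (cut F X) + suc (cut F Y)) + (i + u) ≡⟨ ℤ.+-injective total ⟨
  cut F (X ∩ Y) + cut F (X ∪ Y)             ≤⟨ cut-submodular F X Y ⟩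
  cut F X + cut F Y                         ∎)
  where
  open ℕ.≤-Reasoning
  E = (p , q) ∷ F
  i = proj₁ (slack (X ∩ Y)) + proj₁ (slack (X ∩ Y))
  u = proj₁ (slack (X ∪ Y)) + proj₁ (slack (X ∪ Y))
  cut-∩E : cut E (X ∩ Y) ≡ cut F (X ∩ Y)
  cut-∩E = cong (_+ cut F (X ∩ Y)) (cong₂ crossing (cong (_∧ Y p) Xp) (cong₂ _∧_ Xq Yq))
  cut-∪E : cut E (X ∪ Y) ≡ cut F (X ∪ Y)
  cut-∪E = cong (_+ cut F (X ∪ Y)) (cong₂ crossing (cong₂ _∨_ Xp Yp) (cong (_∨ Y q) Xq))
  tight : ∀ Z → proj₁ (slack Z) ≡ 0 → net Q Z ≡ + cut E Z
  tight Z c≡0 = trans (sym (ℤ.+-identityʳ _))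
    (trans (cong (λ c → net Q Z ℤ.+ + (c + c)) (sym c≡0)) (sym (proj₂ (slack Z))))
  cut-XE : cut E X ≡ suc (cut F X)
  cut-XE = cong (_+ cut F X) (cong₂ crossing Xp Xq)
  cut-YE : cut E Y ≡ suc (cut F Y)
  cut-YE = cong (_+ cut F Y) (cong₂ crossing Yp Yq)
  regroup : ∀ a i b u → (a ℤ.+ i) ℤ.+ (b ℤ.+ u) ≡ (a ℤ.+ b) ℤ.+ (i ℤ.+ u)
  regroup = solve-∀
  module ℤR = ≡-Reasoning
  total : + (cut F (X ∩ Y) + cut F (X ∪ Y)) ≡ + ((suc (cut F X) + suc (cut F Y)) + (i + u))
  total = ℤR.begin
    + (cut F (X ∩ Y) + cut F (X ∪ Y))                       ℤR.≡⟨ cong₂ (λ a b → + (a + b)) cut-∩E cut-∪E ⟨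
    + cut E (X ∩ Y) ℤ.+ + cut E (X ∪ Y)                     ℤR.≡⟨ cong₂ ℤ._+_ (proj₂ (slack (X ∩ Y))) (proj₂ (slack (X ∪ Y))) ⟩
    (net Q (X ∩ Y) ℤ.+ + i) ℤ.+ (net Q (X ∪ Y) ℤ.+ + u)     ℤR.≡⟨ regroup (net Q (X ∩ Y)) (+ i) (net Q (X ∪ Y)) (+ u) ⟩
    (net Q (X ∩ Y) ℤ.+ net Q (X ∪ Y)) ℤ.+ + (i + u)         ℤR.≡⟨ cong (ℤ._+ + (i + u)) (net-modular Q X Y) ⟩
    (net Q X ℤ.+ net Q Y) ℤ.+ + (i + u)                     ℤR.≡⟨ cong (ℤ._+ + (i + u)) (cong₂ ℤ._+_ (tight X cX) (tight Y cY)) ⟩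
    + (cut E X + cut E Y + (i + u))                         ℤR.≡⟨ cong₂ (λ a b → + (a + b + (i + u))) cut-XE cut-YE ⟩
    + ((suc (cut F X) + suc (cut F Y)) + (i + u))           ℤR.∎

-- Edges are directed one at a time while `Slack` is maintained; when a tight set blocks one
-- direction, `conflict` frees the other. Once no edges are left, the slacks of a set and its
-- complement add up to zero, so both vanish.
orient : ExcludedMiddle ℓ → {V : Set ℓ} (F Q : Pairs V) → Slack F Q →
  ∃ λ D → Orients F D × (∀ X → net D X ≡ net Q X)
orient em [] Q slack = [] , [] , λ X → sym (balanced X)
  where
  sum : ∀ n c d → (n ℤ.+ c) ℤ.+ (ℤ.- n ℤ.+ d) ≡ c ℤ.+ d
  sum = solve-∀
  balanced : ∀ X → net Q X ≡ + 0
  balanced X with c , eq ← slack X with d , eq∁ ← slack (∁ X) = begin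
    net Q X                ≡⟨ ℤ.+-identityʳ _ ⟨
    net Q X ℤ.+ + 0        ≡⟨ cong (λ t → net Q X ℤ.+ + t) c+c≡0 ⟨
    net Q X ℤ.+ + (c + c)  ≡⟨ eq ⟨
    + 0                    ∎
    where
    open ≡-Reasoning
    c+c≡0 : c + c ≡ 0
    c+c≡0 = ℕ.m+n≡0⇒m≡0 (c + c) {d + d} (ℤ.+-injective (begin
      + (c + c + (d + d))                                         ≡⟨ sum (net Q X) (+ (c + c)) (+ (d + d)) ⟨
      (net Q X ℤ.+ + (c + c)) ℤ.+ (ℤ.- net Q X ℤ.+ + (d + d))     ≡⟨ cong (λ t → (net Q X ℤ.+ + (c + c)) ℤ.+ (t ℤ.+ + (d + d))) (net-∁ Q X) ⟨
      (net Q X ℤ.+ + (c + c)) ℤ.+ (net Q (∁ X) ℤ.+ + (d + d))     ≡⟨ cong₂ ℤ._+_ eq eq∁ ⟨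
      + 0                                                         ∎))
orient em {V} ((p , q) ∷ F) Q slack
  with em {∃ λ X → X p ≡ false × X q ≡ true × proj₁ (slack X) ≡ 0}
... | no none = extend (orient em F ((q , p) ∷ Q) (orient-edge {F = F} {Q} slack λ X Xp Xq c≡0 → none (X , Xp , Xq , c≡0)))
  where
  cancel : ∀ x y n → (x ℤ.- y) ℤ.+ ((y ℤ.- x) ℤ.+ n) ≡ n
  cancel = solve-∀
  extend : (∃ λ D → Orients F D × (∀ X → net D X ≡ net ((q , p) ∷ Q) X)) →
    ∃ λ D → Orients ((p , q) ∷ F) D × (∀ X → net D X ≡ net Q X)
  extend (D , F~D , D≡Q) = (p , q) ∷ D , inj₁ refl ∷ F~D , λ X →
    trans (cong (ℤ._+_ (indicator (X p) ℤ.- indicator (X q))) (D≡Q X)) (cancel (indicator (X p)) (indicator (X q)) (net Q X))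
... | yes (X , Xp , Xq , cX) = extend (orient em F ((p , q) ∷ Q) (orient-edge {p = q} {p} {F} {Q} flipped
        λ Y Yq Yp cY → conflict {F = F} {Q} slack X Y Xp Xq cX Yp Yq cY))
  where
  flipped : Slack ((q , p) ∷ F) Q
  flipped Y = proj₁ (slack Y) , trans (cong (λ t → + (t + cut F Y)) (crossing-comm (Y q) (Y p))) (proj₂ (slack Y))
  cancel : ∀ x y n → (x ℤ.- y) ℤ.+ ((y ℤ.- x) ℤ.+ n) ≡ n
  cancel = solve-∀
  extend : (∃ λ D → Orients F D × (∀ X → net D X ≡ net ((p , q) ∷ Q) X)) →
    ∃ λ D → Orients ((p , q) ∷ F) D × (∀ X → net D X ≡ net Q X)
  extend (D , F~D , D≡Q) = (q , p) ∷ D , inj₂ refl ∷ F~D , λ X →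
    trans (cong (ℤ._+_ (indicator (X q) ℤ.- indicator (X p))) (D≡Q X)) (cancel (indicator (X q)) (indicator (X p)) (net Q X))

-- Orientations subject to finitely many constraints

unique-⊆ : {xs ys : List A} → Unique xs → (∀ {x} → x ∈ xs → x ∈ ys) → length xs ≤ length ys
unique-⊆ {xs = []}     _        _  = z≤n
unique-⊆ {xs = x ∷ xs} (x∉ ∷ u) ⊆ with ys′ , ys↭ ← extract (⊆ (here refl)) =
  ℕ.≤-trans (s≤s (unique-⊆ u λ {z} z∈xs → strip (All.lookup x∉ z∈xs) (∈-resp-↭ ys↭ (⊆ (there z∈xs)))))
    (ℕ.≤-reflexive (sym (↭-length ys↭)))
  where
  strip : ∀ {z} → x ≢ z → z ∈ x ∷ ys′ → z ∈ ys′
  strip x≢z (here z≡x)  = contradiction (sym z≡x) x≢z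
  strip _   (there z∈) = z∈

++-orients : {P Q D D′ : Pairs V} → Orients P D → Orients Q D′ → Orients (P ++ Q) (D ++ D′)
++-orients []        rel′ = rel′
++-orients (s ∷ rel) rel′ = s ∷ ++-orients rel rel′

++-split : {P Q : Pairs V} {D : Pairs V} → Orients (P ++ Q) D →
  ∃ λ D₁ → ∃ λ D₂ → D ≡ D₁ ++ D₂ × Orients P D₁ × Orients Q D₂
++-split {P = []}    o       = [] , _ , refl , [] , o
++-split {P = _ ∷ P} (e ∷ o) with D₁ , D₂ , refl , o₁ , o₂ ← ++-split {P = P} o =
  _ , D₂ , refl , e ∷ o₁ , o₂

unmap : (f : U → V) {P : Pairs U} {D : Pairs V} → Orients (map (Product.map f f) P) D →
  ∃ λ D′ → Orients P D′ × map (Product.map f f) D′ ≡ D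
unmap f {[]}    []      = [] , [] , refl
unmap f {e ∷ P} (s ∷ o) with D′ , o′ , refl ← unmap f {P} o | s
... | inj₁ refl = e ∷ D′ , inj₁ refl ∷ o′ , refl
... | inj₂ refl = swap e ∷ D′ , inj₂ refl ∷ o′ , refl

cut-orients : {P D : Pairs V} → Orients P D → ∀ X → cut D X ≡ cut P X
cut-orients []               X = refl
cut-orients (inj₁ refl ∷ o)  X = cong (_+_ _) (cut-orients o X)
cut-orients (_∷_ {x = p , q} (inj₂ refl) o) X = cong₂ _+_ (crossing-comm (X q) (X p)) (cut-orients o X)

-- Twice the number of leaving arcs is cut plus net flow. The net flows agree, so `D` exceeds `D′`
-- in this quantity by at least `K`. Different vertex types admit a pairing that lives on a
-- quotient.
leaving-bound : (D : Pairs U) (D′ : Pairs V) {X : Cut U} {X′ : Cut V} {K : ℕ} →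
  cut D′ X′ + K ≤ cut D X → net D X ≡ net D′ X′ → K ≤ leaving D X + leaving D X
leaving-bound D D′ {X} {X′} {K} gap net≡ = ℕ.≤-trans (ℕ.m≤m+n K l′) (ℕ.+-cancelˡ-≤ (cut D′ X′) _ _ (begin
  cut D′ X′ + (K + l′)  ≡⟨ ℕ.+-assoc (cut D′ X′) K l′ ⟨
  cut D′ X′ + K + l′    ≤⟨ ℕ.+-monoˡ-≤ l′ gap ⟩
  cut D X + l′          ≡⟨ ℤ.+-injective total ⟩
  cut D′ X′ + l         ∎))
  where
  open ℕ.≤-Reasoning
  l  = leaving D X + leaving D X
  l′ = leaving D′ X′ + leaving D′ X′
  exchange : ∀ c c′ n → c ℤ.+ (c′ ℤ.+ n) ≡ c′ ℤ.+ (c ℤ.+ n)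
  exchange = solve-∀
  total : + (cut D X + l′) ≡ + (cut D′ X′ + l)
  total = trans (cong (ℤ._+_ (+ cut D X)) (sym (cut+net≡leaving D′ X′)))
    (trans (exchange (+ cut D X) (+ cut D′ X′) (net D′ X′))
      (cong (ℤ._+_ (+ cut D′ X′)) (trans (cong (ℤ._+_ (+ cut D X)) (sym net≡)) (cut+net≡leaving D X))))

halve : ∀ {m n} → m + m ≤ n + n → m ≤ n
halve {m} {n} le with m ≤? n
... | yes m≤n = m≤n
... | no  m≰n = contradiction le (ℕ.<⇒≱ (ℕ.+-mono-< (ℕ.≰⇒> m≰n) (ℕ.≰⇒> m≰n)))

bitstrings : ℕ → List (List Bool)
bitstrings zero    = [] ∷ []
bitstrings (suc n) = map (true ∷_) (bitstrings n) ++ map (false ∷_) (bitstrings n)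

∈-bitstrings : ∀ bs → bs ∈ bitstrings (length bs)
∈-bitstrings []           = here refl
∈-bitstrings (true ∷ bs)  = ∈-++⁺ˡ (∈-map⁺ (true ∷_) (∈-bitstrings bs))
∈-bitstrings (false ∷ bs) = ∈-++⁺ʳ (map (true ∷_) (bitstrings (length bs))) (∈-map⁺ (false ∷_) (∈-bitstrings bs))

lower-em : ∀ a {b} → ExcludedMiddle (a ⊔ b) → ExcludedMiddle a
lower-em a {b} em {P} = map′ lower lift (em {Lift b P})

module FiniteOrientation (em : ExcludedMiddle (a ⊔ b)) (G : Graph a b) where
  open Graph G

  em-vertex : ExcludedMiddle a
  em-vertex = lower-em a {b} em

  em-edge : ExcludedMiddle b
  em-edge = lower-em b {a} em

  em₀ : ExcludedMiddle Level.zero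
  em₀ = lower-em Level.zero {a ⊔ b} em

  module VP = Pairings em-vertex {Vertex}
  module BP = Pairings em₀ {List Bool}

  _≟ᵉ_ : (e f : Edge) → Dec (e ≡ f)
  e ≟ᵉ f = em-edge

  ends : Edge → Vertex × Vertex
  ends e = end₁ e , end₂ e

  arc : (Edge → Bool) → Edge → Vertex × Vertex
  arc o e = if o e then ends e else swap (ends e)

  Out : (Edge → Bool) → Cut Vertex → Edge → Set
  Out o X e = X (proj₁ (arc o e)) ≡ true × X (proj₂ (arc o e)) ≡ false

  Covers : Cut Vertex → List Edge → Set b
  Covers X L = ∀ e → X (end₁ e) ≢ X (end₂ e) → e ∈ L

  -- Infinitely many edges may leave `X`, so they are counted through the lists that contain them
  -- all.
  OutDegree≥ : ℕ → (Edge → Bool) → Cut Vertex → Set b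
  OutDegree≥ k o X = ∀ D → (∀ e → Out o X e → e ∈ D) → k ≤ length D

  Proper : Cut Vertex → Set a
  Proper X = (∃ λ v → X v ≡ true) × (∃ λ v → X v ≡ false)

  record Ring : Set (a ⊔ b) where
    field
      edges     : List Edge
      terminals : List Vertex
      pairing   : VP.Pairing 2 terminals (map ends edges)

    open VP.Pairing pairing public

  -- All sets `X` are involved, but only the directions of the finitely many ring edges matter, so
  -- compactness applies.
  Linked : (Edge → Bool) → Ring → Set (a ⊔ b)
  Linked o r = ∀ X → VP.Splits (Ring.terminals r) X → ∃ λ e → e ∈ Ring.edges r × Out o X e

  cut-length : ∀ Es X → cut (map ends Es) X ≡ length (filter (λ e → ¬? (X (end₁ e) Bool.≟ X (end₂ e))) Es)
  cut-length []       X = refl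
  cut-length (e ∷ Es) X with X (end₁ e) | X (end₂ e)
  ... | true  | true  = cut-length Es X
  ... | true  | false = cong suc (cut-length Es X)
  ... | false | true  = cong suc (cut-length Es X)
  ... | false | false = cut-length Es X

  Out? : ∀ o X e → Dec (Out o X e)
  Out? o X e = (X (proj₁ (arc o e)) Bool.≟ true) ×-dec (X (proj₂ (arc o e)) Bool.≟ false)

  leaving-length : ∀ o Es X → leaving (map (arc o) Es) X ≡ length (filter (Out? o X) Es)
  leaving-length o []       X = refl
  leaving-length o (e ∷ Es) X with X (proj₁ (arc o e)) | X (proj₂ (arc o e))
  ... | true  | false = cong suc (leaving-length o Es X)
  ... | true  | true  = leaving-length o Es X
  ... | false | true  = leaving-length o Es X
  ... | false | false = leaving-length o Es X

  leaving>0 : ∀ o Es X → 1 ≤ leaving (map (arc o) Es) X → ∃ λ e → e ∈ Es × Out o X e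
  leaving>0 o Es X 1≤ with filter (Out? o X) Es in eq | subst (1 ≤_) (leaving-length o Es X) 1≤
  ... | e ∷ _ | _ = e , ∈-filter⁻ (Out? o X) (subst (e ∈_) (sym eq) (here refl))

  -- Since no edge is listed twice, directing the head of the list does not disturb the choices for
  -- the rest.
  realise : ∀ {Es D} → Unique Es → Orients (map ends Es) D → ∃ λ o → map (arc o) Es ≡ D
  realise {[]}     _        []      = (λ _ → true) , refl
  realise {e ∷ Es} (e∉ ∷ u) (s ∷ r) with o , refl ← realise u r = o′ s , cong₂ _∷_ (at-e s) (rest s)
    where
    choice : ∀ {c} → SameEnds (ends e) c → Bool
    choice (inj₁ _) = true
    choice (inj₂ _) = false
    o′ : ∀ {c} → SameEnds (ends e) c → Edge → Bool
    o′ s f = if does (f ≟ᵉ e) then choice s else o f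
    at-e : ∀ {c} (s : SameEnds (ends e) c) → arc (o′ s) e ≡ c
    at-e s rewrite dec-true (e ≟ᵉ e) refl with s
    ... | inj₁ refl = refl
    ... | inj₂ refl = refl
    rest : ∀ {c} (s : SameEnds (ends e) c) → map (arc (o′ s)) Es ≡ map (arc o) Es
    rest s = List.map-cong-local (All.map away e∉)
      where
      away : ∀ {f} → e ≢ f → arc (o′ s) f ≡ arc o f
      away {f} e≢f rewrite dec-false (f ≟ᵉ e) (e≢f ∘ sym) = refl

  arcs-cancel : ∀ {Es D} {o : Edge → Bool} {xs ys} → Orients (map ends Es) D →
    map (arc o) Es ++ xs ≡ D ++ ys → map (arc o) Es ≡ D × xs ≡ ys
  arcs-cancel {[]}     []        eq = refl , eq
  arcs-cancel {e ∷ Es} (_ ∷ rel) eq with eq₁ , eq₂ ← arcs-cancel {Es} rel (List.∷-injectiveʳ eq) =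
    cong₂ _∷_ (List.∷-injectiveˡ eq) eq₁ , eq₂

  -- The pairings of the rings having been oriented as D, each ring is
  -- oriented so as to carry the same net flow as its pairing.
  orient-rings : ∀ Rs {D} → Orients (concatMap Ring.pairs Rs) D →
    ∃ λ DF → Orients (map ends (concatMap Ring.edges Rs)) DF × (∀ X → net DF X ≡ net D X) ×
      (∀ o → map (arc o) (concatMap Ring.edges Rs) ≡ DF → All (Linked o) Rs)
  orient-rings []       []  = [] , [] , (λ X → refl) , λ _ _ → []
  orient-rings (r ∷ Rs) rel
    with D₁ , D₂ , refl , rel₁ , rel₂ ← ++-split {P = Ring.pairs r} rel
    with DF₂ , relF₂ , net₂ , linked₂ ← orient-rings Rs rel₂
    = finish (orient em-vertex (map ends (Ring.edges r)) D₁ slack)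
    where
    open Ring r
    slack : Slack (map ends edges) D₁
    slack X with c , eq ← even-gap (below X) (parity X) = l + c ,
      trans (cong +_ (trans eq (cong (_+ (c + c)) (sym (cut-orients rel₁ X)))))
        (trans (cong (ℤ._+ + (c + c)) (cut≡net+entering D₁ X)) (double (net D₁ X) (+ l) (+ c)))
      where
      l = leaving D₁ (∁ X)
      double : ∀ n l c → (n ℤ.+ (l ℤ.+ l)) ℤ.+ (c ℤ.+ c) ≡ n ℤ.+ ((l ℤ.+ c) ℤ.+ (l ℤ.+ c))
      double = solve-∀
    finish : (∃ λ DF₁ → Orients (map ends edges) DF₁ × (∀ X → net DF₁ X ≡ net D₁ X)) →
      ∃ λ DF → Orients (map ends (edges ++ concatMap Ring.edges Rs)) DF × (∀ X → net DF X ≡ net (D₁ ++ D₂) X) ×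
        (∀ o → map (arc o) (edges ++ concatMap Ring.edges Rs) ≡ DF → All (Linked o) (r ∷ Rs))
    finish (DF₁ , relF₁ , net₁) = DF₁ ++ DF₂ ,
      subst (λ P → Orients P (DF₁ ++ DF₂)) (sym (List.map-++ ends edges _)) (++-orients relF₁ relF₂) ,
      (λ X → trans (net-++ DF₁ DF₂ X) (trans (cong₂ ℤ._+_ (net₁ X) (net₂ X)) (sym (net-++ D₁ D₂ X)))) ,
      λ o eq → let eq₁ , eq₂ = arcs-cancel relF₁ (trans (sym (List.map-++ (arc o) edges _)) eq)
               in linked o eq₁ ∷ linked₂ o eq₂
      where
      linked : ∀ o → map (arc o) edges ≡ DF₁ → Linked o r
      linked o refl X s = leaving>0 o edges X (halve (leaving-bound (map (arc o) edges) D₁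
        (ℕ.≤-trans (ℕ.≤-reflexive (cong (_+ 2) (cut-orients rel₁ X)))
          (ℕ.≤-trans (split X s) (ℕ.≤-reflexive (sym (cut-orients relF₁ X))))) (net₁ X)))

  -- The Eulerian orientation of a finite quotient

  module _ (k : ℕ) (k>0 : 1 ≤ k)
           (connected : ∀ X L → Covers X L → Proper X → k + k ≤ length L)
           (Rs : List Ring) (unique : Unique (concatMap Ring.edges Rs))
           (Xs : List (Cut Vertex × List Edge)) (covers : ∀ {X L} → (X , L) ∈ Xs → Covers X L) where

    inside : Vertex → Cut Vertex × List Edge → Bool
    inside v (X , _) = X v

    class : Vertex → List Bool
    class v = map (inside v) Xs

    class-separates : ∀ {u v} → class u ≢ class v → ∃ λ XL → XL ∈ Xs × proj₁ XL u ≢ proj₁ XL v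
    class-separates {u} {v} = go Xs
      where
      go : ∀ Xs → map (inside u) Xs ≢ map (inside v) Xs → ∃ λ XL → XL ∈ Xs × proj₁ XL u ≢ proj₁ XL v
      go []        ≢ = contradiction refl ≢
      go (XL ∷ Xs) ≢ with proj₁ XL u Bool.≟ proj₁ XL v
      ... | no  X≢ = XL , here refl , X≢
      ... | yes X≡ with XL′ , XL′∈ , X≢ ← go Xs (λ eq → ≢ (cong₂ _∷_ X≡ eq)) = XL′ , there XL′∈ , X≢

    select : ∀ {X L} → (X , L) ∈ Xs → ∃ λ (Z : Cut (List Bool)) → ∀ v → Z (class v) ≡ X v
    select = go
      where
      go : ∀ {X L Xs} → (X , L) ∈ Xs → ∃ λ (Z : Cut (List Bool)) → ∀ v → Z (map (inside v) Xs) ≡ X v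
      go (here refl) = (λ { [] → false ; (x ∷ _) → x }) , λ v → refl
      go (there X∈) with Z , Z≡ ← go X∈ = (λ { [] → false ; (_ ∷ xs) → Z xs }) , Z≡

    nonempty? : (bs : List Bool) → Dec (∃ λ v → class v ≡ bs)
    nonempty? bs = em-vertex

    -- A bit string that is the class of no vertex has degree zero in the quotient, so it must not
    -- be a terminal.
    classes : List (List Bool)
    classes = filter nonempty? (bitstrings (length Xs))

    class-∈ : ∀ v → class v ∈ classes
    class-∈ v = ∈-filter⁺ nonempty?
      (subst (λ n → class v ∈ bitstrings n) (List.length-map _ Xs) (∈-bitstrings (class v))) (v , refl)

    FF : List Edge
    FF = concatMap Ring.edges Rs

    new? : (e : Edge) → Dec (e ∉ FF)
    new? e = ¬? (em-edge {e ∈ FF})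

    -- Ring edges are kept even where they cross no listed cut, because `Linked` concerns all sets
    -- of vertices.
    R₀ R E₀ : List Edge
    R₀ = filter new? (concatMap proj₂ Xs)
    R  = deduplicate _≟ᵉ_ R₀
    E₀ = FF ++ R

    E₀-unique : Unique E₀
    E₀-unique = Unique.++⁺ unique (UniqueDec.deduplicate-! _≟ᵉ_ R₀)
      λ (e∈FF , e∈R) → proj₂ (∈-filter⁻ new? {xs = concatMap proj₂ Xs} (∈-deduplicate⁻ _≟ᵉ_ R₀ e∈R)) e∈FF

    ∈-E₀ : ∀ {X L e} → (X , L) ∈ Xs → e ∈ L → e ∈ E₀
    ∈-E₀ {e = e} XL∈ e∈L with new? e
    ... | yes e∉FF = ∈-++⁺ʳ FF (∈-deduplicate⁺ _≟ᵉ_ (∈-filter⁺ new? (∈-concatMap⁺ proj₂ (Any.map (λ { refl → e∈L }) XL∈)) e∉FF))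
    ... | no ¬e∉FF with em-edge {e ∈ FF}
    ...   | yes e∈FF = ∈-++⁺ˡ e∈FF
    ...   | no  e∉FF = contradiction e∉FF ¬e∉FF

    quotient : Pairs Vertex → Pairs (List Bool)
    quotient = map (Product.map class class)

    EH : Pairs (List Bool)
    EH = quotient (map ends E₀)

    cut-EH : ∀ Z → cut EH Z ≡ cut (map ends E₀) (Z ∘ class)
    cut-EH = cut-map class (map ends E₀)

    -- An edge across `Z ∘ class` crosses one of the listed cuts. Hence `Z ∘ class` is itself a
    -- finite cut of `G`, and `connected` applies to it.
    EH-connects : BP.Connects (k + k) classes EH
    EH-connects Z ((c , c∈ , Zc) , (d , d∈ , Zd))
      with v , refl ← proj₂ (∈-filter⁻ nonempty? {xs = bitstrings (length Xs)} c∈)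
      with w , refl ← proj₂ (∈-filter⁻ nonempty? {xs = bitstrings (length Xs)} d∈) =
      ℕ.≤-trans (connected (Z ∘ class) _ crossing∈ ((v , Zc) , (w , Zd)))
        (ℕ.≤-reflexive (sym (trans (cut-EH Z) (cut-length E₀ (Z ∘ class)))))
      where
      crossing∈ : Covers (Z ∘ class) (filter (λ e → ¬? (Z (class (end₁ e)) Bool.≟ Z (class (end₂ e)))) E₀)
      crossing∈ e Z≢ with XL , XL∈ , X≢ ← class-separates (λ eq → Z≢ (cong Z eq)) =
        ∈-filter⁺ (λ e → ¬? (Z (class (end₁ e)) Bool.≟ Z (class (end₂ e)))) (∈-E₀ XL∈ (covers XL∈ e X≢)) Z≢

    module PH = BP.Pairing (BP.pairing (k + k) (ℕ.≤-trans k>0 (ℕ.m≤m+n k k)) (odd-double k) classes EH EH-connects)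

    MM : Pairs Vertex
    MM = concatMap Ring.pairs Rs

    MM-parity : ∀ X → odd (cut MM X) ≡ odd (cut (map ends FF) X)
    MM-parity X = go Rs
      where
      go : ∀ Rs → odd (cut (concatMap Ring.pairs Rs) X) ≡ odd (cut (map ends (concatMap Ring.edges Rs)) X)
      go []       = refl
      go (r ∷ Rs) = begin
        odd (cut (Ring.pairs r ++ concatMap Ring.pairs Rs) X)
          ≡⟨ trans (cong odd (cut-++ (Ring.pairs r) _ X)) (odd-+ (cut (Ring.pairs r) X) _) ⟩
        odd (cut (Ring.pairs r) X) xor odd (cut (concatMap Ring.pairs Rs) X)
          ≡⟨ cong₂ _xor_ (Ring.parity r X) (go Rs) ⟩
        odd (cut (map ends (Ring.edges r)) X) xor odd (cut (map ends (concatMap Ring.edges Rs)) X)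
          ≡⟨ trans (cong odd (cut-++ (map ends (Ring.edges r)) _ X)) (odd-+ (cut (map ends (Ring.edges r)) X) _) ⟨
        odd (cut (map ends (Ring.edges r) ++ map ends (concatMap Ring.edges Rs)) X)
          ≡⟨ cong (λ P → odd (cut P X)) (List.map-++ ends (Ring.edges r) _) ⟨
        odd (cut (map ends (Ring.edges r ++ concatMap Ring.edges Rs)) X) ∎
        where open ≡-Reasoning

    B : Pairs (List Bool)
    B = quotient (map ends R) ++ PH.pairs ++ quotient MM

    -- Modulo 2, `MM` counts like the ring edges `FF`, and `PH.pairs` like `FF` and `R` together; so
    -- everything cancels.
    B-even : ∀ Z → odd (cut B Z) ≡ false
    B-even Z = begin
      odd (cut B Z)
        ≡⟨ trans (cong odd (cut-++ (quotient (map ends R)) _ Z)) (odd-+ (cut (quotient (map ends R)) Z) _) ⟩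
      r xor odd (cut (PH.pairs ++ quotient MM) Z)
        ≡⟨ cong (r xor_) (trans (cong odd (cut-++ PH.pairs _ Z)) (odd-+ (cut PH.pairs Z) _)) ⟩
      r xor (odd (cut PH.pairs Z) xor odd (cut (quotient MM) Z))
        ≡⟨ cong (r xor_) (cong₂ _xor_ (PH.parity Z) (trans (cong odd (cut-map class MM Z)) (MM-parity (Z ∘ class)))) ⟩
      r xor (odd (cut EH Z) xor f)
        ≡⟨ cong (λ t → r xor (t xor f)) EH-parity ⟩
      r xor ((f xor r) xor f)
        ≡⟨ vanish r f ⟩
      false ∎
      where
      open ≡-Reasoning
      r = odd (cut (quotient (map ends R)) Z)
      f = odd (cut (map ends FF) (Z ∘ class))
      vanish : ∀ r f → r xor ((f xor r) xor f) ≡ false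
      vanish = from-yes (bool? λ r → bool? λ f → (r xor ((f xor r) xor f)) Bool.≟ false)
      EH-parity : odd (cut EH Z) ≡ f xor r
      EH-parity = trans (cong odd (trans (cut-EH Z) (trans (cong (λ P → cut P (Z ∘ class)) (List.map-++ ends FF R))
          (cut-++ (map ends FF) _ (Z ∘ class)))))
        (trans (odd-+ (cut (map ends FF) (Z ∘ class)) _) (cong (λ n → f xor odd n) (sym (cut-map class (map ends R) Z))))

    B-slack : Slack B []
    B-slack Z with c , eq ← even-gap z≤n (sym (B-even Z)) = c , trans (cong +_ eq) (sym (ℤ.+-identityˡ _))

    Good : (Edge → Bool) → Set (a ⊔ b)
    Good o = All (Linked o) Rs × (∀ {X L} → (X , L) ∈ Xs → Proper X → OutDegree≥ k o X)

    -- `unmap` brings the orientation of the ring pairings back to `G`, so the rings are oriented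
    -- with regard to all vertex sets and not only to unions of classes.
    finite-orientation : ∃ Good
    finite-orientation
      with D , rel , balanced ← orient em₀ B [] B-slack
      with DR , D₁ , refl , relR , rel₁ ← ++-split {P = quotient (map ends R)} rel
      with DH , DM , refl , relH , relM ← ++-split {P = PH.pairs} rel₁
      with DR′ , relR′ , refl ← unmap class {map ends R} relR
      with DM′ , relM′ , refl ← unmap class {MM} relM
      with DF , relF , netF , linked ← orient-rings Rs relM′
      with o , arcs ← realise E₀-unique (subst (λ P → Orients P (DF ++ DR′)) (sym (List.map-++ ends FF R)) (++-orients relF relR′))
      = o , linked o (proj₁ (arcs-cancel relF (trans (sym (List.map-++ (arc o) FF R)) arcs))) , out
      where
      out : ∀ {X L} → (X , L) ∈ Xs → Proper X → OutDegree≥ k o X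
      out {X} XL∈ ((v , Xv) , (w , Xw)) Ds Ds⊇ with Z , Z≡ ← select XL∈ = ℕ.≤-trans
        -- The orientation of `B` is balanced, so `E₀` carries out of `X` what `DH` carries into
        -- `Z`; hence the complement.
        (halve (leaving-bound (map (arc o) E₀) DH {X} {∁ Z} gap flow))
        (ℕ.≤-trans (ℕ.≤-reflexive (leaving-length o E₀ X))
          (unique-⊆ (Unique.filter⁺ (Out? o X) E₀-unique) λ e∈ → Ds⊇ _ (proj₂ (∈-filter⁻ (Out? o X) {xs = E₀} e∈))))
        where
        splits : BP.Splits classes Z
        splits = (class v , class-∈ v , trans (Z≡ v) Xv) , (class w , class-∈ w , trans (Z≡ w) Xw)
        gap : cut DH (∁ Z) + (k + k) ≤ cut (map (arc o) E₀) X
        gap = begin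
          cut DH (∁ Z) + (k + k)         ≡⟨ cong (_+ (k + k)) (trans (cut-∁ DH Z) (cut-orients relH Z)) ⟩
          cut PH.pairs Z + (k + k)       ≤⟨ PH.split Z splits ⟩
          cut EH Z                       ≡⟨ cut-EH Z ⟩
          cut (map ends E₀) (Z ∘ class)  ≡⟨ cut-cong (map ends E₀) Z≡ ⟩
          cut (map ends E₀) X            ≡⟨ cong (λ P → cut P X) (List.map-++ ends FF R) ⟩
          cut (map ends FF ++ map ends R) X ≡⟨ cut-orients (++-orients relF relR′) X ⟨
          cut (DF ++ DR′) X              ≡⟨ cong (λ P → cut P X) arcs ⟨
          cut (map (arc o) E₀) X         ∎
          where open ℕ.≤-Reasoning
        lift-net : ∀ P → net (quotient P) Z ≡ net P X
        lift-net P = trans (net-map class P Z) (net-cong P Z≡)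
        solve₁ : ∀ m r h → m ℤ.+ r ≡ ℤ.- h ℤ.+ (r ℤ.+ (h ℤ.+ m))
        solve₁ = solve-∀
        flow : net (map (arc o) E₀) X ≡ net DH (∁ Z)
        flow = begin
          net (map (arc o) E₀) X       ≡⟨ cong (λ P → net P X) arcs ⟩
          net (DF ++ DR′) X            ≡⟨ trans (net-++ DF DR′ X) (cong (ℤ._+ net DR′ X) (netF X)) ⟩
          net DM′ X ℤ.+ net DR′ X      ≡⟨ solve₁ (net DM′ X) (net DR′ X) (net DH Z) ⟩
          ℤ.- net DH Z ℤ.+ (net DR′ X ℤ.+ (net DH Z ℤ.+ net DM′ X))
            ≡⟨ cong (ℤ._+_ (ℤ.- net DH Z)) (cong₂ (λ r m → r ℤ.+ (net DH Z ℤ.+ m)) (lift-net DR′) (lift-net DM′)) ⟨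
          ℤ.- net DH Z ℤ.+ (net (quotient DR′) Z ℤ.+ (net DH Z ℤ.+ net (quotient DM′) Z))
            ≡⟨ cong (λ t → ℤ.- net DH Z ℤ.+ t) (trans (net-++ (quotient DR′) _ Z)
                 (cong (ℤ._+_ (net (quotient DR′) Z)) (net-++ DH _ Z))) ⟨
          ℤ.- net DH Z ℤ.+ net (quotient DR′ ++ DH ++ quotient DM′) Z
            ≡⟨ cong (ℤ._+_ (ℤ.- net DH Z)) (balanced Z) ⟩
          ℤ.- net DH Z ℤ.+ + 0         ≡⟨ ℤ.+-identityʳ _ ⟩
          ℤ.- net DH Z                 ≡⟨ net-∁ DH Z ⟨
          net DH (∁ Z)                 ∎
          where open ≡-Reasoning

-- Compactness

module Compactness (em : ExcludedMiddle (b ⊔ ℓ)) {E : Set b} {C : Set ℓ}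
    (holds : C → (E → Bool) → Set ℓ) (support : C → List E)
    (local : ∀ c {o o′} → (∀ {e} → e ∈ support c → o e ≡ o′ e) → holds c o → holds c o′)
    (finitely : ∀ cs → ∃ λ o → All (λ c → holds c o) cs)
    (layer : ℕ → List E) (exhausts : ∀ e → ∃ λ n → e ∈ layer n) where

  Agree : List E → (E → Bool) → (E → Bool) → Set b
  Agree D o o′ = ∀ {e} → e ∈ D → o e ≡ o′ e

  -- The invariant of the construction: `o` is final on `D`, and no finite list of constraints rules
  -- this out.
  Extends : List E → (E → Bool) → Set (b ⊔ ℓ)
  Extends D o = ∀ cs → ∃ λ o′ → Agree D o o′ × All (λ c → holds c o′) cs

  counterexample : {P : List C → Set (b ⊔ ℓ)} → ¬ (∀ cs → P cs) → ∃ λ cs → ¬ P cs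
  counterexample {P} ¬all with em {∃ λ cs → ¬ P cs}
  ... | yes ∃cs = ∃cs
  ... | no  none = ⊥-elim (¬all λ cs → case-em cs (em {P cs}))
    where
    case-em : ∀ cs → Dec (P cs) → P cs
    case-em cs (yes p) = p
    case-em cs (no ¬p) = ⊥-elim (none (cs , ¬p))

  -- If both values at `e` were impossible, two lists of constraints would witness this, and their
  -- concatenation would contradict `ext`.
  extend : ∀ {D o} → Extends D o → ∀ e → ∃ λ o₁ → Agree D o o₁ × Extends (e ∷ D) o₁
  extend {D} {o} ext e = choose (em {∃ Possible})
    where
    Possible : Bool → Set (b ⊔ ℓ)
    Possible β = ∀ cs → ∃ λ o′ → Agree D o o′ × o′ e ≡ β × All (λ c → holds c o′) cs
    choose : Dec (∃ Possible) → ∃ λ o₁ → Agree D o o₁ × Extends (e ∷ D) o₁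
    choose (yes (β , possible)) with o₁ , agree₁ , e₁ , _ ← possible [] =
      o₁ , agree₁ , λ cs → let o′ , agree , e≡ , all = possible cs in
        o′ , (λ { (here refl) → trans e₁ (sym e≡) ; (there f∈D) → trans (sym (agree₁ f∈D)) (agree f∈D) }) , all
    choose (no impossible)
      with cs₁ , ¬true ← counterexample (λ p → impossible (true , p))
      with cs₂ , ¬false ← counterexample (λ p → impossible (false , p))
      with o′ , agree , all ← ext (cs₁ ++ cs₂)
      with o′ e in e≡
    ... | true  = contradiction (o′ , (λ {f} → agree {f}) , e≡ , All.++⁻ˡ cs₁ all) ¬true
    ... | false = contradiction (o′ , (λ {f} → agree {f}) , e≡ , All.++⁻ʳ cs₁ all) ¬false

  extend* : ∀ {D o} → Extends D o → ∀ es → ∃ λ o₁ → Agree D o o₁ × Extends (es ++ D) o₁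
  extend* {o = o} ext []       = o , (λ _ → refl) , ext
  extend* ext (e ∷ es)
    with o₁ , agree₁ , ext₁ ← extend* ext es
    with o₂ , agree₂ , ext₂ ← extend ext₁ e = o₂ , (λ e∈D → trans (agree₁ e∈D) (agree₂ (∈-++⁺ʳ es e∈D))) , ext₂

  approximation : ℕ → Σ (List E) λ D → ∃ λ o → Extends D o
  approximation zero with o , _ ← finitely [] = [] , o , λ cs →
    let o′ , all = finitely cs in o′ , (λ ()) , all
  approximation (suc n) with D , o , ext ← approximation n
    with o₁ , _ , ext₁ ← extend* ext (layer n) = layer n ++ D , o₁ , ext₁

  domain : ℕ → List E
  domain n = proj₁ (approximation n)

  partial : ℕ → E → Bool
  partial n = proj₁ (proj₂ (approximation n))

  next : ∀ n → Agree (domain n) (partial n) (partial (suc n))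
  next n with D , o , ext ← approximation n = proj₁ (proj₂ (extend* ext (layer n)))

  domain-suc : ∀ n → domain (suc n) ≡ layer n ++ domain n
  domain-suc n with D , o , ext ← approximation n = refl

  coherent : ∀ {m n} → m ≤′ n → ∀ {e} → e ∈ domain m → e ∈ domain n × partial m e ≡ partial n e
  coherent ≤′-refl e∈ = e∈ , refl
  coherent {m} (≤′-step {n} m≤n) {e} e∈ with e∈n , eq ← coherent m≤n e∈ =
    subst (e ∈_) (sym (domain-suc n)) (∈-++⁺ʳ (layer n) e∈n) , trans eq (next n e∈n)

  -- The successor is due to `layer n` entering the domain only at step `n + 1`.
  stage : E → ℕ
  stage e = suc (proj₁ (exhausts e))

  ∈-stage : ∀ e → e ∈ domain (stage e)
  ∈-stage e = subst (e ∈_) (sym (domain-suc _)) (∈-++⁺ˡ (proj₂ (exhausts e)))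

  limit : E → Bool
  limit e = partial (stage e) e

  limit-agrees : ∀ {n e} → e ∈ domain n → partial n e ≡ limit e
  limit-agrees {n} {e} e∈ with ℕ.≤-total n (stage e)
  ... | inj₁ n≤ = proj₂ (coherent (ℕ.≤⇒≤′ n≤) e∈)
  ... | inj₂ ≤n = sym (proj₂ (coherent (ℕ.≤⇒≤′ ≤n) (∈-stage e)))

  common : ∀ es → ∃ λ n → ∀ {e} → e ∈ es → e ∈ domain n
  common []       = 0 , λ ()
  common (e ∷ es) with n , es⊆ ← common es = stage e ℕ.⊔ n , λ where
    (here refl) → proj₁ (coherent (ℕ.≤⇒≤′ (ℕ.m≤m⊔n (stage e) n)) (∈-stage e))
    (there f∈)  → proj₁ (coherent (ℕ.≤⇒≤′ (ℕ.m≤n⊔m (stage e) n)) (es⊆ f∈))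

  -- On the finite support of a constraint the limit agrees with a single approximation, which can
  -- still be completed so as to satisfy that constraint.
  compactness : ∃ λ o → ∀ c → holds c o
  compactness = limit , satisfied
    where
    satisfied : ∀ c → holds c limit
    satisfied c with n , ⊆domain ← common (support c)
      with o′ , agree , (h ∷ []) ← proj₂ (proj₂ (approximation n)) (c ∷ []) =
      local c (λ e∈ → trans (sym (agree (⊆domain e∈))) (limit-agrees {n} (⊆domain e∈))) h

-- Menger's theorem

net+entering≡leaving : {V : Set ℓ} (Q : Pairs V) (X : Cut V) → net Q X ℤ.+ + leaving Q (∁ X) ≡ + leaving Q X
net+entering≡leaving []            X = refl
net+entering≡leaving ((p , q) ∷ Q) X = trans (pointwise (X p) (X q))
  (cong (ℤ._+_ (+ (if X p ∧ not (X q) then 1 else 0))) (net+entering≡leaving Q X))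
  where
  n = net Q X
  l = + leaving Q (∁ X)
  up : ∀ n l → (+ 1 ℤ.+ n) ℤ.+ l ≡ + 1 ℤ.+ (n ℤ.+ l)
  up = solve-∀
  level : ∀ n l → (+ 0 ℤ.+ n) ℤ.+ l ≡ + 0 ℤ.+ (n ℤ.+ l)
  level = solve-∀
  down : ∀ n l → (ℤ.- + 1 ℤ.+ n) ℤ.+ (+ 1 ℤ.+ l) ≡ + 0 ℤ.+ (n ℤ.+ l)
  down = solve-∀
  pointwise : ∀ x y → ((indicator x ℤ.- indicator y) ℤ.+ n) ℤ.+
    (+ (if not x ∧ not (not y) then 1 else 0) ℤ.+ l) ≡ + (if x ∧ not y then 1 else 0) ℤ.+ (n ℤ.+ l)
  pointwise true  true  = level n l
  pointwise true  false = up n l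
  pointwise false true  = down n l
  pointwise false false = level n l

net-↭ : {V : Set ℓ} {P Q : Pairs V} → P ↭ Q → ∀ X → net P X ≡ net Q X
net-↭ Perm.refl               X = refl
net-↭ (Perm.prep (p , q) P↭Q) X = cong (ℤ._+_ (indicator (X p) ℤ.- indicator (X q))) (net-↭ P↭Q X)
net-↭ {Q = _ ∷ _ ∷ Q} (Perm.swap (p , q) (r , s) P↭Q) X =
  trans (cong (λ n → w p q ℤ.+ (w r s ℤ.+ n)) (net-↭ P↭Q X)) (exchange (w p q) (w r s) (net Q X))
  where
  w : _ → _ → ℤ
  w x y = indicator (X x) ℤ.- indicator (X y)
  exchange : ∀ a b c → a ℤ.+ (b ℤ.+ c) ≡ b ℤ.+ (a ℤ.+ c)
  exchange = solve-∀
net-↭ (Perm.trans P↭Q Q↭R)    X = trans (net-↭ P↭Q X) (net-↭ Q↭R X)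

Unique-↭ : {A : Set ℓ} {xs ys : List A} → xs ↭ ys → Unique xs → Unique ys
Unique-↭ {A = A} xs↭ys = PermutationSetoid.Unique-resp-↭ (setoid A) (↭⇒↭ₛ xs↭ys)

module WalkProperties (em : ExcludedMiddle a) {V : Set a} {E : Set b} (Step : E → V → V → Set a) where
  open Paths Step

  snoc : ∀ {u v w} → Walk u v → ∀ e → Step e v w → Walk u w
  snoc nil           e s  = cons e s nil
  snoc (cons f t p)  e s  = cons f t (snoc p e s)

  step-at : ∀ {u v} (p : Walk u v) {e} → e ∈ walkEdges p →
    ∃ λ x → ∃ λ y → Step e x y × x ∈ walkVertices p × y ∈ walkVertices p
  step-at (cons e s p) (here refl) = _ , _ , s , here refl , there (start p)
    where
    start : ∀ {u v} (p : Walk u v) → u ∈ walkVertices p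
    start nil          = here refl
    start (cons _ _ _) = here refl
  step-at (cons e s p) (there f∈) with x , y , s , x∈ , y∈ ← step-at p f∈ = x , y , s , there x∈ , there y∈

  ShorterPath : ∀ {u v} → Walk u v → Set (a ⊔ b)
  ShorterPath {u} {v} p = ∃ λ (q : Path u v) → ∀ {e} → e ∈ Path.edges q → e ∈ walkEdges p

  suffix : ∀ {u v w} (p : Walk u v) → Unique (walkVertices p) → w ∈ walkVertices p →
    ∃ λ (q : Path w v) → ∀ {e} → e ∈ Path.edges q → e ∈ walkEdges p
  suffix nil          uniq       (here refl) = record { walk = nil ; distinct = uniq } , λ e∈ → e∈
  suffix (cons e s p) uniq       (here refl) = record { walk = cons e s p ; distinct = uniq } , λ e∈ → e∈
  suffix (cons e s p) (_ ∷ uniq) (there w∈) with q , q⊆p ← suffix p uniq w∈ = q , there ∘ q⊆p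

  shorten : ∀ {u v} (p : Walk u v) → ShorterPath p
  shorten nil = record { walk = nil ; distinct = [] ∷ [] } , λ e∈ → e∈
  shorten (cons {u} e s p) with q , q⊆p ← shorten p with em {u ∈ Path.vertices q}
  ... | yes u∈ with r , r⊆q ← suffix (Path.walk q) (Path.distinct q) u∈ = r , there ∘ q⊆p ∘ r⊆q
  ... | no  u∉ = record { walk = cons e s (Path.walk q) ; distinct = All.¬Any⇒All¬ _ u∉ ∷ Path.distinct q } ,
                 λ { (here e≡) → here e≡ ; (there e∈) → there (q⊆p e∈) }

module Menger (em : ExcludedMiddle (a ⊔ b)) (D : Digraph a b) where
  open Digraph D

  private
    em-vertex : ExcludedMiddle a
    em-vertex = lower-em a {b} em
    em-edge : ExcludedMiddle b
    em-edge = lower-em b {a} em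

  ends : Arc → Vertex × Vertex
  ends e = tail e , head e

  Leaves : Cut Vertex → Arc → Set
  Leaves X e = X (tail e) ≡ true × X (head e) ≡ false

  leaves? : ∀ X e → Dec (Leaves X e)
  leaves? X e = (X (tail e) Bool.≟ true) ×-dec (X (head e) Bool.≟ false)

  leaving≡ : ∀ Φ X → leaving (map ends Φ) X ≡ length (filter (leaves? X) Φ)
  leaving≡ []      X = refl
  leaving≡ (e ∷ Φ) X with X (tail e) | X (head e)
  ... | true  | false = cong suc (leaving≡ Φ X)
  ... | true  | true  = leaving≡ Φ X
  ... | false | true  = leaving≡ Φ X
  ... | false | false = leaving≡ Φ X

  leaving≡0 : ∀ Φ X → (∀ {e} → e ∈ Φ → ¬ Leaves X e) → leaving (map ends Φ) X ≡ 0
  leaving≡0 []      X none = refl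
  leaving≡0 (e ∷ Φ) X none with X (tail e) | X (head e) | none (here refl)
  ... | true  | false | ¬out = contradiction (refl , refl) ¬out
  ... | true  | true  | _ = leaving≡0 Φ X (none ∘ there)
  ... | false | _     | _ = leaving≡0 Φ X (none ∘ there)

  unit : Vertex → Vertex → Cut Vertex → ℤ
  unit u v X = indicator (X u) ℤ.- indicator (X v)

  used : List Arc → Arc → Bool
  used Φ e = does (em-edge {e ∈ Φ})

  used⁺ : ∀ {Φ e} → e ∈ Φ → used Φ e ≡ true
  used⁺ {Φ} {e} = dec-true (em-edge {e ∈ Φ})

  unused⁺ : ∀ {Φ e} → e ∉ Φ → used Φ e ≡ false
  unused⁺ {Φ} {e} = dec-false (em-edge {e ∈ Φ})

  used⁻ : ∀ {Φ e} → used Φ e ≡ true → e ∈ Φ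
  used⁻ {Φ} {e} = does-true (em-edge {e ∈ Φ})

  unused⁻ : ∀ {Φ e} → used Φ e ≡ false → e ∉ Φ
  unused⁻ eq e∈ = false≢true (trans (sym eq) (used⁺ e∈))

  Residual : List Arc → Arc → Vertex → Vertex → Set a
  Residual Φ e x y = (used Φ e ≡ false × tail e ≡ x × head e ≡ y) ⊎ (used Φ e ≡ true × head e ≡ x × tail e ≡ y)

  Used : List Arc → Arc → Vertex → Vertex → Set a
  Used Φ e x y = used Φ e ≡ true × Leads e x y

  residual-start : ∀ {Φ e x y x′ y′} → Residual Φ e x y → Residual Φ e x′ y′ → x ≡ x′
  residual-start (inj₁ (_ , refl , _))  (inj₁ (_ , refl , _))  = refl
  residual-start (inj₂ (_ , refl , _))  (inj₂ (_ , refl , _))  = refl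
  residual-start (inj₁ (e∉ , _))        (inj₂ (e∈ , _))        = contradiction (trans (sym e∉) e∈) false≢true
  residual-start (inj₂ (e∈ , _))        (inj₁ (e∉ , _))        = contradiction (trans (sym e∉) e∈) false≢true

  open Paths using (nil; cons)
  module Walks (Step : Arc → Vertex → Vertex → Set a) = WalkProperties em-vertex Step

  record Insertion (Ψ : List Arc) (x y : Vertex) : Set (a ⊔ b) where
    field
      arcs   : List Arc
      unique : Unique arcs
      flow   : ∀ X → net (map ends arcs) X ≡ net (map ends Ψ) X ℤ.+ unit x y X

  -- `Φ` stays fixed because the residual steps refer to it, while `Ψ` changes arc by arc. The two
  -- agree on the rest of the path: a residual arc determines the vertex where it starts, so on a
  -- path it cannot recur.
  push : ∀ {Φ Ψ x y} (p : Paths.Walk (Residual Φ) x y) → Unique (Paths.walkVertices (Residual Φ) p) → Unique Ψ →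
    (∀ {e} → e ∈ Paths.walkEdges (Residual Φ) p → (e ∈ Φ → e ∈ Ψ) × (e ∈ Ψ → e ∈ Φ)) → Insertion Ψ x y
  push {Ψ = Ψ} nil _ uniq _ = record { arcs = Ψ ; unique = uniq ; flow = λ X → stay (net (map ends Ψ) X) (indicator (X _)) }
    where
    stay : ∀ n x → n ≡ n ℤ.+ (x ℤ.- x)
    stay = solve-∀
  push {Φ} {Ψ} {x} {y} (cons {v = x′} e s p) (x∉ ∷ distinct) uniq same = toggle s (same (here refl))
    where
    later : ∀ {f} → f ∈ Paths.walkEdges (Residual Φ) p → f ≢ e
    later f∈ refl with _ , _ , s′ , x′∈ , _ ← Walks.step-at (Residual Φ) p f∈ =
      All.lookup x∉ x′∈ (residual-start {Φ} s s′)
    toggle : Residual Φ e x x′ → (e ∈ Φ → e ∈ Ψ) × (e ∈ Ψ → e ∈ Φ) → Insertion Ψ x y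
    toggle (inj₁ (e∉Φ , refl , refl)) (_ , Ψ→Φ) = record
      { arcs = I.arcs ; unique = I.unique
      ; flow = λ X → trans (I.flow X) (add (indicator (X (tail e))) (indicator (X (head e))) (net (map ends Ψ) X) (indicator (X y))) }
      where
      same′ : ∀ {f} → f ∈ Paths.walkEdges (Residual Φ) p → (f ∈ Φ → f ∈ e ∷ Ψ) × (f ∈ e ∷ Ψ → f ∈ Φ)
      same′ f∈ = there ∘ proj₁ (same (there f∈)) ,
        λ { (here f≡e) → contradiction f≡e (later f∈) ; (there f∈Ψ) → proj₂ (same (there f∈)) f∈Ψ }
      module I = Insertion (push {Φ} {e ∷ Ψ} p distinct (All.¬Any⇒All¬ Ψ (unused⁻ e∉Φ ∘ Ψ→Φ) ∷ uniq) same′)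
      add : ∀ x x′ n y → ((x ℤ.- x′) ℤ.+ n) ℤ.+ (x′ ℤ.- y) ≡ n ℤ.+ (x ℤ.- y)
      add = solve-∀
    toggle (inj₂ (e∈Φ , refl , refl)) (Φ→Ψ , _) with Ψ′ , Ψ↭ ← extract (Φ→Ψ (used⁻ e∈Φ)) with (e∉Ψ′ ∷ uniq′) ← Unique-↭ Ψ↭ uniq = record
      { arcs = I.arcs ; unique = I.unique
      ; flow = λ X → trans (I.flow X) (trans
          (remove (indicator (X (tail e))) (indicator (X (head e))) (net (map ends Ψ′) X) (indicator (X y)))
          (cong (ℤ._+ unit (head e) y X) (sym (net-↭ (Permutation.map⁺ ends Ψ↭) X)))) }
      where
      same′ : ∀ {f} → f ∈ Paths.walkEdges (Residual Φ) p → (f ∈ Φ → f ∈ Ψ′) × (f ∈ Ψ′ → f ∈ Φ)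
      same′ {f} f∈ = (λ f∈Φ → strip (∈-resp-↭ Ψ↭ (proj₁ (same (there f∈)) f∈Φ))) ,
        λ f∈Ψ′ → proj₂ (same (there f∈)) (∈-resp-↭ (Perm.↭-sym Ψ↭) (there f∈Ψ′))
        where
        strip : f ∈ e ∷ Ψ′ → f ∈ Ψ′
        strip (here f≡e)  = contradiction f≡e (later f∈)
        strip (there f∈′) = f∈′
      module I = Insertion (push {Φ} {Ψ′} p distinct uniq′ same′)
      remove : ∀ x′ x n y → n ℤ.+ (x′ ℤ.- y) ≡ ((x′ ℤ.- x) ℤ.+ n) ℤ.+ (x ℤ.- y)
      remove = solve-∀

  module _ {u v : Vertex} where

    record Flow (r : ℕ) : Set (a ⊔ b) where
      field
        arcs   : List Arc
        unique : Unique arcs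
        flow   : ∀ X → net (map ends arcs) X ≡ + r ℤ.* unit u v X

    no-flow : Flow 0
    no-flow = record { arcs = [] ; unique = [] ; flow = λ X → refl }

    -- If `v` is unreachable, all arcs leaving the reachable set belong to the flow and no arc of
    -- the flow enters it. So exactly `r` arcs leave, and they form a finite list even if the
    -- digraph is infinite.
    augment : ∀ {k r} → (∀ X → X u ≡ true → X v ≡ false → ∀ Ds → (∀ e → Leaves X e → e ∈ Ds) → k ≤ length Ds) →
      r < k → Flow r → Flow (suc r)
    augment {k} {r} robust r<k F = choose (em {Paths.Walk (Residual Φ) u v})
      where
      open Flow F renaming (arcs to Φ)
      choose : Dec (Paths.Walk (Residual Φ) u v) → Flow (suc r)
      choose (yes p) with q , _ ← Walks.shorten (Residual Φ) p = record
        { arcs   = I.arcs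
        ; unique = I.unique
        ; flow   = λ X → trans (I.flow X) (trans (cong (ℤ._+ unit u v X) (flow X)) (sym (trans
            (ℤ.*-distribʳ-+ (unit u v X) (+ 1) (+ r)) (one-more (+ r) (unit u v X))))) }
        where
        module I = Insertion (push {Φ} {Φ} (Paths.Path.walk q) (Paths.Path.distinct q) unique (λ _ → (λ e∈ → e∈) , (λ e∈ → e∈)))
        one-more : ∀ r t → + 1 ℤ.* t ℤ.+ r ℤ.* t ≡ r ℤ.* t ℤ.+ t
        one-more = solve-∀
      choose (no unreachable) = contradiction (robust X u∈X v∉X (filter (leaves? X) Φ) covered) (ℕ.<⇒≱ (begin-strict
        length (filter (leaves? X) Φ) ≡⟨ leaving≡ Φ X ⟨
        leaving (map ends Φ) X        ≡⟨ ℤ.+-injective value ⟩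
        r                             <⟨ r<k ⟩
        k                             ∎))
        where
        open ℕ.≤-Reasoning
        X : Cut Vertex
        X w = does (em {Paths.Walk (Residual Φ) u w})
        ∈X : ∀ {w} → Paths.Walk (Residual Φ) u w → X w ≡ true
        ∈X {w} = dec-true (em {Paths.Walk (Residual Φ) u w})
        X⁻ : ∀ {w} → X w ≡ true → Paths.Walk (Residual Φ) u w
        X⁻ {w} = does-true (em {Paths.Walk (Residual Φ) u w})
        u∈X : X u ≡ true
        u∈X = ∈X nil
        v∉X : X v ≡ false
        v∉X = dec-false (em {Paths.Walk (Residual Φ) u v}) unreachable
        covered : ∀ e → Leaves X e → e ∈ filter (leaves? X) Φ
        covered e (t∈ , h∉) with em-edge {e ∈ Φ}
        ... | yes e∈Φ = ∈-filter⁺ (leaves? X) e∈Φ (t∈ , h∉)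
        ... | no  e∉Φ = contradiction (trans (sym h∉)
                (∈X (Walks.snoc (Residual Φ) (X⁻ t∈) e (inj₁ (unused⁺ e∉Φ , refl , refl))))) false≢true
        entering≡0 : leaving (map ends Φ) (∁ X) ≡ 0
        entering≡0 = leaving≡0 Φ (∁ X) λ {e} e∈Φ (t∉ , h∈) → false≢true (trans (sym (Bool.not-injective t∉))
          (∈X (Walks.snoc (Residual Φ) (X⁻ (Bool.not-injective h∈)) e (inj₂ (used⁺ e∈Φ , refl , refl)))))
        value : + leaving (map ends Φ) X ≡ + r
        value = trans (sym (net+entering≡leaving (map ends Φ) X)) (trans (cong₂ (λ n e → n ℤ.+ + e) (flow X) entering≡0)
          (trans (ℤ.+-identityʳ _) (trans (cong₂ (λ x y → + r ℤ.* (indicator x ℤ.- indicator y)) u∈X v∉X) (ℤ.*-identityʳ (+ r)))))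

    max-flow : ∀ {k} → (∀ X → X u ≡ true → X v ≡ false → ∀ Ds → (∀ e → Leaves X e → e ∈ Ds) → k ≤ length Ds) → Flow k
    max-flow {k} robust = go k ℕ.≤-refl
      where
      go : ∀ r → r ≤ k → Flow r
      go zero    _   = no-flow
      go (suc r) r<k = augment robust r<k (go r (ℕ.<⇒≤ r<k))

  -- Decomposing a flow into arc-disjoint paths

  record Deletion (Φ Es : List Arc) (x y : Vertex) : Set (a ⊔ b) where
    field
      arcs     : List Arc
      unique   : Unique arcs
      ⊆Φ       : ∀ {e} → e ∈ arcs → e ∈ Φ
      disjoint : Disjoint Es arcs
      flow     : ∀ X → net (map ends Φ) X ≡ unit x y X ℤ.+ net (map ends arcs) X

  delete : ∀ {Φ x y} (p : Paths.Walk Leads x y) → Unique (Paths.walkVertices Leads p) → Unique Φ →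
    (∀ {e} → e ∈ Paths.walkEdges Leads p → e ∈ Φ) → Deletion Φ (Paths.walkEdges Leads p) x y
  delete {Φ} nil _ uniq _ = record { arcs = Φ ; unique = uniq ; ⊆Φ = λ e∈ → e∈ ; disjoint = λ ()
    ; flow = λ X → stay (net (map ends Φ) X) (indicator (X _)) }
    where
    stay : ∀ n x → n ≡ (x ℤ.- x) ℤ.+ n
    stay = solve-∀
  delete {Φ} {y = y} (cons e (refl , refl) p) (x∉ ∷ distinct) uniq ⊆Φ with Φ′ , Φ↭ ← extract (⊆Φ (here refl))
    with (e∉Φ′ ∷ uniq′) ← Unique-↭ Φ↭ uniq = record
    { arcs     = D.arcs
    ; unique   = D.unique
    ; ⊆Φ       = λ f∈ → ∈-resp-↭ (Perm.↭-sym Φ↭) (there (D.⊆Φ f∈))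
    ; disjoint = λ { (here refl , f∈) → All.lookup e∉Φ′ (D.⊆Φ f∈) refl ; (there f∈p , f∈) → D.disjoint (f∈p , f∈) }
    ; flow     = λ X → trans (net-↭ (Permutation.map⁺ ends Φ↭) X) (trans (cong (ℤ._+_ (unit (tail e) (head e) X)) (D.flow X))
        (add (indicator (X (tail e))) (indicator (X (head e))) (indicator (X y)) (net (map ends D.arcs) X)))
    }
    where
    add : ∀ x x′ y n → (x ℤ.- x′) ℤ.+ ((x′ ℤ.- y) ℤ.+ n) ≡ (x ℤ.- y) ℤ.+ n
    add = solve-∀
    later : ∀ {f} → f ∈ Paths.walkEdges Leads p → f ≢ e
    later f∈ refl with _ , _ , (refl , _) , x′∈ , _ ← Walks.step-at Leads p f∈ = All.lookup x∉ x′∈ refl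
    ⊆Φ′ : ∀ {f} → f ∈ Paths.walkEdges Leads p → f ∈ Φ′
    ⊆Φ′ f∈ with ∈-resp-↭ Φ↭ (⊆Φ (there f∈))
    ... | here f≡e   = contradiction f≡e (later f∈)
    ... | there f∈Φ′ = f∈Φ′
    module D = Deletion (delete {Φ′} p distinct uniq′ ⊆Φ′)

  module _ {u v : Vertex} (u≢v : u ≢ v) where

    forget : ∀ {Φ x y} (p : Paths.Walk (Used Φ) x y) → ∃ λ (q : Paths.Walk Leads x y) →
      ∀ {e} → e ∈ Paths.walkEdges Leads q → e ∈ Φ
    forget nil = nil , λ ()
    forget (cons e (e∈ , s) p) with q , q⊆ ← forget p = cons e s q , λ { (here refl) → used⁻ e∈ ; (there f∈) → q⊆ f∈ }

    -- Otherwise no arc of the flow would leave the set reachable from `u`, although the net flow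
    -- out of it is positive.
    flow-path : ∀ {r} (F : Flow {u} {v} (suc r)) → ∃ λ (q : Paths.Walk Leads u v) → ∀ {e} → e ∈ Paths.walkEdges Leads q → e ∈ Flow.arcs F
    flow-path {r} F = choose (em {Paths.Walk (Used Φ) u v})
      where
      open Flow F renaming (arcs to Φ)
      choose : Dec (Paths.Walk (Used Φ) u v) → ∃ λ (q : Paths.Walk Leads u v) → ∀ {e} → e ∈ Paths.walkEdges Leads q → e ∈ Φ
      choose (yes p) = forget p
      choose (no unreachable) = ⊥-elim (impossible (sym value))
        where
        X : Cut Vertex
        X w = does (em {Paths.Walk (Used Φ) u w})
        ∈X : ∀ {w} → Paths.Walk (Used Φ) u w → X w ≡ true
        ∈X {w} = dec-true (em {Paths.Walk (Used Φ) u w})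
        X⁻ : ∀ {w} → X w ≡ true → Paths.Walk (Used Φ) u w
        X⁻ {w} = does-true (em {Paths.Walk (Used Φ) u w})
        v∉X : X v ≡ false
        v∉X = dec-false (em {Paths.Walk (Used Φ) u v}) unreachable
        leaving0 : leaving (map ends Φ) X ≡ 0
        leaving0 = leaving≡0 Φ X λ {e} e∈Φ (t∈ , h∉) → false≢true (trans (sym h∉)
          (∈X (Walks.snoc (Used Φ) (X⁻ t∈) e (used⁺ e∈Φ , refl , refl))))
        value : + suc (r + leaving (map ends Φ) (∁ X)) ≡ + 0
        value = trans (cong (ℤ._+ + leaving (map ends Φ) (∁ X)) (sym (trans (flow X)
            (trans (cong₂ (λ x y → + suc r ℤ.* (indicator x ℤ.- indicator y)) (∈X nil) v∉X) (ℤ.*-identityʳ (+ suc r))))))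
          (trans (net+entering≡leaving (map ends Φ) X) (cong +_ leaving0))
        impossible : ∀ {n} → + 0 ≢ + suc n
        impossible ()

    DisjointPaths : ℕ → List Arc → Set (a ⊔ b)
    DisjointPaths r Φ = ∃ λ (P : Fin r → Paths.Path Leads u v) → (∀ i {e} → e ∈ Paths.Path.edges (P i) → e ∈ Φ) ×
      (∀ i j → i ≢ j → Disjoint (Paths.Path.edges (P i)) (Paths.Path.edges (P j)))

    flow-paths : ∀ {r} (F : Flow {u} {v} r) → DisjointPaths r (Flow.arcs F)
    flow-paths {zero}  F = (λ ()) , (λ ()) , λ ()
    flow-paths {suc r} F with p , p⊆ ← flow-path F with q , q⊆p ← Walks.shorten Leads p =
      combine (flow-paths {r} record
        { arcs   = D.arcs
        ; unique = D.unique
        ; flow   = λ X → peel (+ r) (unit u v X) _ _ (sym (Flow.flow F X)) (D.flow X) })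
      where
      module D = Deletion (delete {Flow.arcs F} (Paths.Path.walk q) (Paths.Path.distinct q) (Flow.unique F) (λ e∈ → p⊆ (q⊆p e∈)))
      peel : ∀ r t m n → (+ 1 ℤ.+ r) ℤ.* t ≡ m → m ≡ t ℤ.+ n → n ≡ r ℤ.* t
      peel r t m n eq₁ eq₂ = trans (recover t n) (trans (cong (ℤ._+_ (ℤ.- t)) (trans (sym eq₂) (sym eq₁))) (collapse r t))
        where
        recover : ∀ t n → n ≡ ℤ.- t ℤ.+ (t ℤ.+ n)
        recover = solve-∀
        collapse : ∀ r t → ℤ.- t ℤ.+ (+ 1 ℤ.+ r) ℤ.* t ≡ r ℤ.* t
        collapse = solve-∀
      combine : DisjointPaths r D.arcs → DisjointPaths (suc r) (Flow.arcs F)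
      combine (P , P⊆ , P-disjoint) =
        (λ { zero → q ; (suc i) → P i }) ,
        (λ { zero e∈ → p⊆ (q⊆p e∈) ; (suc i) e∈ → D.⊆Φ (P⊆ i e∈) }) ,
        λ { zero    zero    i≢j → contradiction refl i≢j
          ; zero    (suc j) _ (e∈q , e∈P) → D.disjoint (e∈q , P⊆ j e∈P)
          ; (suc i) zero    _ (e∈P , e∈q) → D.disjoint (e∈q , P⊆ i e∈P)
          ; (suc i) (suc j) i≢j → P-disjoint i j (i≢j ∘ cong suc) }

    menger : ∀ k → (∀ X → X u ≡ true → X v ≡ false → ∀ Ds → (∀ e → Leaves X e → e ∈ Ds) → k ≤ length Ds) →
      ∃ λ (P : Fin k → Paths.Path Leads u v) → ∀ i j → i ≢ j → Disjoint (Paths.Path.edges (P i)) (Paths.Path.edges (P j))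
    menger k robust with P , _ , disjoint ← flow-paths (max-flow robust) = P , disjoint

-- Balls and rings

gather : (xs : List A) (P : A → ℕ → Set ℓ) → (∀ {x m n} → m ≤ n → P x m → P x n) →
  (∀ {x} → x ∈ xs → ∃ (P x)) → ∃ λ n → ∀ {x} → x ∈ xs → P x n
gather []       P mono each = 0 , λ ()
gather (x ∷ xs) P mono each with m , px ← each (here refl) with n , pxs ← gather xs P mono (each ∘ there) =
  m ℕ.⊔ n , λ { (here refl) → mono (ℕ.m≤m⊔n m n) px ; (there x∈) → mono (ℕ.m≤n⊔m m n) (pxs x∈) }

eventually-avoids : ExcludedMiddle ℓ → {A : Set ℓ} (M : ℕ → A → Set ℓ) → (∀ {x i j} → M i x → M j x → i ≡ j) →
  ∀ xs → ∃ λ N → ∀ {i} → N ≤ i → ∀ {x} → x ∈ xs → ¬ M i x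
eventually-avoids em M once []       = 0 , λ _ ()
eventually-avoids em M once (x ∷ xs) with N , avoids ← eventually-avoids em M once xs with em {∃ λ i → M i x}
... | no  never   = N , λ { N≤i (here refl) Mx → never (_ , Mx) ; N≤i (there x∈) → avoids N≤i x∈ }
... | yes (j , Mj) = suc j ℕ.⊔ N , λ
  { ≤i (here refl) Mx → ℕ.<-irrefl (once Mj Mx) (ℕ.≤-trans (ℕ.m≤m⊔n (suc j) N) ≤i)
  ; ≤i (there x∈)     → avoids (ℕ.≤-trans (ℕ.m≤n⊔m (suc j) N) ≤i) x∈ }

module Geometry (em : ExcludedMiddle (a ⊔ b)) (G : Graph a b) (locally-finite : LocallyFinite G) where
  open Graph G
  open FiniteOrientation em G public
  open Paths Joins using (Walk; nil; cons; walkVertices; Path)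

  incident : Vertex → List Edge
  incident v = filter (λ e → em-vertex {Incident e v}) (proj₁ (locally-finite v))

  ∈-incident : ∀ {e v} → Incident e v → e ∈ incident v
  ∈-incident {e} {v} i = ∈-filter⁺ (λ e → em-vertex {Incident e v}) (proj₂ (locally-finite v) e i) i

  incident⁻ : ∀ {e v} → e ∈ incident v → Incident e v
  incident⁻ {e} {v} e∈ = proj₂ (∈-filter⁻ (λ e → em-vertex {Incident e v}) {xs = proj₁ (locally-finite v)} e∈)

  Joins-sym : ∀ {e u v} → Joins e u v → Joins e v u
  Joins-sym (inj₁ (p , q)) = inj₂ (p , q)
  Joins-sym (inj₂ (p , q)) = inj₁ (p , q)

  Joins-ends : ∀ e → Joins e (end₁ e) (end₂ e)
  Joins-ends e = inj₁ (refl , refl)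

  Joins-incident : ∀ {e u v} → Joins e u v → Incident e u
  Joins-incident (inj₁ (p , _)) = inj₁ p
  Joins-incident (inj₂ (_ , q)) = inj₂ q

  neighbours : Vertex → List Vertex
  neighbours v = concatMap (λ e → end₁ e ∷ end₂ e ∷ []) (incident v)

  ∈-neighbours : ∀ {e u v} → Joins e u v → v ∈ neighbours u
  ∈-neighbours {e} {u} {v} j = ∈-concatMap⁺ (λ e → end₁ e ∷ end₂ e ∷ []) (lose (∈-incident (Joins-incident j)) (other j))
    where
    other : Joins e u v → v ∈ end₁ e ∷ end₂ e ∷ []
    other (inj₁ (_ , q)) = there (here (sym q))
    other (inj₂ (p , _)) = here (sym p)

  neighbours⁻ : ∀ {u v} → v ∈ neighbours u → v ≢ u → ∃ λ e → Joins e u v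
  neighbours⁻ {u} {v} v∈ v≢u with e , e∈ , v∈e ← find (∈-concatMap⁻ (λ e → end₁ e ∷ end₂ e ∷ []) {xs = incident u} v∈) =
    e , join (incident⁻ e∈) v∈e
    where
    join : Incident e u → v ∈ end₁ e ∷ end₂ e ∷ [] → Joins e u v
    join (inj₁ p) (here refl)         = contradiction p v≢u
    join (inj₁ p) (there (here refl)) = inj₁ (p , refl)
    join (inj₂ q) (here refl)         = inj₂ (refl , q)
    join (inj₂ q) (there (here refl)) = contradiction q v≢u

  -- Walks in `G` minus an edge, a list of edges or a ball are all links for a suitable `Q`, so that
  -- they can be concatenated without forming subgraphs.
  data Link (Q : Edge → Set ℓ) : Vertex → Vertex → Set (a ⊔ b ⊔ ℓ) where
    nil  : ∀ {v} → Link Q v v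
    cons : ∀ {u v w} (e : Edge) → Q e → Joins e u v → Link Q v w → Link Q u w

  link-edges : ∀ {Q : Edge → Set ℓ} {u v} → Link Q u v → List Edge
  link-edges nil            = []
  link-edges (cons e _ _ l) = e ∷ link-edges l

  infixr 5 _⁀_
  _⁀_ : ∀ {Q : Edge → Set ℓ} {u v w} → Link Q u v → Link Q v w → Link Q u w
  nil          ⁀ m = m
  cons e q j l ⁀ m = cons e q j (l ⁀ m)

  link-sym : ∀ {Q : Edge → Set ℓ} {u v} → Link Q u v → Link Q v u
  link-sym nil            = nil
  link-sym (cons e q j l) = link-sym l ⁀ cons e q (Joins-sym j) nil

  link-map : ∀ {Q : Edge → Set ℓ} {R : Edge → Set ℓ′} → (∀ {e} → Q e → R e) → ∀ {u v} → Link Q u v → Link R u v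
  link-map f nil            = nil
  link-map f (cons e q j l) = cons e (f q) j (link-map f l)

  link-crosses : ∀ {Q : Edge → Set ℓ} {u v} (l : Link Q u v) (X : Cut Vertex) → X u ≢ X v →
    ∃ λ e → e ∈ link-edges l × Q e × X (end₁ e) ≢ X (end₂ e)
  link-crosses nil X Xu≢Xv = contradiction refl Xu≢Xv
  link-crosses {u = u} (cons {v = v} e q j l) X Xu≢Xv with X u Bool.≟ X v
  ... | no  u≢v = e , here refl , q , separated j
    where
    separated : Joins e u v → X (end₁ e) ≢ X (end₂ e)
    separated (inj₁ (refl , refl)) = u≢v
    separated (inj₂ (refl , refl)) = u≢v ∘ sym
  ... | yes u≡v with f , f∈ , qf , sep ← link-crosses l X (Xu≢Xv ∘ trans u≡v) = f , there f∈ , qf , sep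

  deleted-link : ∀ {F u v} → Paths.Walk (Graph.Joins (deleteEdges G F)) u v → Link (_∉ F) u v
  deleted-link Paths.nil                   = nil
  deleted-link (Paths.cons (e , e∉F) j p) = cons e e∉F j (deleted-link p)

  module Balls (root : Vertex) where

    ball : ℕ → List Vertex
    ball zero    = root ∷ []
    ball (suc n) = ball n ++ concatMap neighbours (ball n)

    infix 4 _∈ᵇ_ _∉ᵇ_

    -- A record, so that the radius can be inferred.
    record _∈ᵇ_ (v : Vertex) (n : ℕ) : Set a where
      constructor within
      field listed : v ∈ ball n

    open _∈ᵇ_ public

    _∉ᵇ_ : Vertex → ℕ → Set a
    v ∉ᵇ n = ¬ (v ∈ᵇ n)

    ball-mono : ∀ {m n} → m ≤ n → ∀ {v} → v ∈ᵇ m → v ∈ᵇ n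
    ball-mono m≤n = go (ℕ.≤⇒≤′ m≤n)
      where
      go : ∀ {m n} → m ≤′ n → ∀ {v} → v ∈ᵇ m → v ∈ᵇ n
      go ≤′-refl       v∈ = v∈
      go (≤′-step m≤n) v∈ = within (∈-++⁺ˡ (listed (go m≤n v∈)))

    ball-step : ∀ {n e u v} → Joins e u v → u ∈ᵇ n → v ∈ᵇ suc n
    ball-step {n} j u∈ = within (∈-++⁺ʳ (ball n) (∈-concatMap⁺ neighbours (lose (listed u∈) (∈-neighbours j))))

    in-ball : ∀ {Q : Edge → Set ℓ} {v} → Link Q root v → ∃ λ n → v ∈ᵇ n
    in-ball l = go {n = 0} (within (here refl)) l
      where
      go : ∀ {Q : Edge → Set ℓ} {n u v} → u ∈ᵇ n → Link Q u v → ∃ λ n → v ∈ᵇ n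
      go u∈ nil            = _ , u∈
      go u∈ (cons e _ j l) = go (ball-step j u∈) l

    Outside Inside : ℕ → Edge → Set a
    Outside s e = end₁ e ∉ᵇ s × end₂ e ∉ᵇ s
    Inside  s e = end₁ e ∈ᵇ s × end₂ e ∈ᵇ s

    outside⁺ : ∀ {s e u v} → Joins e u v → u ∉ᵇ s → v ∉ᵇ s → Outside s e
    outside⁺ (inj₁ (refl , refl)) u∉ v∉ = u∉ , v∉
    outside⁺ (inj₂ (refl , refl)) u∉ v∉ = v∉ , u∉

    outside⁻ : ∀ {s e u v} → Joins e u v → Outside s e → v ∉ᵇ s
    outside⁻ (inj₁ (refl , refl)) (u∉ , v∉) = v∉
    outside⁻ (inj₂ (refl , refl)) (v∉ , u∉) = v∉

    outside-anti : ∀ {s t} → s ≤ t → ∀ {e} → Outside t e → Outside s e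
    outside-anti s≤t (p , q) = p ∘ ball-mono s≤t , q ∘ ball-mono s≤t

    inside-mono : ∀ {s t} → s ≤ t → ∀ {e} → Inside s e → Inside t e
    inside-mono s≤t (p , q) = ball-mono s≤t p , ball-mono s≤t q

    link-outside : ∀ {s u v} → u ∉ᵇ s → Link (Outside s) u v → v ∉ᵇ s
    link-outside u∉ nil            = u∉
    link-outside u∉ (cons e o j l) = link-outside (outside⁻ j o) l

    outside-link : ∀ {s u v} (p : Walk u v) → (∀ {w} → w ∈ᵇ s → w ∉ walkVertices p) → Link (Outside s) u v
    outside-link nil                  avoid = nil
    outside-link {s} (cons e j p) avoid = cons e (outside⁺ {s} j (λ u∈ → avoid u∈ (here refl)) (λ v∈ → avoid v∈ (there (first p)))) j
      (outside-link p λ w∈ → avoid w∈ ∘ there)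
      where
      first : ∀ {u v} (p : Walk u v) → u ∈ walkVertices p
      first nil          = here refl
      first (cons _ _ _) = here refl

    module Spanning (spans : ∀ v → ∃ λ n → v ∈ᵇ n) where

      enclosed : ∀ e → ∃ λ n → Inside n e
      enclosed e with m , p ← spans (end₁ e) with n , q ← spans (end₂ e) =
        m ℕ.⊔ n , ball-mono (ℕ.m≤m⊔n m n) p , ball-mono (ℕ.m≤n⊔m m n) q

      bounded : ∀ {Q : Edge → Set ℓ} {u v} → Link Q u v → ∃ λ n → Link (λ e → Q e × Inside n e) u v
      bounded nil = 0 , nil
      bounded (cons e q j l) with m , i ← enclosed e with n , l′ ← bounded l = m ℕ.⊔ n ,
        cons e (q , inside-mono (ℕ.m≤m⊔n m n) i) j (link-map (λ (q , i) → q , inside-mono (ℕ.m≤n⊔m m n) i) l′)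

      annulus? : ∀ s t e → Dec (Outside s e × Inside t e)
      annulus? s t e = em-vertex

      annulus₀ annulus : ℕ → ℕ → List Edge
      annulus₀ s t = filter (annulus? s t) (concatMap incident (ball t))
      annulus  s t = deduplicate _≟ᵉ_ (annulus₀ s t)

      ∈-annulus : ∀ {s t e} → Outside s e → Inside t e → e ∈ annulus s t
      ∈-annulus {s} {t} {e} out inn = ∈-deduplicate⁺ _≟ᵉ_ (∈-filter⁺ (annulus? s t)
        (∈-concatMap⁺ incident (lose (listed (proj₁ inn)) (∈-incident (inj₁ refl)))) (out , inn))

      annulus⁻ : ∀ {s t e} → e ∈ annulus s t → Outside s e × Inside t e
      annulus⁻ {s} {t} e∈ = proj₂ (∈-filter⁻ (annulus? s t) {xs = concatMap incident (ball t)} (∈-deduplicate⁻ _≟ᵉ_ (annulus₀ s t) e∈))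

      annulus-unique : ∀ s t → Unique (annulus s t)
      annulus-unique s t = UniqueDec.deduplicate-! _≟ᵉ_ (annulus₀ s t)

      annulus-cut : ∀ {s t X e f} → e ∈ annulus s t → f ∈ annulus s t → e ≢ f →
        X (end₁ e) ≢ X (end₂ e) → X (end₁ f) ≢ X (end₂ f) → 2 ≤ cut (map ends (annulus s t)) X
      annulus-cut {s} {t} {X} {e} {f} e∈ f∈ e≢f Xe Xf = ℕ.≤-trans
        (unique-⊆ {xs = e ∷ f ∷ []} ((e≢f ∷ []) ∷ [] ∷ []) λ
          { (here refl)         → ∈-filter⁺ (λ e → ¬? (X (end₁ e) Bool.≟ X (end₂ e))) e∈ Xe
          ; (there (here refl)) → ∈-filter⁺ (λ e → ¬? (X (end₁ e) Bool.≟ X (end₂ e))) f∈ Xf })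
        (ℕ.≤-reflexive (sym (cut-length (annulus s t) X)))

      -- The first vertex of a walk before it enters the ball.
      entrance : ∀ {s f u v} → u ∉ᵇ s → Link (_≢ f) u v →
        Link (λ e → Outside s e × e ≢ f) u v ⊎ ∃ λ w → w ∈ᵇ (suc s) × Link (λ e → Outside s e × e ≢ f) u w
      entrance u∉ nil = inj₁ nil
      entrance {s} {u = u} u∉ (cons {v = v} e e≢f j l) with em-vertex {v ∈ᵇ s}
      ... | yes v∈ = inj₂ (u , ball-step (Joins-sym j) v∈ , nil)
      ... | no  v∉ with entrance v∉ l
      ...   | inj₁ l′            = inj₁ (cons e (outside⁺ {s} j u∉ v∉ , e≢f) j l′)
      ...   | inj₂ (w , w∈ , l′) = inj₂ (w , w∈ , cons e (outside⁺ {s} j u∉ v∉ , e≢f) j l′)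

      -- Since G has no bridge, an edge separating two vertices of a component
      -- of G − ball s also separates two neighbours of the ball; these are all
      -- linked inside a larger ball t, whose edges do not separate any
      -- component of G − ball t.
      module Bridgeless (bridgeless : ∀ f u v → Link (_≢ f) u v) where

        -- The ball has finitely many pairs of vertices. For each linked pair one link is chosen,
        -- and `t` bounds all of these.
        shortcuts : ∀ s → ∃ λ t → s ≤ t × (∀ {u v} → u ∈ᵇ (suc s) → v ∈ᵇ (suc s) →
          Link (Outside s) u v → Link (λ e → Outside s e × Inside t e) u v)
        shortcuts s = s ℕ.⊔ proj₁ all , ℕ.m≤m⊔n s (proj₁ all) ,
          λ u∈ v∈ l → link-map (λ (o , i) → o , inside-mono (ℕ.m≤n⊔m s (proj₁ all)) i) (proj₂ all (listed u∈) (listed v∈) l)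
          where
          Near₁ : Vertex → Vertex → ℕ → Set (a ⊔ b)
          Near₁ u v n = Link (Outside s) u v → Link (λ e → Outside s e × Inside n e) u v
          near-mono₁ : ∀ {u v m n} → m ≤ n → Near₁ u v m → Near₁ u v n
          near-mono₁ m≤n near l = link-map (λ (o , i) → o , inside-mono m≤n i) (near l)
          Near : Vertex → ℕ → Set (a ⊔ b)
          Near u n = ∀ {v} → v ∈ ball (suc s) → Near₁ u v n
          near-mono : ∀ {u m n} → m ≤ n → Near u m → Near u n
          near-mono m≤n near v∈ = near-mono₁ m≤n (near v∈)
          pair : ∀ {u v} → Dec (Link (Outside s) u v) → ∃ (Near₁ u v)
          pair (yes l) = proj₁ (bounded l) , λ _ → proj₂ (bounded l)
          pair (no ¬l) = 0 , λ l → contradiction l ¬l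
          all : ∃ λ n → ∀ {u} → u ∈ ball (suc s) → Near u n
          all = gather (ball (suc s)) Near near-mono λ {u} _ →
            gather (ball (suc s)) (Near₁ u) near-mono₁ λ _ → pair em

        detour : ∀ {s t u v} → s ≤ t →
          (∀ {u v} → u ∈ᵇ (suc s) → v ∈ᵇ (suc s) → Link (Outside s) u v → Link (λ e → Outside s e × Inside t e) u v) →
          u ∉ᵇ t → Link (Outside t) u v → ∀ f → Link (λ e → Outside s e × e ≢ f) u v
        detour {s} {t} {u} {v} s≤t near u∉ l f with em-vertex {Inside t f}
        ... | yes f-in = link-map (λ o → outside-anti s≤t o , λ { refl → proj₁ o (proj₁ f-in) }) l
        ... | no  f-out with entrance (u∉ ∘ ball-mono s≤t) (bridgeless f u v)
                           | entrance (link-outside u∉ l ∘ ball-mono s≤t) (bridgeless f v u)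
        ...   | inj₁ l′ | _ = l′
        ...   | inj₂ _  | inj₁ l′ = link-sym l′
        -- The middle piece avoids `f` since its edges lie inside the ball `t` and `f` does not.
        ...   | inj₂ (w , w∈ , u~w) | inj₂ (x , x∈ , v~x) =
          u~w ⁀ link-map (λ (o , i) → o , λ { refl → f-out i }) (near w∈ x∈
            (link-sym (link-map proj₁ u~w) ⁀ link-map (outside-anti s≤t) l ⁀ link-map proj₁ v~x)) ⁀ link-sym v~x

        -- `region` is empty or a component of the complement of the ball `inner`. The ring starts
        -- at `s` already, because detours around an edge may leave `region`.
        record Stage (s : ℕ) : Set (a ⊔ b) where
          field
            inner outer : ℕ
            s≤inner     : s ≤ inner
            inner≤outer : inner ≤ outer
            s<outer     : s < outer
            region      : Cut Vertex
            boundary    : List Vertex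
            region-outside   : ∀ {v} → region v ≡ true → v ∉ᵇ inner
            region-closed    : ∀ {e u v} → region u ≡ true → Joins e u v → v ∉ᵇ inner → region v ≡ true
            region-connected : ∀ {u v} → region u ≡ true → region v ≡ true → Link (Outside inner) u v
            boundary⊆region  : ∀ {v} → v ∈ boundary → region v ≡ true
            boundary⁺        : ∀ {e u v} → region u ≡ true → Joins e u v → region v ≡ false → u ∈ boundary
            boundary-nonempty : ∀ {u} → region u ≡ true → ∃ λ v → v ∈ boundary
            connects         : VP.Connects 2 boundary (map ends (annulus s outer))

        -- Serves the indices that belong to no ray.
        idle : ∀ s → Stage s
        idle s = record
          { inner = s ; outer = suc s ; s≤inner = ℕ.≤-refl ; inner≤outer = ℕ.n≤1+n s ; s<outer = ℕ.≤-refl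
          ; region = λ _ → false ; boundary = []
          ; region-outside = λ () ; region-closed = λ () ; region-connected = λ () ; boundary⊆region = λ ()
          ; boundary⁺ = λ () ; boundary-nonempty = λ () ; connects = λ { _ ((_ , () , _) , _) } }

        -- A stage whose region is the component of the complement of a ball that
        -- contains the far vertices of a ray.
        module RingStage (s t : ℕ) (s≤t : s ≤ t)
            (near : ∀ {u v} → u ∈ᵇ suc s → v ∈ᵇ suc s → Link (Outside s) u v → Link (λ e → Outside s e × Inside t e) u v)
            (tip : Vertex) (tip∉ : tip ∉ᵇ t) (m : ℕ) (tip∈ : tip ∈ᵇ m) where

          member? : ∀ v → Dec (Link (Outside t) tip v)
          member? v = em

          region : Cut Vertex
          region v = does (member? v)

          ∈region : ∀ {v} → Link (Outside t) tip v → region v ≡ true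
          ∈region {v} = dec-true (member? v)

          region⁻ : ∀ {v} → region v ≡ true → Link (Outside t) tip v
          region⁻ {v} = does-true (member? v)

          -- Radius `suc t` captures the vertices adjacent to the ball `t`; radius `m` captures
          -- `tip`, so the list is never empty.
          boundary : List Vertex
          boundary = filter member? (ball (m ℕ.⊔ suc t))

          linked : ∀ {v} → v ∈ boundary → Link (Outside t) tip v
          linked v∈ = proj₂ (∈-filter⁻ member? {xs = ball (m ℕ.⊔ suc t)} v∈)

          Between : ℕ → Edge → Set a
          Between n e = Outside s e × Inside n e

          TwoCrossings : Vertex → Vertex → ℕ → Set (a ⊔ b)
          TwoCrossings u v n = ∀ (X : Cut Vertex) → X u ≢ X v → ∃ λ e → ∃ λ f → e ≢ f ×
            (Between n e × X (end₁ e) ≢ X (end₂ e)) × (Between n f × X (end₁ f) ≢ X (end₂ f))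

          widen : ∀ {m n e} → m ≤ n → Between m e → Between n e
          widen m≤n (o , i) = o , inside-mono m≤n i

          crossings-mono : ∀ {u v m n} → m ≤ n → TwoCrossings u v m → TwoCrossings u v n
          crossings-mono m≤n two X ≢ with e , f , e≢f , (be , Xe) , (bf , Xf) ← two X ≢ =
            e , f , e≢f , (widen m≤n be , Xe) , (widen m≤n bf , Xf)

          -- A link crosses `X` in some edge, and the detour around that edge crosses `X` in another
          -- one. The link has finitely many edges, so a single radius bounds the detours for every
          -- `X`.
          two-crossings : ∀ {u v} → u ∈ boundary → v ∈ boundary → ∃ (TwoCrossings u v)
          two-crossings {u} {v} u∈ v∈
            with n₁ , l₁ ← bounded (link-map (outside-anti s≤t) (link-sym (linked u∈) ⁀ linked v∈))
            with n₂ , avoiding ← gather (link-edges l₁) (λ e n → Link (λ f → (Outside s f × f ≢ e) × Inside n f) u v)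
                   (λ m≤n → link-map λ (p , i) → p , inside-mono m≤n i)
                   (λ {e} _ → bounded (detour s≤t near (link-outside (tip∉) (linked u∈)) (link-sym (linked u∈) ⁀ linked v∈) e))
            = n₁ ℕ.⊔ n₂ , crossings
            where
            crossings : TwoCrossings u v (n₁ ℕ.⊔ n₂)
            crossings X ≢ with e , e∈ , be , Xe ← link-crosses l₁ X ≢
              with f , _ , ((of , f≢e) , if) , Xf ← link-crosses (avoiding e∈) X ≢ =
              e , f , f≢e ∘ sym , (widen (ℕ.m≤m⊔n n₁ n₂) be , Xe) , (widen (ℕ.m≤n⊔m n₁ n₂) (of , if) , Xf)

          AllCrossings : Vertex → ℕ → Set (a ⊔ b)
          AllCrossings u n = ∀ {v} → v ∈ boundary → TwoCrossings u v n

          all-crossings : ∃ λ n → ∀ {u} → u ∈ boundary → AllCrossings u n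
          all-crossings = gather boundary AllCrossings (λ m≤n two v∈ → crossings-mono m≤n (two v∈))
            λ {u} u∈ → gather boundary (TwoCrossings u) crossings-mono (two-crossings u∈)

          outer : ℕ
          outer = (t ℕ.⊔ suc s) ℕ.⊔ proj₁ all-crossings

          connects : VP.Connects 2 boundary (map ends (annulus s outer))
          connects X ((u , u∈ , Xu) , (v , v∈ , Xv)) =
            count (proj₂ all-crossings u∈ v∈ X (λ eq → false≢true (trans (sym Xv) (trans (sym eq) Xu))))
            where
            grow : ∀ {e} → Inside (proj₁ all-crossings) e → Inside outer e
            grow = inside-mono (ℕ.m≤n⊔m (t ℕ.⊔ suc s) (proj₁ all-crossings))
            count : (∃ λ e → ∃ λ f → e ≢ f ×
                (Between (proj₁ all-crossings) e × X (end₁ e) ≢ X (end₂ e)) ×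
                (Between (proj₁ all-crossings) f × X (end₁ f) ≢ X (end₂ f))) →
              2 ≤ cut (map ends (annulus s outer)) X
            count (e , f , e≢f , ((oe , ie) , Xe) , ((of , if) , Xf)) =
              annulus-cut {s} {outer} {X} (∈-annulus oe (grow ie)) (∈-annulus of (grow if)) e≢f Xe Xf

          region-outside : ∀ {v} → region v ≡ true → v ∉ᵇ t
          region-outside v∈ = link-outside (tip∉) (region⁻ v∈)

          region-closed : ∀ {e u v} → region u ≡ true → Joins e u v → v ∉ᵇ t → region v ≡ true
          region-closed u∈ j v∉ = ∈region (region⁻ u∈ ⁀ cons _ (outside⁺ {t} j (region-outside u∈) v∉) j nil)

          stage : Stage s
          stage = record
            { inner = t ; outer = outer ; s≤inner = s≤t
            ; inner≤outer = ℕ.≤-trans (ℕ.m≤m⊔n t (suc s)) (ℕ.m≤m⊔n (t ℕ.⊔ suc s) (proj₁ all-crossings))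
            ; s<outer = ℕ.≤-trans (ℕ.m≤n⊔m t (suc s)) (ℕ.m≤m⊔n (t ℕ.⊔ suc s) (proj₁ all-crossings))
            ; region = region ; boundary = boundary
            ; region-outside = region-outside
            ; region-closed = region-closed
            ; region-connected = λ u∈ v∈ → link-sym (region⁻ u∈) ⁀ region⁻ v∈
            ; boundary⊆region = ∈region ∘ linked
            ; boundary⁺ = λ {e} {u} {v} u∈ j v∉ → ∈-filter⁺ member?
                (listed (ball-mono (ℕ.m≤n⊔m m (suc t)) (near-ball u∈ j v∉))) (region⁻ u∈)
            ; boundary-nonempty = λ _ → tip , ∈-filter⁺ member? (listed (ball-mono (ℕ.m≤m⊔n m (suc t)) tip∈)) nil
            ; connects = connects
            }
            where
            near-ball : ∀ {e u v} → region u ≡ true → Joins e u v → region v ≡ false → u ∈ᵇ (suc t)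
            near-ball {v = v} u∈ j v∉ with em-vertex {v ∈ᵇ t}
            ... | yes v∈b = ball-step (Joins-sym j) v∈b
            ... | no  v∉b = contradiction (trans (sym v∉) (region-closed u∈ j v∉b)) false≢true

        -- The radius `t` is determined only here, so a tip has to be on offer outside every ball.
        ring : ∀ s (tip : ℕ → Vertex) → (∀ n → tip n ∉ᵇ n) →
          ∃ λ (S : Stage s) → ∀ {v} → Link (Outside (Stage.inner S)) (tip (Stage.inner S)) v → Stage.region S v ≡ true
        ring s tip tip∉ = R.stage , R.∈region
          where
          t = proj₁ (shortcuts s)
          module R = RingStage s t (proj₁ (proj₂ (shortcuts s))) (proj₂ (proj₂ (shortcuts s)))
            (tip t) (tip∉ t) (proj₁ (spans (tip t))) (proj₂ (spans (tip t)))

-- Infinite cuts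

-- 0, 1 0, 2 1 0, 3 2 1 0, …
schedule : ℕ → ℕ × ℕ
schedule zero    = 0 , 0
schedule (suc j) with schedule j
... | m , zero  = suc m , suc m
... | m , suc c = m , c

-- After the current block has run down to `0`, further blocks pass until one is long enough to
-- contain `i`.
schedule-recurs : ∀ i N → ∃ λ j → N ≤ j × proj₂ (schedule j) ≡ i
schedule-recurs i N = climb N (schedule N) refl
  where
  next-zero : ∀ j {m} → schedule j ≡ (m , 0) → schedule (suc j) ≡ (suc m , suc m)
  next-zero j eq rewrite eq = refl
  next-suc : ∀ j {m c} → schedule j ≡ (m , suc c) → schedule (suc j) ≡ (m , c)
  next-suc j eq rewrite eq = refl
  descend : ∀ {i m} j d → schedule j ≡ (m , d + i) → ∃ λ j′ → j ≤ j′ × schedule j′ ≡ (m , i)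
  descend j zero    eq = j , ℕ.≤-refl , eq
  descend j (suc d) eq with j′ , j<j′ , eq′ ← descend (suc j) d (next-suc j eq) = j′ , ℕ.<⇒≤ j<j′ , eq′
  climb : ∀ j s → schedule j ≡ s → ∃ λ j′ → j ≤ j′ × proj₂ (schedule j′) ≡ i
  raise : ∀ d j {m} → schedule j ≡ (m , m) → i ≤ d + m → ∃ λ j′ → j ≤ j′ × proj₂ (schedule j′) ≡ i
  raise zero j {m} eq i≤m with j′ , j≤ , eq′ ← descend {i} j (m ∸ i) (trans eq (cong (m ,_) (sym (ℕ.m∸n+n≡m i≤m)))) =
    j′ , j≤ , cong proj₂ eq′
  raise (suc d) j {m} eq i≤ with j₁ , j≤j₁ , eq₁ ← descend {0} j m (trans eq (cong (m ,_) (sym (ℕ.+-identityʳ m))))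
    with j₂ , j₁<j₂ , eq₂ ← raise d (suc j₁) (next-zero j₁ eq₁) (ℕ.≤-trans i≤ (ℕ.≤-reflexive (sym (ℕ.+-suc d m)))) =
    j₂ , ℕ.≤-trans j≤j₁ (ℕ.<⇒≤ j₁<j₂) , eq₂
  climb j (m , c) eq with j₁ , j≤j₁ , eq₁ ← descend {0} j c (trans eq (cong (m ,_) (sym (ℕ.+-identityʳ c))))
    with j₂ , j₁<j₂ , eq₂ ← raise i (suc j₁) (next-zero j₁ eq₁) (ℕ.m≤m+n i (suc m)) = j₂ , ℕ.≤-trans j≤j₁ (ℕ.<⇒≤ j₁<j₂) , eq₂

module InfiniteCuts (em : ExcludedMiddle (a ⊔ b)) (G : Graph a b) (locally-finite : LocallyFinite G)
    (index : Ray G → ℕ) (index-injective : Injective (_∼_ G) _≡_ index) (root : Graph.Vertex G) where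
  open Graph G
  open Geometry em G locally-finite public
  open Balls root public

  module Rings (spans : ∀ v → ∃ λ n → v ∈ᵇ n) (bridgeless : ∀ f u v → Link (_≢ f) u v) where
    open Spanning spans public
    open Bridgeless bridgeless public

    tail-start : Ray G → ℕ → ℕ
    tail-start R s = proj₁ (eventually-avoids em-vertex (λ m v → Ray.vertex R m ≡ v)
      (λ p q → Ray.distinct R (trans p (sym q))) (ball s))

    ray-tail : ∀ R s {m} → tail-start R s ≤ m → Ray.vertex R m ∉ᵇ s
    ray-tail R s τ≤m v∈ = proj₂ (eventually-avoids em-vertex (λ m v → Ray.vertex R m ≡ v)
      (λ p q → Ray.distinct R (trans p (sym q))) (ball s)) τ≤m (listed v∈) refl

    tail-forward : ∀ R s {m n} → tail-start R s ≤ m → m ≤′ n → Link (Outside s) (Ray.vertex R m) (Ray.vertex R n)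
    tail-forward R s τ≤m ≤′-refl           = nil
    tail-forward R s τ≤m (≤′-step {n} m≤n) = tail-forward R s τ≤m m≤n ⁀ cons (Ray.edge R n)
      (outside⁺ {s} (Ray.joins R n) (ray-tail R s τ≤n) (ray-tail R s (ℕ.m≤n⇒m≤1+n τ≤n))) (Ray.joins R n) nil
      where τ≤n = ℕ.≤-trans τ≤m (ℕ.≤′⇒≤ m≤n)

    tail-linked : ∀ R s {m n} → tail-start R s ≤ m → tail-start R s ≤ n →
      Link (Outside s) (Ray.vertex R m) (Ray.vertex R n)
    tail-linked R s {m} {n} τ≤m τ≤n with ℕ.≤-total m n
    ... | inj₁ m≤n = tail-forward R s τ≤m (ℕ.≤⇒≤′ m≤n)
    ... | inj₂ n≤m = link-sym (tail-forward R s τ≤n (ℕ.≤⇒≤′ n≤m))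

    -- Among the disjoint paths one avoids the ball and both initial segments; it therefore joins
    -- the tails of the rays outside the ball.
    equivalent-linked : ∀ {R S} → _∼_ G R S → ∀ s {m n} → tail-start R s ≤ m → tail-start S s ≤ n →
      Link (Outside s) (Ray.vertex R m) (Ray.vertex S n)
    equivalent-linked {R} {S} (P , disjoint) s {m} {n} τ≤m τ≤n = via (eventually-avoids em-vertex
        (λ i v → v ∈ PathBetween.vertices (P i)) (λ {_} {i} {j} v∈i v∈j → decidable-stable (i ℕ.≟ j) λ i≢j → disjoint i j i≢j (v∈i , v∈j)) avoid)
      where
      avoid : List Vertex
      avoid = ball s ++ map (Ray.vertex R) (upTo (tail-start R s)) ++ map (Ray.vertex S) (upTo (tail-start S s))
      via : (∃ λ N → ∀ {i} → N ≤ i → ∀ {v} → v ∈ avoid → v ∉ PathBetween.vertices (P i)) →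
        Link (Outside s) (Ray.vertex R m) (Ray.vertex S n)
      via (N , avoids) = tail-linked R s τ≤m (late R start λ v∈ → avoids ℕ.≤-refl (∈-++⁺ʳ (ball s) (∈-++⁺ˡ v∈)) (first walk)) ⁀
        outside-link walk (λ v∈ → avoids ℕ.≤-refl (∈-++⁺ˡ (listed v∈))) ⁀
        tail-linked S s (late S finish λ v∈ → avoids ℕ.≤-refl (∈-++⁺ʳ (ball s) (∈-++⁺ʳ (map (Ray.vertex R) (upTo (tail-start R s))) v∈)) (last walk)) τ≤n
        where
        open PathBetween (P N) using (start; finish; path)
        open Paths.Path path using (walk)
        first : ∀ {u v} (p : Paths.Walk Joins u v) → u ∈ Paths.walkVertices Joins p
        first Paths.nil          = here refl
        first (Paths.cons _ _ _) = here refl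
        last : ∀ {u v} (p : Paths.Walk Joins u v) → v ∈ Paths.walkVertices Joins p
        last Paths.nil          = here refl
        last (Paths.cons _ _ p) = there (last p)
        late : ∀ T i → Ray.vertex T i ∉ map (Ray.vertex T) (upTo (tail-start T s)) → tail-start T s ≤ i
        late T i ∉early = ℕ.≮⇒≥ λ i<τ → ∉early (∈-map⁺ (Ray.vertex T) (∈-upTo⁺ i<τ))

    Catches : ∀ {s} → Stage s → Ray G → Set
    Catches S R = ∃ λ τ → ∀ {m} → τ ≤ m → Stage.region S (Ray.vertex R m) ≡ true

    -- The stage is built around one ray of index `i`. Any other is equivalent to it by injectivity
    -- of the index, so its tail lies in the same component.
    stage-for : ∀ s i → ∃ λ (S : Stage s) → ∀ R → index R ≡ i → Catches S R
    stage-for s i = choose (em {∃ λ R → index R ≡ i})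
      where
      choose : Dec (∃ λ R → index R ≡ i) → ∃ λ (S : Stage s) → ∀ R → index R ≡ i → Catches S R
      choose (no none)       = idle s , λ R eq → contradiction (R , eq) none
      choose (yes (R , R≡i)) = finish (ring s (λ n → Ray.vertex R (tail-start R n)) (λ n → ray-tail R n ℕ.≤-refl))
        where
        finish : (∃ λ (S : Stage s) → ∀ {v} → Link (Outside (Stage.inner S)) (Ray.vertex R (tail-start R (Stage.inner S))) v → Stage.region S v ≡ true) →
          ∃ λ (S : Stage s) → ∀ R → index R ≡ i → Catches S R
        finish (S , ∈region) = S , λ R′ R′≡i → tail-start R′ (Stage.inner S) , λ τ≤m →
          ∈region (equivalent-linked (index-injective (trans R≡i (sym R′≡i))) (Stage.inner S) ℕ.≤-refl τ≤m)

    -- Each stage begins at the radius where the previous ring ends, which makes the rings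
    -- edge-disjoint.
    radius : ℕ → ℕ
    stage  : ∀ j → Stage (radius j)

    radius zero    = 0
    radius (suc j) = Stage.outer (stage j)

    stage j = proj₁ (stage-for (radius j) (proj₂ (schedule j)))

    module S j = Stage (stage j)

    catches : ∀ j R → index R ≡ proj₂ (schedule j) → Catches (stage j) R
    catches j = proj₂ (stage-for (radius j) (proj₂ (schedule j)))

    radius-mono : ∀ {i j} → i ≤ j → radius i ≤ radius j
    radius-mono i≤j = go (ℕ.≤⇒≤′ i≤j)
      where
      go : ∀ {i j} → i ≤′ j → radius i ≤ radius j
      go ≤′-refl           = ℕ.≤-refl
      go (≤′-step {j} i≤j) = ℕ.≤-trans (go i≤j) (ℕ.<⇒≤ (S.s<outer j))

    radius≥ : ∀ j → j ≤ radius j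
    radius≥ zero    = z≤n
    radius≥ (suc j) = ℕ.≤-trans (s≤s (radius≥ j)) (S.s<outer j)

    inner≤radius : ∀ {i j} → i < j → S.inner i ≤ radius j
    inner≤radius {i} i<j = ℕ.≤-trans (S.inner≤outer i) (radius-mono i<j)

    ring-at : ℕ → Ring
    ring-at j = record
      { edges     = annulus (radius j) (radius (suc j))
      ; terminals = S.boundary j
      ; pairing   = VP.pairing 2 (s≤s z≤n) refl (S.boundary j) _ (S.connects j)
      }

    inner-ends : ∀ j {e} → e ∈ Ring.edges (ring-at j) → Inside (radius (suc j)) e
    inner-ends j e∈ = proj₂ (annulus⁻ {radius j} {radius (suc j)} e∈)

    outer-ends : ∀ j {e} → e ∈ Ring.edges (ring-at j) → Outside (radius j) e
    outer-ends j e∈ = proj₁ (annulus⁻ {radius j} {radius (suc j)} e∈)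

    rings-disjoint : ∀ {i j e} → e ∈ Ring.edges (ring-at i) → e ∈ Ring.edges (ring-at j) → i ≡ j
    rings-disjoint {i} {j} e∈i e∈j with ℕ.<-cmp i j
    ... | tri≈ _ i≡j _ = i≡j
    ... | tri< i<j _ _ = contradiction (ball-mono (radius-mono i<j) (proj₁ (inner-ends i e∈i))) (proj₁ (outer-ends j e∈j))
    ... | tri> _ _ j<i = contradiction (ball-mono (radius-mono j<i) (proj₁ (inner-ends j e∈j))) (proj₁ (outer-ends i e∈i))

    -- The later region is connected outside a ball that contains the ball `S.inner i`, so once it
    -- meets the earlier region it cannot leave it.
    nested : ∀ {i j u v} → i < j → S.region i u ≡ true → S.region j u ≡ true → S.region j v ≡ true → S.region i v ≡ true
    nested {i} {j} i<j u∈i u∈j v∈j = go u∈i (S.region-connected j u∈j v∈j)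
      where
      go : ∀ {u v} → S.region i u ≡ true → Link (Outside (S.inner j)) u v → S.region i v ≡ true
      go u∈ nil            = u∈
      go u∈ (cons e o k l) = go (S.region-closed i u∈ k (outside⁻ k o ∘ ball-mono (ℕ.≤-trans (inner≤radius i<j) (S.s≤inner j)))) l

    -- Distance levels and descendants

    Finite : ∀ {ℓ} → (Vertex → Set ℓ) → Set (a ⊔ ℓ)
    Finite P = ∃ λ (L : List Vertex) → ∀ {w} → P w → w ∈ L

    finite-⋃ : ∀ {ℓ} {P : Vertex → Vertex → Set ℓ} xs → (∀ {x} → x ∈ xs → Finite (P x)) →
      Finite (λ w → ∃ λ x → x ∈ xs × P x w)
    finite-⋃ []       each = [] , λ { (_ , () , _) }
    finite-⋃ (x ∷ xs) each with L , L⊇ ← each (here refl) with M , M⊇ ← finite-⋃ xs (each ∘ there) =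
      L ++ M , λ { (_ , here refl , p) → ∈-++⁺ˡ (L⊇ p) ; (_ , there x∈ , p) → ∈-++⁺ʳ L (M⊇ (_ , x∈ , p)) }

    AtLevel : ℕ → Vertex → Set a
    AtLevel n w = w ∈ᵇ n × (∀ {m} → m < n → w ∉ᵇ m)

    level : ∀ w → ∃ λ n → AtLevel n w
    level w = least (proj₁ (spans w)) (proj₂ (spans w))
      where
      least : ∀ n → w ∈ᵇ n → ∃ λ n → AtLevel n w
      least zero    w∈ = 0 , w∈ , λ ()
      least (suc n) w∈ with em-vertex {w ∈ᵇ n}
      ... | yes w∈n = least n w∈n
      ... | no  w∉n = suc n , w∈ , λ { (s≤s m≤n) w∈m → w∉n (ball-mono m≤n w∈m) }

    level-unique : ∀ {m n w} → AtLevel m w → AtLevel n w → m ≡ n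
    level-unique {m} {n} (w∈m , <m) (w∈n , <n) with ℕ.<-cmp m n
    ... | tri< m<n _ _ = contradiction w∈m (<n m<n)
    ... | tri≈ _ m≡n _ = m≡n
    ... | tri> _ _ n<m = contradiction w∈n (<m n<m)

    level-pred : ∀ {n w} → AtLevel (suc n) w → ∃ λ z → ∃ λ e → AtLevel n z × Joins e z w
    level-pred {n} {w} (w∈ , <n) with ∈-++⁻ (ball n) (listed w∈)
    ... | inj₁ w∈n = contradiction (within w∈n) (<n ℕ.≤-refl)
    ... | inj₂ w∈′ with z , z∈ , w∈z ← find (∈-concatMap⁻ neighbours {xs = ball n} w∈′)
      with e , j ← neighbours⁻ w∈z (λ { refl → <n ℕ.≤-refl (within z∈) }) =
      z , e , (within z∈ , λ m<n z∈m → <n (s≤s m<n) (ball-step j z∈m)) , j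

    -- The level rises by one with each step, so the descent never returns to a smaller ball; hence
    -- a region that contains a far vertex contains its descendants.
    data Descendant (n : ℕ) (y : Vertex) : ℕ → Vertex → Set (a ⊔ b) where
      self : Descendant n y n y
      snoc : ∀ {m z w} e → Descendant n y m z → Joins e z w → AtLevel (suc m) w → Descendant n y (suc m) w

    descendant-level : ∀ {n y m w} → Descendant n y m w → n ≤ m
    descendant-level self           = ℕ.≤-refl
    descendant-level (snoc _ d _ _) = ℕ.m≤n⇒m≤1+n (descendant-level d)

    descendant-of-root : ∀ m {w} → AtLevel m w → Descendant 0 root m w
    descendant-of-root zero    (within (here refl) , _) = self
    descendant-of-root (suc m) lv with z , e , lz , j ← level-pred lv = snoc e (descendant-of-root m lz) j lv

    descendant-head : ∀ {n y m w} → Descendant n y m w → (w ≡ y × m ≡ n) ⊎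
      (∃ λ y′ → (∃ λ e → Joins e y y′) × AtLevel (suc n) y′ × Descendant (suc n) y′ m w)
    descendant-head self = inj₁ (refl , refl)
    descendant-head (snoc e d j lv) with descendant-head d
    ... | inj₁ (refl , refl)             = inj₂ (_ , (e , j) , lv , self)
    ... | inj₂ (y′ , adj , lv′ , d′) = inj₂ (y′ , adj , lv′ , snoc e d′ j lv)

    -- König's lemma along geodesics from the root.
    module König (Free : ℕ → Vertex → Set) (anti : ∀ {m n w} → m ≤ n → Free n w → Free m w)
        (infinite : ∀ m → ¬ Finite (Free m)) where

      Below : ℕ → Vertex → ℕ → Vertex → Set (a ⊔ b)
      Below n y m w = (∃ λ m′ → Descendant n y m′ w) × Free m w

      -- Every `m` is demanded at once, because the ray is constructed before it is known which
      -- stage catches it.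
      Big : ℕ → Vertex → Set (a ⊔ b)
      Big n y = ∀ m → ¬ Finite (Below n y m)

      Child : ℕ → Vertex → Set (a ⊔ b)
      Child n y = ∃ λ z → (∃ λ e → Joins e y z) × AtLevel (suc n) z × Big (suc n) z

      -- If each child failed for some `m`, the largest of these finitely many `m` would fail for
      -- `y`, whose descendants are itself and those of its children.
      child : ∀ n y → Big n y → Child n y
      child n y big = decide em
        where
        IsChild : Vertex → Set (a ⊔ b)
        IsChild z = (∃ λ e → Joins e y z) × AtLevel (suc n) z
        module _ (none : ¬ Child n y) where
          Bounded : Vertex → ℕ → Set (a ⊔ b)
          Bounded z m = IsChild z → Finite (Below (suc n) z m)
          bounded-at : ∀ z → ∃ (Bounded z)
          bounded-at z = at (em {IsChild z}) (em {∃ λ m → Finite (Below (suc n) z m)})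
            where
            at : Dec (IsChild z) → Dec (∃ λ m → Finite (Below (suc n) z m)) → ∃ (Bounded z)
            at (no ¬c)  _               = 0 , λ c → contradiction c ¬c
            at _        (yes (m , fin)) = m , λ _ → fin
            at (yes (adj , lv)) (no ¬fin) = ⊥-elim (none (z , adj , lv , λ m fin → ¬fin (m , fin)))
          all-bounded : ∃ λ m → ∀ {z} → z ∈ neighbours y → Bounded z m
          all-bounded = gather (neighbours y) Bounded
            (λ m≤n bd c → let L , L⊇ = bd c in L , λ (d , free) → L⊇ (d , anti m≤n free)) (λ {z} _ → bounded-at z)
          m = proj₁ all-bounded
          covered : Finite (λ w → ∃ λ z → z ∈ neighbours y × IsChild z × Below (suc n) z m w)
          covered = finite-⋃ (neighbours y) λ {z} z∈ → one z∈ (em {IsChild z})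
            where
            one : ∀ {z} → z ∈ neighbours y → Dec (IsChild z) → Finite (λ w → IsChild z × Below (suc n) z m w)
            one z∈ (yes c) = let L , L⊇ = proj₂ all-bounded z∈ c in L , L⊇ ∘ proj₂
            one z∈ (no ¬c) = [] , λ (c , _) → contradiction c ¬c
          small : Finite (Below n y m)
          small = y ∷ proj₁ covered , λ ((m′ , d) , free) → place free (descendant-head d)
            where
            place : ∀ {w m′} → Free m w → (w ≡ y × m′ ≡ n) ⊎
              (∃ λ z → (∃ λ e → Joins e y z) × AtLevel (suc n) z × Descendant (suc n) z m′ w) → w ∈ y ∷ proj₁ covered
            place free (inj₁ (refl , _)) = here refl
            place free (inj₂ (z , (e , j) , lv , d)) =
              there (proj₂ covered (z , ∈-neighbours j , ((e , j) , lv) , ((_ , d) , free)))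
        decide : Dec (Child n y) → Child n y
        decide (yes c)   = c
        decide (no none) = ⊥-elim (big (m none) (small none))

      State : ℕ → Set (a ⊔ b)
      State n = ∃ λ y → AtLevel n y × Big n y

      state : ∀ n → State n
      state zero    = root , (within (here refl) , λ ()) , λ m (L , L⊇) →
        infinite m (L , λ {w} free → L⊇ ((_ , descendant-of-root _ (proj₂ (level w))) , free))
      state (suc n) with y , _ , big ← state n with z , _ , lv , bigz ← child n y big = z , lv , bigz

      link : ∀ n → ∃ λ e → Joins e (proj₁ (state n)) (proj₁ (state (suc n)))
      link n with y , _ , big ← state n with z , adj , _ ← child n y big = adj

      geodesic : Ray G
      geodesic = record
        { vertex   = λ n → proj₁ (state n)
        ; edge     = λ n → proj₁ (link n)
        ; joins    = λ n → proj₂ (link n)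
        ; distinct = λ {m} {n} eq → level-unique (proj₁ (proj₂ (state m)))
            (subst (AtLevel n) (sym eq) (proj₁ (proj₂ (state n))))
        }

      big : ∀ n → Big n (Ray.vertex geodesic n)
      big n = proj₂ (proj₂ (state n))

    -- Making a set constant on regions

    arc-joins : ∀ o e → Joins e (proj₁ (arc o e)) (proj₂ (arc o e))
    arc-joins o e with o e
    ... | true  = inj₁ (refl , refl)
    ... | false = inj₂ (refl , refl)

    -- The common value on a uniform boundary, read off at the first vertex; by `boundary-nonempty`
    -- there is one whenever the region has a vertex.
    value : List Vertex → Cut Vertex → Bool
    value []      Y = false
    value (p ∷ _) Y = Y p

    value-uniform : ∀ A {Y : Cut Vertex} {p} → (∀ {p q} → p ∈ A → q ∈ A → Y p ≡ Y q) → p ∈ A → value A Y ≡ Y p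
    value-uniform (_ ∷ _) uniform p∈ = uniform (here refl) p∈

    Uniform : Cut Vertex → ℕ → Set a
    Uniform Y j = ∀ {p q} → p ∈ S.boundary j → q ∈ S.boundary j → Y p ≡ Y q

    adjust : ℕ → Cut Vertex → Cut Vertex
    adjust j Y w = if S.region j w then value (S.boundary j) Y else Y w

    adjust-in : ∀ j Y {w} → S.region j w ≡ true → adjust j Y w ≡ value (S.boundary j) Y
    adjust-in j Y w∈ rewrite w∈ = refl

    adjust-out : ∀ j Y {w} → S.region j w ≡ false → adjust j Y w ≡ Y w
    adjust-out j Y w∉ rewrite w∉ = refl

    adjust-boundary : ∀ j Y {p} → Uniform Y j → p ∈ S.boundary j → adjust j Y p ≡ Y p
    adjust-boundary j Y uniform p∈ = trans (adjust-in j Y (S.boundary⊆region j p∈)) (value-uniform (S.boundary j) uniform p∈)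

    -- An edge can leave the region only from its boundary, where `Y` already has the value that the
    -- whole region receives.
    adjust-adjacent : ∀ j Y {e p q} → Uniform Y j → Joins e p q →
      (adjust j Y p ≡ Y p × adjust j Y q ≡ Y q) ⊎ adjust j Y p ≡ adjust j Y q
    adjust-adjacent j Y {e} {p} {q} uniform e-joins = by (S.region j p) (S.region j q) refl refl
      where
      by : ∀ x y → S.region j p ≡ x → S.region j q ≡ y →
        (adjust j Y p ≡ Y p × adjust j Y q ≡ Y q) ⊎ adjust j Y p ≡ adjust j Y q
      by true  true  p∈ q∈ = inj₂ (trans (adjust-in j Y p∈) (sym (adjust-in j Y q∈)))
      by false false p∉ q∉ = inj₁ (adjust-out j Y p∉ , adjust-out j Y q∉)
      by true  false p∈ q∉ = inj₁ (adjust-boundary j Y uniform (S.boundary⁺ j p∈ e-joins q∉) , adjust-out j Y q∉)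
      by false true  p∉ q∈ = inj₁ (adjust-out j Y p∉ , adjust-boundary j Y uniform (S.boundary⁺ j q∈ (Joins-sym e-joins) p∉))

    adjust-Out : ∀ o j Y {e} → Uniform Y j → Out o (adjust j Y) e → Out o Y e
    adjust-Out o j Y {e} uniform (t∈ , h∉) = by (adjust-adjacent j Y uniform (arc-joins o e))
      where
      by : _ ⊎ _ → Out o Y e
      by (inj₁ (t≡ , h≡)) = trans (sym t≡) t∈ , trans (sym h≡) h∉
      by (inj₂ t≡h)       = contradiction (trans (sym h∉) (trans (sym t≡h) t∈)) false≢true

    -- From some stage J on, no ring is split by X.  Making X constant on the
    -- regions one after the other creates no new arc leaving X, and turns X
    -- into a finite cut as soon as all but finitely many vertices are covered.
    module InfiniteCut (k : ℕ) (o : Edge → Bool) (linked : ∀ j → Linked o (ring-at j))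
        (finite-cuts : ∀ X L → Covers X L → Proper X → OutDegree≥ k o X)
        (X : Cut Vertex) {u v} (u∈X : X u ≡ true) (v∉X : X v ≡ false)
        (D : List Edge) (D⊇ : ∀ e → Out o X e → e ∈ D) where

      late : ∃ λ N → ∀ {j} → N ≤ j → ∀ {e} → e ∈ D → e ∉ Ring.edges (ring-at j)
      late = eventually-avoids em-edge (λ j e → e ∈ Ring.edges (ring-at j)) (λ {_} {i} {j} → rings-disjoint {i} {j}) D

      -- From `J` on, rings contain no edge of `D`, and regions avoid a ball that contains `u` and
      -- `v`.
      J : ℕ
      J = proj₁ late ℕ.⊔ (proj₁ (spans u) ℕ.⊔ proj₁ (spans v))

      near : ∀ {w} → proj₁ (spans w) ≤ proj₁ (spans u) ℕ.⊔ proj₁ (spans v) → w ∈ᵇ radius J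
      near {w} le = ball-mono (ℕ.≤-trans le (ℕ.≤-trans (ℕ.m≤n⊔m (proj₁ late) _) (radius≥ J))) (proj₂ (spans w))

      approx : ℕ → Cut Vertex
      approx zero    = X
      approx (suc m) = adjust (m + J) (approx m)

      same-region : ∀ {i j p q} → i < j → p ∈ S.boundary j → q ∈ S.boundary j → S.region i p ≡ S.region i q
      same-region {i} {j} {p} {q} i<j p∈ q∈ = by (S.region i p) (S.region i q) refl refl
        where
        by : ∀ x y → S.region i p ≡ x → S.region i q ≡ y → S.region i p ≡ S.region i q
        by true  _     ip _  = trans ip (sym (nested i<j ip (S.boundary⊆region j p∈) (S.boundary⊆region j q∈)))
        by false false ip iq = trans ip (sym iq)
        by false true  _  iq = trans (nested i<j iq (S.boundary⊆region j q∈) (S.boundary⊆region j p∈)) (sym iq)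

      -- If `X` split a late boundary, the ring would contain a leaving edge and hence an edge of
      -- `D`. Adjustments preserve uniformity, since an earlier region contains all or none of a
      -- later boundary.
      uniform : ∀ m j → m + J ≤ j → Uniform (approx m) j
      uniform zero j J≤j {p} {q} p∈ q∈ = by (X p) (X q) refl refl
        where
        unsplit : VP.Splits (S.boundary j) X → ⊥
        unsplit s with e , e∈ , out ← linked j X s =
          proj₂ late (ℕ.≤-trans (ℕ.m≤m⊔n (proj₁ late) _) J≤j) (D⊇ e out) e∈
        by : ∀ x y → X p ≡ x → X q ≡ y → X p ≡ X q
        by true  true  Xp Xq = trans Xp (sym Xq)
        by false false Xp Xq = trans Xp (sym Xq)
        by true  false Xp Xq = ⊥-elim (unsplit ((p , p∈ , Xp) , (q , q∈ , Xq)))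
        by false true  Xp Xq = ⊥-elim (unsplit ((q , q∈ , Xq) , (p , p∈ , Xp)))
      uniform (suc m) j m<j {p} {q} p∈ q∈ =
        cong₂ (λ r y → if r then value (S.boundary (m + J)) (approx m) else y)
          (same-region m<j p∈ q∈) (uniform m j (ℕ.<⇒≤ m<j) p∈ q∈)

      Out-approx : ∀ m {e} → Out o (approx m) e → Out o X e
      Out-approx zero    out = out
      Out-approx (suc m) out = Out-approx m (adjust-Out o (m + J) (approx m) (uniform m (m + J) ℕ.≤-refl) out)

      -- A later region that meets `S.region i` lies inside it, boundary included, and thus receives
      -- the value that `S.region i` already has.
      constant : ∀ m {i p q} → i < m + J → J ≤ i → S.region i p ≡ true → S.region i q ≡ true → approx m p ≡ approx m q
      constant zero i<J J≤i _ _ = contradiction i<J (ℕ.≤⇒≯ J≤i)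
      constant (suc m) {i} {p} {q} i<1+j J≤i p∈ q∈ with ℕ.m≤n⇒m<n∨m≡n (ℕ.s≤s⁻¹ i<1+j)
      ... | inj₂ refl = trans (adjust-in i (approx m) p∈) (sym (adjust-in i (approx m) q∈))
      ... | inj₁ i<j  = by (S.region j p) (S.region j q) refl refl
        where
        j = m + J
        mixed : ∀ {p q} → S.region i p ≡ true → S.region i q ≡ true → S.region j p ≡ true → S.region j q ≡ false →
          adjust j (approx m) p ≡ adjust j (approx m) q
        mixed {p} {q} p∈ q∈ jp jq with c , c∈ ← S.boundary-nonempty j jp =
          trans (adjust-in j (approx m) jp) (trans (value-uniform (S.boundary j) (uniform m j ℕ.≤-refl) c∈)
            (trans (constant m i<j J≤i (nested i<j p∈ jp (S.boundary⊆region j c∈)) q∈) (sym (adjust-out j (approx m) jq))))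
        by : ∀ x y → S.region j p ≡ x → S.region j q ≡ y → adjust j (approx m) p ≡ adjust j (approx m) q
        by true  true  jp jq = trans (adjust-in j (approx m) jp) (sym (adjust-in j (approx m) jq))
        by true  false jp jq = mixed p∈ q∈ jp jq
        by false true  jp jq = sym (mixed q∈ p∈ jq jp)
        by false false jp jq = trans (adjust-out j (approx m) jp) (trans (constant m i<j J≤i p∈ q∈) (sym (adjust-out j (approx m) jq)))

      fixed : ∀ m {w} → w ∈ᵇ radius J → approx m w ≡ X w
      fixed zero    w∈ = refl
      fixed (suc m) w∈ = trans (adjust-out (m + J) (approx m) (Bool.¬-not λ jw → S.region-outside (m + J) jw
        (ball-mono (ℕ.≤-trans (radius-mono (ℕ.m≤n+m J m)) (S.s≤inner (m + J))) w∈))) (fixed m w∈)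

      Free : ℕ → Vertex → Set
      Free m w = ∀ i → J ≤ i → i < m + J → S.region i w ≡ false

      -- The first end of an edge across `approx m` is one of the finitely many free vertices or
      -- lies in some region. In the latter case the edge leaves that region, so its second end lies
      -- in a fixed ball. Thus the cut is finite, and `D` still contains its leaving edges.
      finish : ∀ m → Finite (Free m) → k ≤ length D
      finish m (L , L⊇) = finite-cuts (approx m) (concatMap incident (L ++ ball (radius (m + J)))) covers
        ((u , trans (fixed m (near (ℕ.m≤m⊔n _ _))) u∈X) , (v , trans (fixed m (near (ℕ.m≤n⊔m (proj₁ (spans u)) _))) v∉X))
        D (λ e → D⊇ e ∘ Out-approx m)
        where
        covers : Covers (approx m) (concatMap incident (L ++ ball (radius (m + J))))
        covers e ≢ = by em₀
          where
          incident-∈ : ∀ {w} → Incident e w → w ∈ L ++ ball (radius (m + J)) → e ∈ concatMap incident (L ++ ball (radius (m + J)))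
          incident-∈ inc w∈ = ∈-concatMap⁺ incident (lose w∈ (∈-incident inc))
          by : Dec (∃ λ i → J ≤ i × i < m + J × S.region i (end₁ e) ≡ true) → _
          by (no free) = incident-∈ (inj₁ refl) (∈-++⁺ˡ (L⊇ λ i J≤i i<m → Bool.¬-not λ i∈ → free (i , J≤i , i<m , i∈)))
          by (yes (i , J≤i , i<m , p∈)) = incident-∈ (inj₂ refl) (∈-++⁺ʳ L (listed (ball-mono (inner≤radius i<m) (near-ball em-vertex))))
            where
            near-ball : Dec (end₂ e ∈ᵇ S.inner i) → end₂ e ∈ᵇ S.inner i
            near-ball (yes q∈) = q∈
            near-ball (no  q∉) = contradiction (constant m i<m J≤i p∈ (S.region-closed i p∈ (Joins-ends e) q∉)) ≢

      -- Otherwise a geodesic ray would have free descendants beyond each of its vertices. But some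
      -- stage after `J` catches the ray, and then its region swallows all descendants of a far
      -- vertex.
      some-finite : ¬ (∀ m → ¬ Finite (Free m))
      some-finite infinite = clash (schedule-recurs (index K.geodesic) J)
        where
        module K = König Free (λ m≤n free i J≤i i<m → free i J≤i (ℕ.≤-trans i<m (ℕ.+-monoˡ-≤ J m≤n))) infinite
        clash : (∃ λ j → J ≤ j × proj₂ (schedule j) ≡ index K.geodesic) → ⊥
        clash (j , J≤j , eq) = trap (catches j K.geodesic (sym eq))
          where
          trap : Catches (stage j) K.geodesic → ⊥
          -- `suc (j ∸ J)` is the least number of adjustments that includes stage `j`.
          trap (τ , caught) = K.big n (suc (j ∸ J)) ([] , λ ((m , d) , free) →
            contradiction (trans (sym (free j J≤j (s≤s (ℕ.≤-reflexive (sym (ℕ.m∸n+n≡m J≤j)))))) (swallowed d)) false≢true)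
            where
            n = τ ℕ.⊔ suc (S.inner j)
            swallowed : ∀ {m w} → Descendant n (Ray.vertex K.geodesic n) m w → S.region j w ≡ true
            swallowed self = caught (ℕ.m≤m⊔n τ _)
            swallowed (snoc e d k (_ , <m)) = S.region-closed j (swallowed d) k
              (<m (s≤s (ℕ.≤-trans (ℕ.n≤1+n _) (ℕ.≤-trans (ℕ.m≤n⊔m τ _) (descendant-level d)))))

      bound : k ≤ length D
      bound with em-vertex {∃ λ m → Finite (Free m)}
      ... | yes (m , fin) = finish m fin
      ... | no  none      = ⊥-elim (some-finite λ m fin → none (m , fin))

-- The theorem

2*≡ : ∀ k → 2 * k ≡ k + k
2*≡ k = cong (_+_ k) (ℕ.+-identityʳ k)

module Forward (em : ExcludedMiddle (a ⊔ b)) (G : Graph a b) (locally-finite : LocallyFinite G)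
    (index : Ray G → ℕ) (index-injective : Injective (_∼_ G) _≡_ index)
    (k : ℕ) (k>0 : 1 ≤ k) (edge-connected : EdgeConnected (2 * k) G) (root : Graph.Vertex G) where
  open Graph G
  open InfiniteCuts em G locally-finite index index-injective root

  avoiding : ∀ F → length F < k + k → ∀ u v → Link (_∉ F) u v
  avoiding F small u v = deleted-link (Paths.Path.walk
    (edge-connected F (ℕ.≤-trans small (ℕ.≤-reflexive (sym (2*≡ k)))) u v))

  two≤ : 2 ≤ k + k
  two≤ = ℕ.+-mono-≤ k>0 k>0

  spans : ∀ v → ∃ λ n → v ∈ᵇ n
  spans v = in-ball (avoiding [] (ℕ.≤-trans (s≤s z≤n) two≤) root v)

  bridgeless : ∀ f u v → Link (_≢ f) u v
  bridgeless f u v = link-map (λ e∉ e≡f → e∉ (here e≡f)) (avoiding (f ∷ []) two≤ u v)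

  large-cuts : ∀ X L → Covers X L → Proper X → k + k ≤ length L
  large-cuts X L covers ((u , Xu) , (v , Xv)) = ℕ.≮⇒≥ λ small →
    let e , _ , e∉L , crosses = link-crosses (avoiding L small u v) X (λ eq → false≢true (trans (sym Xv) (trans (sym eq) Xu)))
    in e∉L (covers e crosses)

  open Rings spans bridgeless

  -- A cut comes with a list covering it because that list serves as the finite support of the
  -- constraint.
  Constraint : Set (a ⊔ b)
  Constraint = ℕ ⊎ (Σ (Cut Vertex × List Edge) λ (X , L) → Covers X L)

  holds : Constraint → (Edge → Bool) → Set (a ⊔ b)
  holds (inj₁ j)             o = Linked o (ring-at j)
  holds (inj₂ ((X , L) , _)) o = Proper X → OutDegree≥ k o X

  support : Constraint → List Edge
  support (inj₁ j)             = Ring.edges (ring-at j)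
  support (inj₂ ((X , L) , _)) = L

  Out-local : ∀ {o o′ X e} → o e ≡ o′ e → Out o X e → Out o′ X e
  Out-local {e = e} eq out rewrite eq = out

  Out-crosses : ∀ o X e → Out o X e → X (end₁ e) ≢ X (end₂ e)
  Out-crosses o X e (t∈ , h∉) eq with o e
  ... | true  = false≢true (trans (sym h∉) (trans (sym eq) t∈))
  ... | false = false≢true (trans (sym h∉) (trans eq t∈))

  local : ∀ c {o o′} → (∀ {e} → e ∈ support c → o e ≡ o′ e) → holds c o → holds c o′
  local (inj₁ j) {o} {o′} agree linked X s with e , e∈ , out ← linked X s =
    e , e∈ , Out-local {o} {o′} {X} (agree e∈) out
  local (inj₂ ((X , L) , covers)) {o} {o′} agree bound proper D D⊇ = bound proper D λ e out →
    D⊇ e (Out-local {o} {o′} {X} (agree (covers e (Out-crosses o X e out))) out)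

  rings : ℕ → List Ring
  rings zero    = []
  rings (suc n) = ring-at n ∷ rings n

  ∈-rings : ∀ {j n} → j < n → ring-at j ∈ rings n
  ∈-rings {j} {suc n} (s≤s j≤n) with ℕ.m≤n⇒m<n∨m≡n j≤n
  ... | inj₁ j<n  = there (∈-rings j<n)
  ... | inj₂ refl = here refl

  rings⁻ : ∀ n {e} → e ∈ concatMap Ring.edges (rings n) → ∃ λ j → j < n × e ∈ Ring.edges (ring-at j)
  rings⁻ (suc n) e∈ with ∈-++⁻ (Ring.edges (ring-at n)) e∈
  ... | inj₁ e∈n = n , ℕ.≤-refl , e∈n
  ... | inj₂ e∈′ with j , j<n , e∈j ← rings⁻ n e∈′ = j , ℕ.m≤n⇒m≤1+n j<n , e∈j

  rings-unique : ∀ n → Unique (concatMap Ring.edges (rings n))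
  rings-unique zero    = []
  rings-unique (suc n) = Unique.++⁺ (annulus-unique (radius n) (radius (suc n))) (rings-unique n)
    λ (e∈n , e∈) → let j , j<n , e∈j = rings⁻ n e∈ in ℕ.<-irrefl (rings-disjoint {j} {n} e∈j e∈n) j<n

  cuts : List Constraint → List (Cut Vertex × List Edge)
  cuts []                   = []
  cuts (inj₁ _ ∷ cs)        = cuts cs
  cuts (inj₂ (XL , _) ∷ cs) = XL ∷ cuts cs

  cuts-cover : ∀ cs {X L} → (X , L) ∈ cuts cs → Covers X L
  cuts-cover (inj₁ _ ∷ cs)            XL∈          = cuts-cover cs XL∈
  cuts-cover (inj₂ (XL , covers) ∷ cs) (here refl) = covers
  cuts-cover (inj₂ _ ∷ cs)            (there XL∈)  = cuts-cover cs XL∈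

  last-ring : List Constraint → ℕ
  last-ring []            = 0
  last-ring (inj₁ j ∷ cs) = suc j ℕ.⊔ last-ring cs
  last-ring (inj₂ _ ∷ cs) = last-ring cs

  -- All rings up to the last one mentioned are used, because constraints may repeat while
  -- `finite-orientation` asks for distinct edges.
  finitely : ∀ cs → ∃ λ o → All (λ c → holds c o) cs
  finitely cs = check (finite-orientation k k>0 large-cuts (rings (last-ring cs)) (rings-unique (last-ring cs)) (cuts cs) (cuts-cover cs))
    where
    satisfied : ∀ o cs {n} → last-ring cs ≤ n → All (Linked o) (rings n) →
      (∀ {X L} → (X , L) ∈ cuts cs → Proper X → OutDegree≥ k o X) → All (λ c → holds c o) cs
    satisfied o []            _  linked out = []
    satisfied o (inj₁ j ∷ cs) le linked out = All.lookup linked (∈-rings (ℕ.≤-trans (ℕ.m≤m⊔n (suc j) (last-ring cs)) le)) ∷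
      satisfied o cs (ℕ.≤-trans (ℕ.m≤n⊔m (suc j) (last-ring cs)) le) linked out
    satisfied o (inj₂ _ ∷ cs) le linked out = out (here refl) ∷ satisfied o cs le linked (out ∘ there)
    check : (∃ λ o → All (Linked o) (rings (last-ring cs)) × (∀ {X L} → (X , L) ∈ cuts cs → Proper X → OutDegree≥ k o X)) →
      ∃ λ o → All (λ c → holds c o) cs
    check (o , linked , out) = o , satisfied o cs ℕ.≤-refl linked out

  exhausts : ∀ e → ∃ λ n → e ∈ concatMap incident (ball n)
  exhausts e = let n , v∈ = spans (end₁ e) in n , ∈-concatMap⁺ incident (lose (listed v∈) (∈-incident (inj₁ refl)))

  orientation : ∃ λ o → ∀ c → holds c o
  orientation = Compactness.compactness {b = b} {ℓ = a ⊔ b} em holds support local finitely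
    (λ n → concatMap incident (ball n)) exhausts

  Goal : Set (a ⊔ b)
  Goal = ∃ λ (O : Orientation G) → ArcConnected k (Orientation.digraph O)

  orient-graph : (∃ λ o → ∀ c → holds c o) → Goal
  orient-graph (o , all) = O , λ u v u≢v → Menger.menger em (Orientation.digraph O) u≢v k λ X Xu Xv D D⊇ →
    InfiniteCut.bound k o (λ j → all (inj₁ j)) (λ X L covers → all (inj₂ ((X , L) , covers))) X Xu Xv D D⊇
    where
    O : Orientation G
    O = record { tail = proj₁ ∘ arc o ; head = proj₂ ∘ arc o ; oriented = arc-joins o }

  goal : Goal
  goal = orient-graph orientation

-- From arc-connected orientations to edge-connectivity

module Backward (em : ExcludedMiddle (a ⊔ b)) (G : Graph a b) (O : Orientation G) (k : ℕ)
    (arc-connected : ArcConnected k (Orientation.digraph O)) where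
  open Graph G
  open Orientation O
  open Digraph digraph using (Leads)

  leaving-arc : (X : Vertex → Bool) → ∀ {x y} (p : Paths.Walk Leads x y) → X x ≡ true → X y ≡ false →
    ∃ λ e → e ∈ Paths.walkEdges Leads p × X (tail e) ≡ true × X (head e) ≡ false
  leaving-arc X Paths.nil Xx Xy = contradiction (trans (sym Xy) Xx) false≢true
  leaving-arc X (Paths.cons {v = z} e (refl , refl) p) Xx Xy with X z in Xz
  ... | false = e , here refl , Xx , Xz
  ... | true  with f , f∈ , out ← leaving-arc X p Xz Xy = f , there f∈ , out

  -- If `F` separated `u` from `v`, the part reachable from `u` would be left by `k` arc-disjoint
  -- paths and entered by `k` others. These cross through `2 * k` distinct edges, all of them in
  -- `F`.
  edge-connected : EdgeConnected (2 * k) G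
  edge-connected F small u v = connect (em {Paths.Walk (Graph.Joins G∖F) u v})
    where
    G∖F : Graph _ _
    G∖F = deleteEdges G F
    open WalkProperties (lower-em a {b} em) (Graph.Joins G∖F) using (snoc; shorten)
    connect : Dec (Paths.Walk (Graph.Joins G∖F) u v) → Paths.Path (Graph.Joins G∖F) u v
    connect (yes p)           = proj₁ (shorten p)
    connect (no disconnected) = contradiction small (ℕ.≤⇒≯ (ℕ.≤-trans (ℕ.≤-reflexive count) (unique-⊆ unique in-F)))
      where
      X : Vertex → Bool
      X w = does (em {Paths.Walk (Graph.Joins G∖F) u w})
      ∈X : ∀ {w} → Paths.Walk (Graph.Joins G∖F) u w → X w ≡ true
      ∈X {w} = dec-true (em {Paths.Walk (Graph.Joins G∖F) u w})
      X⁻ : ∀ {w} → X w ≡ true → Paths.Walk (Graph.Joins G∖F) u w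
      X⁻ {w} = does-true (em {Paths.Walk (Graph.Joins G∖F) u w})
      u∈X : X u ≡ true
      u∈X = ∈X Paths.nil
      v∉X : X v ≡ false
      v∉X = dec-false (em {Paths.Walk (Graph.Joins G∖F) u v}) disconnected
      u≢v : u ≢ v
      u≢v refl = disconnected Paths.nil
      boundary-∈ : ∀ {e x y} → Joins e x y → X x ≡ true → X y ≡ false → e ∈ F
      boundary-∈ {e} j Xx Xy = decidable-stable (lower-em b {a} em) λ e∉F →
        false≢true (trans (sym Xy) (∈X (snoc (X⁻ Xx) (e , e∉F) j)))
      reverse : ∀ {e x y} → Joins e x y → Joins e y x
      reverse (inj₁ p) = inj₂ p
      reverse (inj₂ p) = inj₁ p
      forth = arc-connected u v u≢v
      back  = arc-connected v u (u≢v ∘ sym)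
      out = λ i → leaving-arc X (Paths.Path.walk (proj₁ forth i)) u∈X v∉X
      into = λ i → leaving-arc (not ∘ X) (Paths.Path.walk (proj₁ back i)) (cong not v∉X) (cong not u∈X)
      outs ins crossings : List Edge
      outs = map (proj₁ ∘ out) (allFin k)
      ins  = map (proj₁ ∘ into) (allFin k)
      crossings = outs ++ ins
      out-injective : Injective _≡_ _≡_ (proj₁ ∘ out)
      out-injective {i} {j} eq = decidable-stable (i Fin.≟ j) λ i≢j → proj₂ forth i j i≢j
        (proj₁ (proj₂ (out i)) , subst (_∈ Paths.Path.edges (proj₁ forth j)) (sym eq) (proj₁ (proj₂ (out j))))
      into-injective : Injective _≡_ _≡_ (proj₁ ∘ into)
      into-injective {i} {j} eq = decidable-stable (i Fin.≟ j) λ i≢j → proj₂ back i j i≢j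
        (proj₁ (proj₂ (into i)) , subst (_∈ Paths.Path.edges (proj₁ back j)) (sym eq) (proj₁ (proj₂ (into j))))
      opposite : ∀ i j → proj₁ (out i) ≢ proj₁ (into j)
      opposite i j eq = false≢true (trans (sym (Bool.not-injective (proj₁ (proj₂ (proj₂ (into j))))))
        (subst (λ e → X (tail e) ≡ true) eq (proj₁ (proj₂ (proj₂ (out i))))))
      unique : Unique crossings
      unique = Unique.++⁺ (Unique.map⁺ out-injective (Unique.allFin⁺ k)) (Unique.map⁺ into-injective (Unique.allFin⁺ k))
        λ (e∈outs , e∈ins) → let i , _ , eq = ∈-map⁻ (proj₁ ∘ out) e∈outs ; j , _ , eq′ = ∈-map⁻ (proj₁ ∘ into) e∈ins
                             in opposite i j (trans (sym eq) eq′)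
      in-F : ∀ {e} → e ∈ crossings → e ∈ F
      in-F e∈ with ∈-++⁻ outs e∈
      ... | inj₁ e∈outs with i , _ , refl ← ∈-map⁻ (proj₁ ∘ out) e∈outs =
        boundary-∈ (oriented _) (proj₁ (proj₂ (proj₂ (out i)))) (proj₂ (proj₂ (proj₂ (out i))))
      ... | inj₂ e∈ins with j , _ , refl ← ∈-map⁻ (proj₁ ∘ into) e∈ins =
        boundary-∈ (reverse (oriented _)) (Bool.not-injective (proj₂ (proj₂ (proj₂ (into j))))) (Bool.not-injective (proj₁ (proj₂ (proj₂ (into j)))))
      count : 2 * k ≡ length crossings
      count = trans (2*≡ k) (sym (trans (List.length-++ outs) (cong₂ _+_ (size (proj₁ ∘ out)) (size (proj₁ ∘ into)))))
        where
        size : (f : Fin k → Edge) → length (map f (allFin k)) ≡ k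
        size f = trans (List.length-map f (allFin k)) (List.length-tabulate id)

theorem6p1 : ∀ {a b} → ExcludedMiddle (a ⊔ b) →
    (G : Graph a b) → LocallyFinite G → CountablyManyEnds G →
    (k : ℕ) .{{_ : NonZero k}} →
    EdgeConnected (2 * k) G ⇔ (∃ λ (O : Orientation G) → ArcConnected k (Orientation.digraph O))
theorem6p1 {a} {b} em G locally-finite (index , _ , index-injective) k = mk⇔ forward
  (λ (O , arc-connected) → Backward.edge-connected em G O k arc-connected)
  where
  open Graph G
  forward : EdgeConnected (2 * k) G → ∃ λ (O : Orientation G) → ArcConnected k (Orientation.digraph O)
  forward connected with lower-em a {b} em {Vertex}
  ... | yes root = Forward.goal em G locally-finite index index-injective k (>-nonZero⁻¹ k) connected root
  -- Without a vertex there is no root for the balls, but then any orientation will do.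
  ... | no empty = record { tail = end₁ ; head = end₂ ; oriented = λ e → inj₁ (refl , refl) } ,
                   λ v → contradiction v empty
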